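{- There exists $n_0$ such that for every integer $n\geq n_0$ divisible by $3$ the following holds. Let $G$ be a triangle-free graph on $n$ vertices. Then \[ D_3^b(G)\leq \frac{n^2}{36}. \] Additionally, if $D_3^b(G)=\frac{n^2}{36}$, then $G\cong K_{\frac{5n}{6},\frac{n}{6}}$ or $G\cong K_{\frac{n}{2},\frac{n}{2}}$.
   Context: For a graph $G$ and $A\subseteq V(G)$, $e(A)$ denotes the number of edges of $G$ with both endpoints in $A$. A $k$-partition $V(G)=A_1\cup\dots\cup A_k$ is balanced if $|A_i|=|A_j|$ for all $i,j$. $D_k^b(G)=\min \sum_{i=1}^k e(A_i)$, where the minimum is over all balanced $k$-partitions of $V(G)$. $K_{a,b}$ is the complete bipartite graph with class sizes $a$ and $b$. -}

module Defs where

open import Data.Nat using (ℕ; _+_; _*_; _<ᵇ_; _≤_; _^_)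
open import Data.Bool using (Bool; true; false; _∧_; if_then_else_)
open import Data.Fin using (Fin; toℕ; _≟_)
open import Data.List using (List; allFin; map; length; filterᵇ)
open import Data.Nat.ListAction using (sum)
open import Data.Product using (Σ; _×_; _,_)
open import Relation.Nullary using (¬_)
open import Relation.Nullary.Decidable using (⌊_⌋)
open import Relation.Binary.PropositionalEquality using (_≡_)
open import Function.Bundles using (_↔_; Inverse)

record Graph (n : ℕ) : Set where
  field
    adj   : Fin n → Fin n → Bool
    sym   : ∀ i j → adj i j ≡ adj j i
    irref : ∀ i → adj i i ≡ false
open Graph public

TriangleFree : ∀ {n} → Graph n → Set
TriangleFree G = ∀ i j k → ¬ (adj G i j ≡ true × adj G j k ≡ true × adj G i k ≡ true)

Partition3 : ℕ → Set
Partition3 n = Fin n → Fin 3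

classSize : ∀ {n} → Partition3 n → Fin 3 → ℕ
classSize {n} p c = length (filterᵇ (λ i → ⌊ p i ≟ c ⌋) (allFin n))

Balanced : ∀ {n} → Partition3 n → Set
Balanced {n} p = ∀ c d → classSize p c ≡ classSize p d

inside : ∀ {n} → Graph n → Partition3 n → Fin n → Fin n → ℕ
inside G p i j =
  if adj G i j ∧ (toℕ i <ᵇ toℕ j) ∧ ⌊ p i ≟ p j ⌋ then 1 else 0

internalEdges : ∀ {n} → Graph n → Partition3 n → ℕ
internalEdges {n} G p =
  sum (map (λ i → sum (map (λ j → inside G p i j) (allFin n))) (allFin n))

IsD3b : ∀ {n} → Graph n → ℕ → Set
IsD3b {n} G d =
  (Σ (Partition3 n) λ p → Balanced p × internalEdges G p ≡ d)
  × (∀ (p : Partition3 n) → Balanced p → d ≤ internalEdges G p)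

KBip : (n a : ℕ) → Graph n
KBip n a = record
  { adj = λ i j → xor (toℕ i <ᵇ a) (toℕ j <ᵇ a)
  ; sym = λ i j → xor-comm (toℕ i <ᵇ a) (toℕ j <ᵇ a)
  ; irref = λ i → xor-self (toℕ i <ᵇ a)
  }
  where
  open import Relation.Binary.PropositionalEquality using (refl)
  xor : Bool → Bool → Bool
  xor true true = false
  xor true false = true
  xor false true = true
  xor false false = false
  xor-comm : ∀ x y → xor x y ≡ xor y x
  xor-comm true true = refl
  xor-comm true false = refl
  xor-comm false true = refl
  xor-comm false false = refl
  xor-self : ∀ x → xor x x ≡ false
  xor-self true = refl
  xor-self false = refl

_≅_ : ∀ {n} → Graph n → Graph n → Set
_≅_ {n} G H = Σ (Fin n ↔ Fin n) λ σ →
  ∀ i j → adj G i j ≡ adj H (Inverse.to σ i) (Inverse.to σ j)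

module Submission where

-- Write n = 3m and let D be twice the least number of internal edges, so that the bound reads 2D ≤ m².
--
-- Suppose first that some degree is at least m. Then m neighbours of such a vertex, an independent set, can serve
-- as one part. If all degrees in the remaining graph are below m, that graph has a halving with fewer than m²/4
-- edges: put the neighbourhood of a vertex into one half, split the other vertices at random, and average over
-- the vertices. Otherwise a second part can be chosen independent too, and Mantel's theorem bounds the third.
-- Equality makes the third part a K_{m/2,m/2}; moving m/2 vertices at a time between the parts then shows that
-- each independent part is joined completely to one side of it and not at all to the other.
--
-- Suppose now that all degrees are below m and that 2D ≥ m². For an edge uv put I = N(u), J = N(v), and let C be
-- the set of the other vertices. Filling up both I and J at random from C, filling up one of them and halving the
-- rest, and taking a random m-subset of C and halving the rest give inequalities in the numbers of edges. Summing
-- a combination of them over all edges with weights 1 / (d(u) w(u) d(v) w(v)), w(x) = 7m − 5 d(x), eliminates the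
-- sums of the degrees of the neighbours. What remains is a polynomial inequality in d(u), d(v), the number of
-- edges and m; it is verified by cutting the domain into cones, on each of which all coefficients have the right
-- sign after a linear change of variables.

open import Defs hiding (sym)
open import Data.Nat as ℕ using (ℕ; zero; suc; _!)
import Data.Nat.Properties as ℕₚ
open import Data.Nat.Divisibility using (∣-trans; m≤n⇒m!∣n!; m∣m*n)
open import Data.Nat.DivMod using (_/_; m/n*n≡m)
open import Data.Nat.ListAction using (sum)
import Data.Nat.Tactic.RingSolver as ℕ-Solver
open import Data.Integer hiding (suc; _/_)
open import Data.Integer.Properties
open import Data.Integer.Tactic.RingSolver using (solve-∀)
open import Data.Bool using (Bool; true; false; not; if_then_else_; _∧_; _∨_) renaming (T to IsTrue)
open import Data.Bool.Properties using (T-∧; T-∨)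
open import Data.Fin using (Fin; zero; suc; toℕ; fromℕ; punchIn) renaming (_≟_ to _≟ᶠ_)
open import Data.Fin.Patterns using (0F; 1F; 2F)
import Data.Fin.Properties as Finₚ
open import Data.Fin.Permutation using (Permutation; insert; insert-punchIn; _⟨$⟩ʳ_) renaming (id to idₚ)
open import Data.List using (List; []; _∷_; _++_; length; filterᵇ; take; drop; map; allFin; tabulate; cartesianProductWith)
open import Data.List.Properties using (++-assoc; take++drop≡id; length-take; length-drop; length-++; length-tabulate; map-cong)
open import Data.List.Membership.Propositional using (_∈_)
open import Data.List.Membership.Propositional.Properties using (∈-++⁻; ∈-allFin; ∈-cartesianProductWith⁺)
open import Data.List.Relation.Unary.Any using (here; there)
open import Data.Vec as Vec using (Vec; []; _∷_; _∷ʳ_)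
open import Data.Product using (Σ; _×_; _,_; proj₁; proj₂)
open import Data.Sum using (_⊎_; inj₁; inj₂)
open import Data.Unit using (⊤; tt)
open import Data.Empty using (⊥; ⊥-elim)
open import Function.Bundles using (Equivalence)
open import Relation.Nullary using (¬_; Dec; yes; no; does)
open import Relation.Nullary.Decidable using (⌊_⌋)
open import Relation.Binary.Definitions using (tri<; tri≈; tri>)
open import Relation.Binary.PropositionalEquality hiding (J)

-- Sums over lists

-- When all degrees are small, the obstacle is that every random splitting brings in S(v), the sum
-- of the degrees of the neighbours of v, which no local data control. But S(v) is exactly the mean
-- of d(u)d(v) over the neighbours u of v. Hence an edge inequality in which S(v) has a coefficient
-- of the form f(u)g(v) can be divided by f(u), and S(v) can then be traded for d(u)d(v). The
-- combination of splittings that eliminates the number of edges inside C has this product form: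
-- with α = m - d(u), the number of edges avoiding N(v) gets, up to a common factor, the coefficient
-- (2m + 5α) d(v), and 2m + 5α = 7m - 5 d(u) is the origin of w. Both extremal graphs have vertices
-- of degree at least m. The averaging arguments therefore only treat cases in which the inequality
-- is strict, and rounded constants such as those of the tangent line do no harm.

2ℤ : ℤ
2ℤ = + 2

≤⇒0≤- : ∀ {x y} → x ≤ y → 0ℤ ≤ y - x
≤⇒0≤- = i≤j⇒0≤j-i

0≤-⇒≤ : ∀ {x y} → 0ℤ ≤ y - x → x ≤ y
0≤-⇒≤ = 0≤i-j⇒j≤i

0≤+ : ∀ {x y} → 0ℤ ≤ x → 0ℤ ≤ y → 0ℤ ≤ x + y
0≤+ = +-mono-≤

0≤* : ∀ {x y} → 0ℤ ≤ x → 0ℤ ≤ y → 0ℤ ≤ x * y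
0≤* {+ a} {+ b} _ _ = subst (0ℤ ≤_) (pos-* a b) (+≤+ ℕ.z≤n)

0≤² : ∀ x → 0ℤ ≤ x * x
0≤² (+ a)      = 0≤* {+ a} {+ a} (+≤+ ℕ.z≤n) (+≤+ ℕ.z≤n)
0≤² (-[1+ a ]) = +≤+ ℕ.z≤n

x²≡0⇒x≡0 : ∀ x → x * x ≡ 0ℤ → x ≡ 0ℤ
x²≡0⇒x≡0 x e with i*j≡0⇒i≡0∨j≡0 x e
... | inj₁ p = p
... | inj₂ p = p

0≤+ℕ : ∀ n → 0ℤ ≤ + n
0≤+ℕ n = +≤+ ℕ.z≤n

-- Every linear or polynomial inequality below is derived by exhibiting its slack.
≤-slack : ∀ {x y} z → 0ℤ ≤ z → y - x ≡ z → x ≤ y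
≤-slack z 0≤z eq = 0≤-⇒≤ (subst (0ℤ ≤_) (sym eq) 0≤z)

*-mono-0≤ : ∀ {k x y} → 0ℤ ≤ k → x ≤ y → k * x ≤ k * y
*-mono-0≤ {k} {x} {y} 0≤k x≤y = ≤-slack _ (0≤* 0≤k (≤⇒0≤- x≤y)) (lem k x y)
  where
  lem : ∀ k x y → k * y - k * x ≡ k * (y - x)
  lem = solve-∀

0<⇒1≤ : ∀ {x} → 0ℤ < x → 1ℤ ≤ x
0<⇒1≤ (+<+ (ℕ.s≤s p)) = +≤+ (ℕ.s≤s ℕ.z≤n)

0<* : ∀ {x y} → 0ℤ < x → 0ℤ < y → 0ℤ < x * y
0<* {+ suc a} {+ suc b} _ _ = +<+ (ℕ.s≤s ℕ.z≤n)
0<* {+ zero} (+<+ ()) _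
0<* {+ suc a} {+ zero} _ (+<+ ())

*-cancel-0< : ∀ {k x y} → 0ℤ < k → k * x ≤ k * y → x ≤ y
*-cancel-0< {+ suc k} _ p = *-cancelˡ-≤-pos _ _ (+ suc k) p
*-cancel-0< {+ zero} (+<+ ()) _

0≤-cancel : ∀ {k x} → 0ℤ < k → 0ℤ ≤ k * x → 0ℤ ≤ x
0≤-cancel {k} {x} 0<k p = *-cancel-0< 0<k (subst (_≤ k * x) (sym (*-zeroʳ k)) p)

module _ {V : Set} where

  ∑ : List V → (V → ℤ) → ℤ
  ∑ []       f = 0ℤ
  ∑ (x ∷ xs) f = f x + ∑ xs f

  # : List V → ℤ
  # xs = + length xs

  ∑-cong : ∀ xs {f g : V → ℤ} → (∀ x → f x ≡ g x) → ∑ xs f ≡ ∑ xs g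
  ∑-cong []       h = refl
  ∑-cong (x ∷ xs) h = cong₂ _+_ (h x) (∑-cong xs h)

  ∑-cong∈ : ∀ xs {f g : V → ℤ} → (∀ x → x ∈ xs → f x ≡ g x) → ∑ xs f ≡ ∑ xs g
  ∑-cong∈ []       h = refl
  ∑-cong∈ (x ∷ xs) h = cong₂ _+_ (h x (here refl)) (∑-cong∈ xs λ y p → h y (there p))

  ∑-mono∈ : ∀ xs {f g : V → ℤ} → (∀ x → x ∈ xs → f x ≤ g x) → ∑ xs f ≤ ∑ xs g
  ∑-mono∈ []       h = ≤-refl
  ∑-mono∈ (x ∷ xs) h = +-mono-≤ (h x (here refl)) (∑-mono∈ xs λ y p → h y (there p))

  ∑-mono : ∀ xs {f g : V → ℤ} → (∀ x → f x ≤ g x) → ∑ xs f ≤ ∑ xs g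
  ∑-mono xs h = ∑-mono∈ xs λ x _ → h x

  ∑-+ : ∀ xs (f g : V → ℤ) → ∑ xs (λ x → f x + g x) ≡ ∑ xs f + ∑ xs g
  ∑-+ []       f g = refl
  ∑-+ (x ∷ xs) f g = trans (cong (_+_ (f x + g x)) (∑-+ xs f g)) (lem (f x) (g x) (∑ xs f) (∑ xs g))
    where
    lem : ∀ a b c d → (a + b) + (c + d) ≡ (a + c) + (b + d)
    lem = solve-∀

  ∑-* : ∀ xs k (f : V → ℤ) → ∑ xs (λ x → k * f x) ≡ k * ∑ xs f
  ∑-* []       k f = sym (*-zeroʳ k)
  ∑-* (x ∷ xs) k f = trans (cong (_+_ (k * f x)) (∑-* xs k f)) (sym (*-distribˡ-+ k (f x) (∑ xs f)))

  ∑-*ʳ : ∀ xs k (f : V → ℤ) → ∑ xs (λ x → f x * k) ≡ ∑ xs f * k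
  ∑-*ʳ xs k f = trans (∑-cong xs λ x → *-comm (f x) k) (trans (∑-* xs k f) (*-comm k _))

  ∑-0 : ∀ xs → ∑ xs (λ _ → 0ℤ) ≡ 0ℤ
  ∑-0 []       = refl
  ∑-0 (x ∷ xs) = trans (+-identityˡ _) (∑-0 xs)

  ∑-const : ∀ xs k → ∑ xs (λ _ → k) ≡ # xs * k
  ∑-const []       k = refl
  ∑-const (x ∷ xs) k = trans (cong (_+_ k) (∑-const xs k)) (lem k (# xs))
    where
    lem : ∀ k n → k + n * k ≡ (1ℤ + n) * k
    lem = solve-∀

  ∑-++ : ∀ xs ys (f : V → ℤ) → ∑ (xs ++ ys) f ≡ ∑ xs f + ∑ ys f
  ∑-++ []       ys f = sym (+-identityˡ _)
  ∑-++ (x ∷ xs) ys f = trans (cong (_+_ (f x)) (∑-++ xs ys f)) (sym (+-assoc (f x) _ _))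

  0≤∑ : ∀ xs {f : V → ℤ} → (∀ x → 0ℤ ≤ f x) → 0ℤ ≤ ∑ xs f
  0≤∑ []       h = ≤-refl
  0≤∑ (x ∷ xs) h = 0≤+ (h x) (0≤∑ xs h)

  0≤∑∈ : ∀ xs {f : V → ℤ} → (∀ x → x ∈ xs → 0ℤ ≤ f x) → 0ℤ ≤ ∑ xs f
  0≤∑∈ xs {f} h = subst (_≤ ∑ xs f) (∑-0 xs) (∑-mono∈ xs h)

  -- Lists are only ever compared through sums over them, so that the order of the elements never matters.
  infix 4 _≋_
  record _≋_ (xs ys : List V) : Set where
    constructor ≋-by
    field ∑≡ : ∀ (f : V → ℤ) → ∑ xs f ≡ ∑ ys f
  open _≋_ public

  ≋-refl : ∀ {xs} → xs ≋ xs
  ≋-refl = ≋-by λ _ → refl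

  ≋-sym : ∀ {xs ys} → xs ≋ ys → ys ≋ xs
  ≋-sym p = ≋-by λ f → sym (∑≡ p f)

  ≋-trans : ∀ {xs ys zs} → xs ≋ ys → ys ≋ zs → xs ≋ zs
  ≋-trans p q = ≋-by λ f → trans (∑≡ p f) (∑≡ q f)

  ≋-++ : ∀ {xs xs′ ys ys′} → xs ≋ xs′ → ys ≋ ys′ → xs ++ ys ≋ xs′ ++ ys′
  ≋-++ {xs} {xs′} {ys} {ys′} p q = ≋-by λ f →
    trans (∑-++ xs ys f) (trans (cong₂ _+_ (∑≡ p f) (∑≡ q f)) (sym (∑-++ xs′ ys′ f)))

  ≋-comm : ∀ xs ys → xs ++ ys ≋ ys ++ xs
  ≋-comm xs ys = ≋-by λ f → trans (∑-++ xs ys f) (trans (+-comm (∑ xs f) _) (sym (∑-++ ys xs f)))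

  ≋-assoc : ∀ xs ys zs → (xs ++ ys) ++ zs ≋ xs ++ (ys ++ zs)
  ≋-assoc xs ys zs = ≋-by λ f → cong (λ l → ∑ l f) (++-assoc xs ys zs)

  ≋-# : ∀ {xs ys} → xs ≋ ys → # xs ≡ # ys
  ≋-# {xs} {ys} p = trans (sym (one xs)) (trans (∑≡ p (λ _ → 1ℤ)) (one ys))
    where
    one : ∀ zs → ∑ zs (λ _ → 1ℤ) ≡ # zs
    one zs = trans (∑-const zs 1ℤ) (*-identityʳ (# zs))

  #-++ : ∀ xs ys → # (xs ++ ys) ≡ # xs + # ys
  #-++ []       ys = sym (+-identityˡ _)
  #-++ (x ∷ xs) ys = trans (cong (_+_ 1ℤ) (#-++ xs ys)) (sym (+-assoc 1ℤ (# xs) (# ys)))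

∑-swap : ∀ {V W : Set} (xs : List V) (ys : List W) (f : V → W → ℤ) →
         ∑ xs (λ x → ∑ ys (f x)) ≡ ∑ ys (λ y → ∑ xs (λ x → f x y))
∑-swap []       ys f = sym (∑-0 ys)
∑-swap (x ∷ xs) ys f = trans (cong (_+_ (∑ ys (f x))) (∑-swap xs ys f)) (sym (∑-+ ys (f x) _))

-- Edge counts and random splittings

-- binom r s = (r + s)! / (r! s!), and binom with one or two of its arguments lowered (0 when impossible).
binom : ℕ → ℕ → ℤ
binom zero    s       = 1ℤ
binom (suc r) zero    = 1ℤ
binom (suc r) (suc s) = binom r (suc s) + binom (suc r) s

binom₁ : ℕ → ℕ → ℤ
binom₁ zero    s = 0ℤ
binom₁ (suc r) s = binom r s

binom¹ : ℕ → ℕ → ℤ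
binom¹ r zero    = 0ℤ
binom¹ r (suc s) = binom r s

binom₂ : ℕ → ℕ → ℤ
binom₂ zero    s = 0ℤ
binom₂ (suc r) s = binom₁ r s

binom² : ℕ → ℕ → ℤ
binom² r zero    = 0ℤ
binom² r (suc s) = binom¹ r s

binom-r0 : ∀ r → binom r 0 ≡ 1ℤ
binom-r0 zero    = refl
binom-r0 (suc r) = refl

pascal₁ : ∀ r s → binom₁ r (suc s) + binom r s ≡ binom r (suc s)
pascal₁ zero    s = refl
pascal₁ (suc r) s = refl

pascal¹ : ∀ r s → binom r s + binom¹ (suc r) s ≡ binom (suc r) s
pascal¹ r zero    = trans (+-identityʳ _) (binom-r0 r)
pascal¹ r (suc s) = refl

pascal₂ : ∀ r s → binom₂ r (suc s) + binom₁ r s ≡ binom₁ r (suc s)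
pascal₂ zero    s = refl
pascal₂ (suc r) s = pascal₁ r s

pascal² : ∀ r s → binom¹ r s + binom² (suc r) s ≡ binom¹ (suc r) s
pascal² r zero    = refl
pascal² r (suc s) = pascal¹ r s

binom>0 : ∀ r s → 0ℤ < binom r s
binom>0 zero    s       = +<+ (ℕ.s≤s ℕ.z≤n)
binom>0 (suc r) zero    = +<+ (ℕ.s≤s ℕ.z≤n)
binom>0 (suc r) (suc s) = +-mono-< (binom>0 r (suc s)) (binom>0 (suc r) s)

-- The two identities form one induction: the Pascal step for either of them uses both at the
-- smaller pair.
absorption : ∀ r s → (1ℤ + + r + + s) * binom r s ≡ (1ℤ + + r) * binom (suc r) s
                   × (1ℤ + + r + + s) * binom r s ≡ (1ℤ + + s) * binom r (suc s)
absorption r s = left r s , right r s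
  where
  step : ∀ a b x y z → (1ℤ + a + b) * z ≡ (1ℤ + a) * x → (1ℤ + a + b) * z ≡ (1ℤ + b) * y →
         (1ℤ + a + (1ℤ + b)) * y ≡ (1ℤ + a) * (y + x) × (1ℤ + (1ℤ + a) + b) * x ≡ (1ℤ + b) * (y + x)
  step a b x y z p q =
      trans (l₁ a b y) (trans (cong (_+_ ((1ℤ + a) * y)) (trans (sym q) p)) (l₂ a x y))
    , trans (l₃ a b x) (trans (cong (_+_ ((1ℤ + b) * x)) (trans (sym p) q)) (l₄ b x y))
    where
    l₁ : ∀ a b y → (1ℤ + a + (1ℤ + b)) * y ≡ (1ℤ + a) * y + (1ℤ + b) * y
    l₁ = solve-∀
    l₂ : ∀ a x y → (1ℤ + a) * y + (1ℤ + a) * x ≡ (1ℤ + a) * (y + x)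
    l₂ = solve-∀
    l₃ : ∀ a b x → (1ℤ + (1ℤ + a) + b) * x ≡ (1ℤ + b) * x + (1ℤ + a) * x
    l₃ = solve-∀
    l₄ : ∀ b x y → (1ℤ + b) * x + (1ℤ + b) * y ≡ (1ℤ + b) * (y + x)
    l₄ = solve-∀

  left : ∀ r s → (1ℤ + + r + + s) * binom r s ≡ (1ℤ + + r) * binom (suc r) s
  right : ∀ r s → (1ℤ + + r + + s) * binom r s ≡ (1ℤ + + s) * binom r (suc s)
  left r zero    = trans (cong ((1ℤ + + r + + 0) *_) (binom-r0 r)) (l (+ r))
    where
    l : ∀ r → (1ℤ + r + + 0) * 1ℤ ≡ (1ℤ + r) * 1ℤ
    l = solve-∀
  left r (suc s) = proj₁ (step (+ r) (+ s) (binom (suc r) s) (binom r (suc s)) (binom r s) (left r s) (right r s))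
  right zero    s = refl
  right (suc r) s = proj₂ (step (+ r) (+ s) (binom (suc r) s) (binom r (suc s)) (binom r s) (left r s) (right r s))

-- The quotient of `binom₁` by `binom` is the probability r / (r + s) that a given element falls
-- into the part of size r of a random split. The next three lemmas treat the other part, and two
-- given elements falling into the same part.
binom₁-ratio : ∀ r s → (+ r + + s) * binom₁ r s ≡ + r * binom r s
binom₁-ratio zero    s = *-zeroʳ (+ 0 + + s)
binom₁-ratio (suc r) s = proj₁ (absorption r s)

binom¹-ratio : ∀ r s → (+ r + + s) * binom¹ r s ≡ + s * binom r s
binom¹-ratio r zero    = *-zeroʳ (+ r + + 0)
binom¹-ratio r (suc s) = trans (cong (_* binom r s) (l (+ r) (+ s))) (proj₂ (absorption r s))
  where
  l : ∀ r s → r + (1ℤ + s) ≡ 1ℤ + r + s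
  l = solve-∀

binom₂-ratio : ∀ r s → (+ r + + s) * (+ r + + s - 1ℤ) * binom₂ r s ≡ + r * (+ r - 1ℤ) * binom r s
binom₂-ratio zero s = *-zeroʳ ((+ 0 + + s) * (+ 0 + + s - 1ℤ))
binom₂-ratio (suc r) s = begin
  (1ℤ + + r + + s) * (1ℤ + + r + + s - 1ℤ) * binom₁ r s ≡⟨ l₁ (+ r) (+ s) (binom₁ r s) ⟩
  (1ℤ + + r + + s) * ((+ r + + s) * binom₁ r s)         ≡⟨ cong ((1ℤ + + r + + s) *_) (binom₁-ratio r s) ⟩
  (1ℤ + + r + + s) * (+ r * binom r s)                  ≡⟨ l₂ (1ℤ + + r + + s) (+ r) (binom r s) ⟩
  + r * ((1ℤ + + r + + s) * binom r s)                  ≡⟨ cong (+ r *_) (proj₁ (absorption r s)) ⟩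
  + r * ((1ℤ + + r) * binom (suc r) s)                  ≡⟨ l₃ (+ r) (binom (suc r) s) ⟩
  (1ℤ + + r) * (1ℤ + + r - 1ℤ) * binom (suc r) s        ∎
  where
  open ≡-Reasoning
  l₁ : ∀ r s x → (1ℤ + r + s) * (1ℤ + r + s - 1ℤ) * x ≡ (1ℤ + r + s) * ((r + s) * x)
  l₁ = solve-∀
  l₂ : ∀ a b c → a * (b * c) ≡ b * (a * c)
  l₂ = solve-∀
  l₃ : ∀ r x → r * ((1ℤ + r) * x) ≡ (1ℤ + r) * (1ℤ + r - 1ℤ) * x
  l₃ = solve-∀

binom²-ratio : ∀ r s → (+ r + + s) * (+ r + + s - 1ℤ) * binom² r s ≡ + s * (+ s - 1ℤ) * binom r s
binom²-ratio r zero = *-zeroʳ ((+ r + + 0) * (+ r + + 0 - 1ℤ))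
binom²-ratio r (suc s) = begin
  (+ r + (1ℤ + + s)) * (+ r + (1ℤ + + s) - 1ℤ) * binom¹ r s ≡⟨ l₁ (+ r) (+ s) (binom¹ r s) ⟩
  (1ℤ + + r + + s) * ((+ r + + s) * binom¹ r s)         ≡⟨ cong ((1ℤ + + r + + s) *_) (binom¹-ratio r s) ⟩
  (1ℤ + + r + + s) * (+ s * binom r s)                  ≡⟨ l₂ (1ℤ + + r + + s) (+ s) (binom r s) ⟩
  + s * ((1ℤ + + r + + s) * binom r s)                  ≡⟨ cong (+ s *_) (proj₂ (absorption r s)) ⟩
  + s * ((1ℤ + + s) * binom r (suc s))                  ≡⟨ l₃ (+ s) (binom r (suc s)) ⟩
  (1ℤ + + s) * (1ℤ + + s - 1ℤ) * binom r (suc s)        ∎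
  where
  open ≡-Reasoning
  l₁ : ∀ r s x → (r + (1ℤ + s)) * (r + (1ℤ + s) - 1ℤ) * x ≡ (1ℤ + r + s) * ((r + s) * x)
  l₁ = solve-∀
  l₂ : ∀ a b c → a * (b * c) ≡ b * (a * c)
  l₂ = solve-∀
  l₃ : ∀ r x → r * ((1ℤ + r) * x) ≡ (1ℤ + r) * (1ℤ + r - 1ℤ) * x
  l₃ = solve-∀

module Edges {V : Set} (A : V → V → ℤ) (A-sym : ∀ x y → A x y ≡ A y x)
             (A-irr : ∀ x → A x x ≡ 0ℤ) (A≥0 : ∀ x y → 0ℤ ≤ A x y) where

  deg : List V → V → ℤ
  deg xs x = ∑ xs (A x)

  E : List V → List V → ℤ
  E xs ys = ∑ xs (deg ys)

  -- Twice the number of edges inside xs.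
  Q : List V → ℤ
  Q xs = E xs xs

  E-sym : ∀ xs ys → E xs ys ≡ E ys xs
  E-sym xs ys = trans (∑-swap xs ys A) (∑-cong ys λ y → ∑-cong xs λ x → A-sym x y)

  0≤deg : ∀ xs x → 0ℤ ≤ deg xs x
  0≤deg xs x = 0≤∑ xs (A≥0 x)

  0≤E : ∀ xs ys → 0ℤ ≤ E xs ys
  0≤E xs ys = 0≤∑ xs (0≤deg ys)

  0≤Q : ∀ xs → 0ℤ ≤ Q xs
  0≤Q xs = 0≤E xs xs

  deg-++ : ∀ xs ys v → deg (xs ++ ys) v ≡ deg xs v + deg ys v
  deg-++ xs ys v = ∑-++ xs ys (A v)

  E-++ˡ : ∀ xs ys zs → E (xs ++ ys) zs ≡ E xs zs + E ys zs
  E-++ˡ xs ys zs = ∑-++ xs ys (deg zs)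

  E-++ʳ : ∀ xs ys zs → E zs (xs ++ ys) ≡ E zs xs + E zs ys
  E-++ʳ xs ys zs = trans (∑-cong zs (deg-++ xs ys)) (∑-+ zs (deg xs) (deg ys))

  Q-++ : ∀ xs ys → Q (xs ++ ys) ≡ Q xs + 2ℤ * E xs ys + Q ys
  Q-++ xs ys = begin
    E (xs ++ ys) (xs ++ ys)                              ≡⟨ E-++ˡ xs ys (xs ++ ys) ⟩
    E xs (xs ++ ys) + E ys (xs ++ ys)                    ≡⟨ cong₂ _+_ (E-++ʳ xs ys xs) (E-++ʳ xs ys ys) ⟩
    (Q xs + E xs ys) + (E ys xs + Q ys)                  ≡⟨ cong (λ e → (Q xs + E xs ys) + (e + Q ys)) (E-sym ys xs) ⟩
    (Q xs + E xs ys) + (E xs ys + Q ys)                  ≡⟨ l (Q xs) (E xs ys) (Q ys) ⟩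
    Q xs + 2ℤ * E xs ys + Q ys ∎
    where
    open ≡-Reasoning
    l : ∀ a b c → (a + b) + (b + c) ≡ a + + 2 * b + c
    l = solve-∀

  Q-∷ : ∀ x xs → Q (x ∷ xs) ≡ 2ℤ * deg xs x + Q xs
  Q-∷ x xs = trans (Q-++ (x ∷ []) xs) (trans (cong (λ a → (a + 0ℤ) + 0ℤ + 2ℤ * (deg xs x + 0ℤ) + Q xs) (A-irr x)) (l (deg xs x) (Q xs)))
    where
    l : ∀ d q → (0ℤ + 0ℤ) + 0ℤ + + 2 * (d + 0ℤ) + q ≡ + 2 * d + q
    l = solve-∀

  deg-≋ : ∀ {xs ys} → xs ≋ ys → ∀ v → deg xs v ≡ deg ys v
  deg-≋ p v = ∑≡ p (A v)

  E-≋ : ∀ {xs xs′ ys ys′} → xs ≋ xs′ → ys ≋ ys′ → E xs ys ≡ E xs′ ys′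
  E-≋ {xs} {xs′} {ys} {ys′} p q = trans (∑≡ p (deg ys)) (∑-cong xs′ (deg-≋ q))

  Q-≋ : ∀ {xs ys} → xs ≋ ys → Q xs ≡ Q ys
  Q-≋ p = E-≋ p p

-- M! / d for 1 ≤ d ≤ M, and 0 otherwise.
recip : ℕ → ℤ → ℤ
recip M (+ suc k)  = + ((M !) / suc k)
recip M _          = 0ℤ

0≤recip : ∀ M d → 0ℤ ≤ recip M d
0≤recip M (+ zero)   = ≤-refl
0≤recip M (+ suc k)  = +≤+ ℕ.z≤n
0≤recip M (-[1+ k ]) = ≤-refl

-- This is what allows weights 1 / d in integer sums: one constant M! clears the denominators of all
-- degrees from 1 to M.
recip-* : ∀ M d → 1ℤ ≤ d → d ≤ + M → recip M d * d ≡ + (M !)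
recip-* M (+ suc k) 1≤d (+≤+ d≤M) =
  trans (sym (pos-* ((M !) / suc k) (suc k))) (cong +_ (m/n*n≡m (∣-trans (m∣m*n (k !)) (m≤n⇒m!∣n! d≤M))))
recip-* M (+ zero) (+≤+ ()) _

0<! : ∀ M → 0ℤ < + (M !)
0<! M = +<+ (ℕₚ.n≢0⇒n>0 (ℕ.≢-nonZero⁻¹ (M !) {{ℕₚ._!≢0 M}}))

-- Turns equality in an average into equality at every vertex: the slacks are nonnegative and their
-- sum is at most 0.
∑-≡-split : ∀ {V : Set} (xs : List V) (P : V → ℤ) (R : V → ℤ) → (∀ x → x ∈ xs → P x ≤ R x) →
            ∑ xs R ≤ ∑ xs P → ∀ x → x ∈ xs → P x ≡ R x
∑-≡-split (y ∷ xs) P R h le x m = go m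
  where
  hd : P y ≤ R y
  hd = h y (here refl)
  tl : ∑ xs P ≤ ∑ xs R
  tl = ∑-mono∈ xs λ z p → h z (there p)
  l₁ : ∀ p r a b → p - r ≡ ((p + a) - (r + b)) + (b - a)
  l₁ = solve-∀
  l₂ : ∀ p r a b → a - b ≡ ((p + a) - (r + b)) + (r - p)
  l₂ = solve-∀
  go : ∀ {x} → x ∈ y ∷ xs → P x ≡ R x
  go (here refl) = ≤-antisym hd (≤-slack _ (0≤+ (≤⇒0≤- le) (≤⇒0≤- tl)) (l₁ (P y) (R y) (∑ xs P) (∑ xs R)))
  go (there p)   = ∑-≡-split xs P R (λ z q → h z (there q))
    (≤-slack _ (0≤+ (≤⇒0≤- le) (≤⇒0≤- hd)) (l₂ (P y) (R y) (∑ xs P) (∑ xs R))) _ p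

filter-≋ : ∀ {V : Set} (p : V → Bool) xs → xs ≋ filterᵇ p xs ++ filterᵇ (λ x → not (p x)) xs
filter-≋ p xs = ≋-by λ f → trans (go f xs) (sym (∑-++ (filterᵇ p xs) _ f))
  where
  l : ∀ a b c → a + (b + c) ≡ b + (a + c)
  l = solve-∀
  go : ∀ f ys → ∑ ys f ≡ ∑ (filterᵇ p ys) f + ∑ (filterᵇ (λ x → not (p x)) ys) f
  go f []       = refl
  go f (x ∷ ys) with p x
  ... | true  = trans (cong (_+_ (f x)) (go f ys)) (sym (+-assoc (f x) (∑ (filterᵇ p ys) f) _))
  ... | false = trans (cong (_+_ (f x)) (go f ys)) (l (f x) (∑ (filterᵇ p ys) f) _)

∈-filterᵇ : ∀ {V : Set} (p : V → Bool) {x} xs → x ∈ filterᵇ p xs → p x ≡ true × x ∈ xs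
∈-filterᵇ p (y ∷ xs) x∈ with p y in e
∈-filterᵇ p (y ∷ xs) (here refl) | true  = e , here refl
∈-filterᵇ p (y ∷ xs) (there x∈)  | true  = proj₁ (∈-filterᵇ p xs x∈) , there (proj₂ (∈-filterᵇ p xs x∈))
∈-filterᵇ p (y ∷ xs) x∈          | false = proj₁ (∈-filterᵇ p xs x∈) , there (proj₂ (∈-filterᵇ p xs x∈))

filterᵇ-∈ : ∀ {V : Set} (p : V → Bool) {x} xs → x ∈ xs → p x ≡ true → x ∈ filterᵇ p xs
filterᵇ-∈ p (y ∷ xs) (here refl) px with p y
filterᵇ-∈ p (y ∷ xs) (here refl) refl | true = here refl
filterᵇ-∈ p (y ∷ xs) (there x∈) px with p y
... | true  = there (filterᵇ-∈ p xs x∈ px)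
... | false = filterᵇ-∈ p xs x∈ px

take-drop-≋ : ∀ {V : Set} k (xs : List V) → xs ≋ take k xs ++ drop k xs
take-drop-≋ k xs = ≋-by λ f → cong (λ ys → ∑ ys f) (sym (take++drop≡id k xs))

pick : ∀ {V : Set} {x : V} xs → x ∈ xs → Σ (List V) λ xs⁻ → xs ≋ x ∷ xs⁻
pick (x ∷ xs) (here refl) = xs , ≋-refl
pick (y ∷ xs) (there x∈)  = y ∷ proj₁ (pick xs x∈) , ≋-by λ f → trans (cong (_+_ (f y)) (∑≡ (proj₂ (pick xs x∈)) f)) (l (f y) (f _) _)
  where
  l : ∀ a b c → a + (b + c) ≡ b + (a + c)
  l = solve-∀

≋-length : ∀ {V : Set} {xs ys : List V} → xs ≋ ys → length xs ≡ length ys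
≋-length p = +-injective (≋-# p)

subset-containing : ∀ {V : Set} {x : V} xs k → x ∈ xs → 1 ℕ.≤ k → k ℕ.≤ length xs →
  Σ (List V) λ T → Σ (List V) λ R → xs ≋ T ++ R × length T ≡ k × x ∈ T
subset-containing {x = x} xs (suc k) x∈ _ k< with pick xs x∈
... | ys , xs≋ = x ∷ take k ys , drop k ys , ≋-trans xs≋ (≋-by λ f → cong (_+_ (f x)) (∑≡ (take-drop-≋ k ys) f))
  , cong suc (trans (length-take k ys) (ℕₚ.m≤n⇒m⊓n≡m (ℕₚ.≤-pred (subst (suc k ℕ.≤_) (≋-length xs≋) k<)))) , here refl

-- k (2h - k) = h² - (k - h)², so only the balanced cut reaches h².
balanced-cut : ∀ k h → h * h ≤ k * (h + h - k) → k ≡ h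
balanced-cut k h h²≤ = i-j≡0⇒i≡j k h (x²≡0⇒x≡0 (k - h) (≤-antisym square (0≤² (k - h))))
  where
  l : ∀ k h → 0ℤ - (k - h) * (k - h) ≡ k * (h + h - k) - h * h
  l = solve-∀
  square : (k - h) * (k - h) ≤ 0ℤ
  square = ≤-slack _ (≤⇒0≤- h²≤) (l k h)

-- Polynomial inequalities

≤-absurd : ∀ {x y} → x ≤ y → 1ℤ ≤ x - y → ⊥
≤-absurd {x} {y} p q = 1≰0 (≤-trans q (subst (_≤ 0ℤ) refl (≤-slack _ (≤⇒0≤- p) (l x y))))
  where
  1≰0 : ¬ (1ℤ ≤ 0ℤ)
  1≰0 (+≤+ ())
  l : ∀ x y → 0ℤ - (x - y) ≡ y - x
  l = solve-∀

module _ (m p q : ℤ) (0≤p : 0ℤ ≤ p) (0≤q : 0ℤ ≤ q) (0≤m : 0ℤ ≤ m) (4q≤p² : 0ℤ ≤ p * p - + 4 * q) where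

  -- For p = s + t and q = st, where s and t are the end degrees of an edge, this is -1/4 times the
  -- discriminant of the quadratic in `Q H` that has to be nonnegative in `Tight.edge`.
  discriminant : ℤ
  discriminant = q * q * (+ 132 * m * p - + 4 * m * m - + 9 * p * p) - q * p * (+ 96 * m * m * m + + 21 * m * m * p) + + 24 * m * m * m * m * p * p

  -- As a function of p for fixed q / p the discriminant is concave; it is nonnegative
  -- at p = 4q / p (where it vanishes to second order at q / p = m / 3) and at p = 2m.
  0≤discriminant : 0ℤ < p → 0ℤ < + 2 * m - p → 0ℤ ≤ discriminant
  0≤discriminant 0<p p<2m = 0≤-cancel (0<* 0<p 0<w) (subst (0ℤ ≤_) (sym (l m p q))
    (0≤+ (0≤+ (0≤* (0≤* (<⇒≤ p<2m) (0≤² (+ 3 * q - m * p))) fac₁) (0≤* (0≤* (0≤² m) (0≤* 0≤p 4q≤p²)) fac₂))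
         (0≤* (0≤* (0≤* (0≤* (0≤+ℕ 9) (0≤² q)) 4q≤p²) (<⇒≤ p<2m)) (<⇒≤ 0<w))))
    where
    w = + 2 * m * p - + 4 * q
    0<w : 0ℤ < w
    0<w = subst (0ℤ <_) (sym (l₀ m p q)) (+-mono-<-≤ (0<* 0<p p<2m) 4q≤p²)
      where
      l₀ : ∀ m p q → + 2 * m * p - + 4 * q ≡ p * (+ 2 * m - p) + (p * p - + 4 * q)
      l₀ = solve-∀
    fac₁ : 0ℤ ≤ + 24 * (m * m) * (p * p) + + 48 * m * p * q - + 16 * q * q
    fac₁ = subst (0ℤ ≤_) (sym (l₁ m p q)) (0≤+ (0≤+ (0≤* (0≤* (0≤+ℕ 24) (0≤² m)) (0≤² p))
        (0≤* (0≤* (0≤* (0≤+ℕ 40) 0≤m) 0≤p) 0≤q)) (0≤* (0≤* (0≤+ℕ 4) 0≤q) (<⇒≤ 0<w)))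
      where
      l₁ : ∀ m p q → + 24 * (m * m) * (p * p) + + 48 * m * p * q - + 16 * q * q
        ≡ + 24 * (m * m) * (p * p) + + 40 * m * p * q + + 4 * q * (+ 2 * m * p - + 4 * q)
      l₁ = solve-∀
    fac₂ : 0ℤ ≤ + 224 * q * q - + 138 * m * p * q + + 24 * (m * m) * (p * p)
    fac₂ = 0≤-cancel {+ 896} (+<+ (ℕ.s≤s ℕ.z≤n)) (subst (0ℤ ≤_) (sym (l₂ m p q))
        (0≤+ (0≤² (+ 448 * q - + 138 * m * p)) (0≤* (0≤* (0≤+ℕ 2460) (0≤² m)) (0≤² p))))
      where
      l₂ : ∀ m p q → + 896 * (+ 224 * q * q - + 138 * m * p * q + + 24 * (m * m) * (p * p))
        ≡ (+ 448 * q - + 138 * m * p) * (+ 448 * q - + 138 * m * p) + + 2460 * (m * m) * (p * p)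
      l₂ = solve-∀
    l : ∀ m p q → p * (+ 2 * m * p - + 4 * q) *
        (q * q * (+ 132 * m * p - + 4 * m * m - + 9 * p * p) - q * p * (+ 96 * m * m * m + + 21 * m * m * p) + + 24 * m * m * m * m * p * p)
      ≡ (+ 2 * m - p) * ((+ 3 * q - m * p) * (+ 3 * q - m * p)) * (+ 24 * (m * m) * (p * p) + + 48 * m * p * q - + 16 * q * q)
        + (m * m) * (p * (p * p - + 4 * q)) * (+ 224 * q * q - + 138 * m * p * q + + 24 * (m * m) * (p * p))
        + + 9 * (q * q) * (p * p - + 4 * q) * (+ 2 * m - p) * (+ 2 * m * p - + 4 * q)
    l = solve-∀

  -- Up to the factor 5m, the edge polynomial in the proof of `tangent` at the end point `Q H` =
  -- 11m² / 10, written in the sum p and the product q of the end degrees.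
  linear-form : ℤ
  linear-form = + 120 * q * q - (+ 28 * m * m + + 18 * m * p) * q + + 5 * m * m * m * p

  -- For 3p ≥ 2m the square in q is completed. Below that the remainder has the wrong sign, and the
  -- form is expanded in powers of p² - 4q instead; the constant term, a multiple of p times a
  -- cubic, is the value at q = p² / 4.
  0≤linear-form : 0ℤ ≤ + 2 * m - p → 0ℤ ≤ linear-form
  0≤linear-form p≤2m with ≤-total (+ 2 * m) (+ 3 * p)
  ... | inj₁ 2m≤3p = 0≤-cancel {+ 480} (+<+ (ℕ.s≤s ℕ.z≤n)) (subst (0ℤ ≤_) (sym (l m p q))
      (0≤+ (0≤² (+ 240 * q - (+ 28 * m * m + + 18 * m * p)))
           (0≤* (0≤* (0≤² m) (≤⇒0≤- 2m≤3p)) (0≤+ (0≤* (0≤+ℕ 108) p≤2m) (0≤* (0≤+ℕ 176) 0≤m)))))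
    where
    l : ∀ m p q → + 480 * (+ 120 * q * q - (+ 28 * m * m + + 18 * m * p) * q + + 5 * m * m * m * p)
      ≡ (+ 240 * q - (+ 28 * m * m + + 18 * m * p)) * (+ 240 * q - (+ 28 * m * m + + 18 * m * p))
        + m * m * (+ 3 * p - + 2 * m) * (+ 108 * (+ 2 * m - p) + + 176 * m)
    l = solve-∀
  ... | inj₂ 3p≤2m = 0≤-cancel {+ 54} (+<+ (ℕ.s≤s ℕ.z≤n)) (subst (0ℤ ≤_) (sym (l m p q))
      (0≤+ (0≤* (0≤* (0≤+ℕ 3) 0≤p) cubic) (0≤* 4q≤p² lin)))
    where
    y = + 2 * m - + 3 * p
    0≤y : 0ℤ ≤ y
    0≤y = ≤⇒0≤- 3p≤2m
    cubic : 0ℤ ≤ + 10 * m * m * m + + 18 * m * m * y + + 21 * m * y * y - + 5 * y * y * y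
    cubic = subst (0ℤ ≤_) (sym (l₁ m p)) (0≤+ (0≤+ (0≤+ (0≤* (0≤* (0≤* (0≤+ℕ 10) 0≤m) 0≤m) 0≤m) (0≤* (0≤* (0≤* (0≤+ℕ 18) 0≤m) 0≤m) 0≤y))
       (0≤* (0≤* (0≤* (0≤+ℕ 11) 0≤m) 0≤y) 0≤y)) (0≤* (0≤* (0≤* (0≤+ℕ 15) 0≤p) 0≤y) 0≤y))
      where
      l₁ : ∀ m p → + 10 * m * m * m + + 18 * m * m * (+ 2 * m - + 3 * p) + + 21 * m * (+ 2 * m - + 3 * p) * (+ 2 * m - + 3 * p) - + 5 * (+ 2 * m - + 3 * p) * (+ 2 * m - + 3 * p) * (+ 2 * m - + 3 * p)
         ≡ + 10 * m * m * m + + 18 * m * m * (+ 2 * m - + 3 * p) + + 11 * m * (+ 2 * m - + 3 * p) * (+ 2 * m - + 3 * p) + + 15 * p * (+ 2 * m - + 3 * p) * (+ 2 * m - + 3 * p)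
      l₁ = solve-∀
    lin : 0ℤ ≤ + 27 * (+ 14 * m * m + + 9 * m * p) - + 810 * p * p + + 405 * (p * p - + 4 * q)
    lin = 0≤+ (subst (0ℤ ≤_) (sym (l₂ m p)) (0≤+ (0≤+ (0≤* (0≤* (0≤+ℕ 180) 0≤m) 0≤m) (0≤* (0≤* (0≤+ℕ 99) 0≤m) 0≤y)) (0≤* (0≤* (0≤+ℕ 270) 0≤p) 0≤y))) (0≤* (0≤+ℕ 405) 4q≤p²)
      where
      l₂ : ∀ m p → + 27 * (+ 14 * m * m + + 9 * m * p) - + 810 * p * p ≡ + 180 * m * m + + 99 * m * (+ 2 * m - + 3 * p) + + 270 * p * (+ 2 * m - + 3 * p)
      l₂ = solve-∀
    l : ∀ m p q → + 54 * (+ 120 * q * q - (+ 28 * m * m + + 18 * m * p) * q + + 5 * m * m * m * p)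
      ≡ + 3 * p * (+ 10 * m * m * m + + 18 * m * m * (+ 2 * m - + 3 * p) + + 21 * m * (+ 2 * m - + 3 * p) * (+ 2 * m - + 3 * p) - + 5 * (+ 2 * m - + 3 * p) * (+ 2 * m - + 3 * p) * (+ 2 * m - + 3 * p))
        + (p * p - + 4 * q) * (+ 27 * (+ 14 * m * m + + 9 * m * p) - + 810 * p * p + + 405 * (p * p - + 4 * q))
    l = solve-∀

_^′_ : ℤ → ℕ → ℤ
y ^′ zero  = 1ℤ
y ^′ suc n = y * y ^′ n

-- Evaluates a binary form: in a list of length k the i-th coefficient, counted from 0, goes with x
-- ^ i * y ^ (k - 1 - i). Homogeneity makes x and y interchangeable by reversing the list, so that a
-- single substitution lemma serves both halves of a cut.
horner : ∀ {C : Set} → (C → ℤ) → ∀ {n} → Vec C n → ℤ × ℤ → ℤ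
horner ev []             xy      = 0ℤ
horner ev (_∷_ {n} c cs) (x , y) = ev c * y ^′ n + x * horner ev cs (x , y)

module _ {C : Set} where

  reverse : ∀ {n} → Vec C n → Vec C n
  reverse []       = []
  reverse (c ∷ cs) = reverse cs ∷ʳ c

  pad : C → ∀ k {n} → Vec C (suc n) → Vec C (suc (k ℕ.+ n))
  pad z zero    cs = cs
  pad z (suc k) cs = pad z k cs ∷ʳ z

  -- Substitution of x + y for x.
  shiftWith : C → (C → C → C) → ∀ {n} → Vec C n → Vec C n
  shiftWith z _⊕_ []       = []
  shiftWith z _⊕_ (c ∷ cs) = Vec.zipWith _⊕_ (c ∷ shiftWith z _⊕_ cs) (shiftWith z _⊕_ cs ∷ʳ z)

  convolve : ∀ {C₁ C₂ : Set} → C → (C → C → C) → (C₁ → C₂ → C) →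
             ∀ {d e} → Vec C₁ (suc d) → Vec C₂ (suc e) → Vec C (suc (d ℕ.+ e))
  convolve z _⊕_ _⊗_ {zero}  (c ∷ [])     ds = Vec.map (c ⊗_) ds
  convolve z _⊕_ _⊗_ {suc d} (c ∷ cs) ds = Vec.zipWith _⊕_ (pad z (suc d) (Vec.map (c ⊗_) ds)) (z ∷ convolve z _⊕_ _⊗_ cs ds)

  module _ (ev : C → ℤ) where

    horner-∷ʳ : ∀ {n} (cs : Vec C n) c x y → horner ev (cs ∷ʳ c) (x , y) ≡ y * horner ev cs (x , y) + ev c * x ^′ n
    horner-∷ʳ []       c x y = l (ev c) x y
      where
      l : ∀ c x y → c * 1ℤ + x * 0ℤ ≡ y * 0ℤ + c * 1ℤ
      l = solve-∀
    horner-∷ʳ {suc n} (d ∷ cs) c x y = trans (cong (λ z → ev d * (y * y ^′ n) + x * z) (horner-∷ʳ cs c x y))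
        (l (ev d) (ev c) x y (y ^′ n) (x ^′ n) (horner ev cs (x , y)))
      where
      l : ∀ d c x y yn xn h → d * (y * yn) + x * (y * h + c * xn) ≡ y * (d * yn + x * h) + c * (x * xn)
      l = solve-∀

    horner-reverse : ∀ {n} (cs : Vec C n) x y → horner ev (reverse cs) (x , y) ≡ horner ev cs (y , x)
    horner-reverse []       x y = refl
    horner-reverse {suc n} (c ∷ cs) x y = trans (horner-∷ʳ (reverse cs) c x y)
      (trans (cong (λ z → y * z + ev c * x ^′ n) (horner-reverse cs x y)) (+-comm _ (ev c * x ^′ n)))

    horner-map : ∀ {B : Set} (ev′ : B → ℤ) (f : B → C) k → (∀ b → ev (f b) ≡ k * ev′ b) → ∀ {n} (bs : Vec B n) xy →
                 horner ev (Vec.map f bs) xy ≡ k * horner ev′ bs xy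
    horner-map ev′ f k eq []             xy      = sym (*-zeroʳ k)
    horner-map ev′ f k eq (_∷_ {n} b bs) (x , y) =
      trans (cong₂ (λ u v → u * y ^′ n + x * v) (eq b) (horner-map ev′ f k eq bs (x , y))) (l k (ev′ b) (y ^′ n) x _)
      where
      l : ∀ k b z x h → k * b * z + x * (k * h) ≡ k * (b * z + x * h)
      l = solve-∀

    horner-replicate : ∀ {z} → ev z ≡ 0ℤ → ∀ n xy → horner ev (Vec.replicate n z) xy ≡ 0ℤ
    horner-replicate ez zero    xy      = refl
    horner-replicate ez (suc n) (x , y) = trans (cong₂ (λ a b → a * y ^′ n + x * b) ez (horner-replicate ez n (x , y))) (l x (y ^′ n))
      where
      l : ∀ x z → 0ℤ * z + x * 0ℤ ≡ 0ℤ
      l = solve-∀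

    module _ {z : C} {_⊕_ : C → C → C} (ev-z : ev z ≡ 0ℤ) (ev-⊕ : ∀ c d → ev (c ⊕ d) ≡ ev c + ev d) where

      horner-⊕ : ∀ {n} (cs ds : Vec C n) xy → horner ev (Vec.zipWith _⊕_ cs ds) xy ≡ horner ev cs xy + horner ev ds xy
      horner-⊕ []       []       xy      = refl
      horner-⊕ {suc n} (c ∷ cs) (d ∷ ds) (x , y) = trans (cong₂ (λ a b → a * y ^′ n + x * b) (ev-⊕ c d) (horner-⊕ cs ds (x , y)))
          (l (ev c) (ev d) (y ^′ n) x _ _)
        where
        l : ∀ c d z x p q → (c + d) * z + x * (p + q) ≡ (c * z + x * p) + (d * z + x * q)
        l = solve-∀

      horner-shift : ∀ {n} (cs : Vec C n) x y → horner ev (shiftWith z _⊕_ cs) (x , y) ≡ horner ev cs (x + y , y)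
      horner-shift []       x y = refl
      horner-shift {suc n} (c ∷ cs) x y = begin
        horner ev (Vec.zipWith _⊕_ (c ∷ cs′) (cs′ ∷ʳ z)) (x , y)
          ≡⟨ horner-⊕ (c ∷ cs′) (cs′ ∷ʳ z) (x , y) ⟩
        (ev c * y ^′ n + x * s) + horner ev (cs′ ∷ʳ z) (x , y)
          ≡⟨ cong (_+_ (ev c * y ^′ n + x * s)) (trans (horner-∷ʳ cs′ z x y) (cong (λ t → y * s + t * x ^′ n) ev-z)) ⟩
        (ev c * y ^′ n + x * s) + (y * s + 0ℤ * x ^′ n)
          ≡⟨ l (ev c) (y ^′ n) (x ^′ n) x y s ⟩
        ev c * y ^′ n + (x + y) * s
          ≡⟨ cong (λ t → ev c * y ^′ n + (x + y) * t) (horner-shift cs x y) ⟩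
        ev c * y ^′ n + (x + y) * horner ev cs (x + y , y) ∎
        where
        open ≡-Reasoning
        cs′ : Vec C n
        cs′ = shiftWith z _⊕_ cs
        s : ℤ
        s = horner ev cs′ (x , y)
        l : ∀ c yn xn x y s → (c * yn + x * s) + (y * s + 0ℤ * xn) ≡ c * yn + (x + y) * s
        l = solve-∀

      horner-pad : ∀ k {n} (cs : Vec C (suc n)) x y → horner ev (pad z k cs) (x , y) ≡ y ^′ k * horner ev cs (x , y)
      horner-pad zero    cs x y = sym (*-identityˡ _)
      horner-pad (suc k) {n} cs x y = trans (horner-∷ʳ (pad z k cs) z x y)
        (trans (cong₂ (λ a b → y * a + b * x ^′ suc (k ℕ.+ n)) (horner-pad k cs x y) ev-z) (l y (y ^′ k) _ (x ^′ suc (k ℕ.+ n))))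
        where
        l : ∀ y yk h w → y * (yk * h) + 0ℤ * w ≡ y * yk * h
        l = solve-∀

      horner-convolve : ∀ {C₁ C₂ : Set} {ev₁ : C₁ → ℤ} {ev₂ : C₂ → ℤ} {_⊗_ : C₁ → C₂ → C} →
        (∀ c d → ev (c ⊗ d) ≡ ev₁ c * ev₂ d) → ∀ {d e} (cs : Vec C₁ (suc d)) (ds : Vec C₂ (suc e)) x y →
        horner ev (convolve z _⊕_ _⊗_ cs ds) (x , y) ≡ horner ev₁ cs (x , y) * horner ev₂ ds (x , y)
      horner-convolve {ev₁ = ev₁} {ev₂} {_⊗_} ev-⊗ {zero} (c ∷ []) ds x y =
          trans (horner-map ev₂ (c ⊗_) (ev₁ c) (ev-⊗ c) ds (x , y)) (l (ev₁ c) x (horner ev₂ ds (x , y)))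
        where
        l : ∀ c x h → c * h ≡ (c * 1ℤ + x * 0ℤ) * h
        l = solve-∀
      horner-convolve {ev₁ = ev₁} {ev₂} {_⊗_} ev-⊗ {suc d} {e} (c ∷ cs) ds x y = begin
        horner ev (Vec.zipWith _⊕_ (pad z (suc d) (Vec.map (c ⊗_) ds)) (z ∷ convolve z _⊕_ _⊗_ cs ds)) (x , y)
          ≡⟨ horner-⊕ (pad z (suc d) (Vec.map (c ⊗_) ds)) (z ∷ convolve z _⊕_ _⊗_ cs ds) (x , y) ⟩
        horner ev (pad z (suc d) (Vec.map (c ⊗_) ds)) (x , y) + (ev z * w + x * horner ev (convolve z _⊕_ _⊗_ cs ds) (x , y))
          ≡⟨ cong₂ _+_ (trans (horner-pad (suc d) (Vec.map (c ⊗_) ds) x y) (cong (y ^′ suc d *_) (horner-map ev₂ (c ⊗_) (ev₁ c) (ev-⊗ c) ds (x , y))))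
                       (cong₂ (λ a b → a * w + x * b) ev-z (horner-convolve ev-⊗ cs ds x y)) ⟩
        y ^′ suc d * (ev₁ c * h) + (0ℤ * w + x * (horner ev₁ cs (x , y) * h))
          ≡⟨ l (y ^′ suc d) (ev₁ c) h w x (horner ev₁ cs (x , y)) ⟩
        (ev₁ c * y ^′ suc d + x * horner ev₁ cs (x , y)) * h ∎
        where
        open ≡-Reasoning
        h w : ℤ
        h = horner ev₂ ds (x , y)
        w = y ^′ suc (d ℕ.+ e)
        l : ∀ yd c h w x k → yd * (c * h) + (0ℤ * w + x * (k * h)) ≡ (c * yd + x * k) * h
        l = solve-∀

-- A form of degree d in each pair of variables (x , y), as the list of the coefficients of x ^ i * y ^ (d - i).
Form : ∀ {k} → Vec ℕ k → Set
Form []       = ℤ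
Form (d ∷ ds) = Vec (Form ds) (suc d)

Point : ℕ → Set
Point zero    = ⊤
Point (suc k) = (ℤ × ℤ) × Point k

⟦_⟧ : ∀ {k} {ds : Vec ℕ k} → Form ds → Point k → ℤ
⟦_⟧ {ds = []}     c ρ        = c
⟦_⟧ {ds = d ∷ ds} p (xy , ρ) = horner (λ c → ⟦_⟧ {ds = ds} c ρ) p xy

zeroForm : ∀ {k} (ds : Vec ℕ k) → Form ds
zeroForm []       = 0ℤ
zeroForm (d ∷ ds) = Vec.replicate (suc d) (zeroForm ds)

add : ∀ {k} (ds : Vec ℕ k) → Form ds → Form ds → Form ds
add []       = _+_
add (d ∷ ds) = Vec.zipWith (add ds)

mul : ∀ {k} (ds es : Vec ℕ k) → Form ds → Form es → Form (Vec.zipWith ℕ._+_ ds es)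
mul []       []       = _*_
mul (d ∷ ds) (e ∷ es) = convolve (zeroForm (Vec.zipWith ℕ._+_ ds es)) (add (Vec.zipWith ℕ._+_ ds es)) (mul ds es)

⟦zero⟧ : ∀ {k} (ds : Vec ℕ k) ρ → ⟦_⟧ {ds = ds} (zeroForm ds) ρ ≡ 0ℤ
⟦zero⟧ []       ρ        = refl
⟦zero⟧ (d ∷ ds) (xy , ρ) = horner-replicate (λ c → ⟦_⟧ {ds = ds} c ρ) {zeroForm ds} (⟦zero⟧ ds ρ) (suc d) xy

⟦add⟧ : ∀ {k} (ds : Vec ℕ k) p q ρ → ⟦_⟧ {ds = ds} (add ds p q) ρ ≡ ⟦_⟧ {ds = ds} p ρ + ⟦_⟧ {ds = ds} q ρ
⟦add⟧ []       p q ρ        = refl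
⟦add⟧ (d ∷ ds) p q (xy , ρ) = horner-⊕ _ (⟦zero⟧ ds ρ) (λ c c′ → ⟦add⟧ ds c c′ ρ) p q xy

⟦mul⟧ : ∀ {k} (ds es : Vec ℕ k) p q ρ → ⟦_⟧ {ds = Vec.zipWith ℕ._+_ ds es} (mul ds es p q) ρ ≡ ⟦_⟧ {ds = ds} p ρ * ⟦_⟧ {ds = es} q ρ
⟦mul⟧ []       []       p q ρ              = refl
⟦mul⟧ (d ∷ ds) (e ∷ es) p q ((x , y) , ρ) =
  horner-convolve _ (⟦zero⟧ (Vec.zipWith ℕ._+_ ds es) ρ) (λ c c′ → ⟦add⟧ (Vec.zipWith ℕ._+_ ds es) c c′ ρ) (λ c c′ → ⟦mul⟧ ds es c c′ ρ) p q x y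

data Axis : ℕ → Set where
  here  : ∀ {k} → Axis (suc k)
  there : ∀ {k} → Axis k → Axis (suc k)

coordinates : ∀ {k} → Axis k → Point k → ℤ × ℤ
coordinates here      (xy , ρ) = xy
coordinates (there i) (xy , ρ) = coordinates i ρ

-- A form together with its value at the point ρ; the arithmetic operations keep both in step.
record Poly {k} (ρ : Point k) (ds : Vec ℕ k) (x : ℤ) : Set where
  constructor poly
  field
    form   : Form ds
    ⟦form⟧ : ⟦_⟧ {ds = ds} form ρ ≡ x
open Poly

infixl 6 _⊞_
infixl 7 _⊠_

_⊞_ : ∀ {k} {ρ : Point k} {ds x y} → Poly ρ ds x → Poly ρ ds y → Poly ρ ds (x + y)
_⊞_ {ρ = ρ} {ds} (poly f e) (poly g e′) = poly (add ds f g) (trans (⟦add⟧ ds f g ρ) (cong₂ _+_ e e′))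

_⊠_ : ∀ {k} {ρ : Point k} {ds es x y} → Poly ρ ds x → Poly ρ es y → Poly ρ (Vec.zipWith ℕ._+_ ds es) (x * y)
_⊠_ {ρ = ρ} {ds} {es} (poly f e) (poly g e′) = poly (mul ds es f g) (trans (⟦mul⟧ ds es f g ρ) (cong₂ _*_ e e′))

_⟨_⟩ : ∀ {k} {ρ : Point k} {ds x y} → Poly ρ ds x → x ≡ y → Poly ρ ds y
poly f e ⟨ x≡y ⟩ = poly f (trans e x≡y)

raise : ∀ {k} {ρ : Point k} {xy ds x} → Poly ρ ds x → Poly (xy , ρ) (0 ∷ ds) x
raise {xy = x , y} (poly f e) = poly (f ∷ []) (trans (cong (λ z → z * 1ℤ + x * 0ℤ) e) (l _ x))
  where
  l : ∀ c x → c * 1ℤ + x * 0ℤ ≡ c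
  l = solve-∀

con : ∀ {k} {ρ : Point k} c → Poly ρ (Vec.replicate k 0) c
con {zero}  c = poly c refl
con {suc k} c = raise (con c)

unit : ∀ {k} → Axis k → Vec ℕ k
unit here      = 1 ∷ Vec.replicate _ 0
unit (there i) = 0 ∷ unit i

linear : ∀ {k} {ρ : Point k} (i : Axis k) (c₀ c₁ : ℤ) → Poly ρ (unit i) (c₀ * proj₂ (coordinates i ρ) + c₁ * proj₁ (coordinates i ρ))
linear {suc k} {(x , y) , ρ} here c₀ c₁ = poly (form {x = c₀} p₀ ∷ form p₁ ∷ [])
    (trans (cong₂ (λ a b → a * (y * 1ℤ) + x * (b * 1ℤ + x * 0ℤ)) (⟦form⟧ p₀) (⟦form⟧ p₁)) (l c₀ c₁ x y))
  where
  p₀ : Poly ρ (Vec.replicate k 0) c₀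
  p₀ = con c₀
  p₁ : Poly ρ (Vec.replicate k 0) c₁
  p₁ = con c₁
  l : ∀ a b x y → a * (y * 1ℤ) + x * (b * 1ℤ + x * 0ℤ) ≡ a * y + b * x
  l = solve-∀
linear (there i) c₀ c₁ = raise (linear i c₀ c₁)

-- The change of variables x ↦ x + y on the half x ≥ y, and y ↦ y + x on the other half.
data HalfSpace : Set where
  x≥y y≥x : HalfSpace

restrict : ∀ {k} (ds : Vec ℕ k) → Axis k → HalfSpace → Form ds → Form ds
restrict (d ∷ ds) here      x≥y p = shiftWith (zeroForm ds) (add ds) p
restrict (d ∷ ds) here      y≥x p = reverse (shiftWith (zeroForm ds) (add ds) (reverse p))
restrict (d ∷ ds) (there i) h   p = Vec.map (restrict ds i h) p

move : ∀ {k} → Axis k → HalfSpace → Point k → Point k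
move here      x≥y ((x , y) , ρ) = (x - y , y) , ρ
move here      y≥x ((x , y) , ρ) = (x , y - x) , ρ
move (there i) h   (xy , ρ)      = xy , move i h ρ

⟦restrict⟧ : ∀ {k} (ds : Vec ℕ k) i h (p : Form ds) ρ → ⟦_⟧ {ds = ds} (restrict ds i h p) (move i h ρ) ≡ ⟦_⟧ {ds = ds} p ρ
⟦restrict⟧ (d ∷ ds) here x≥y p ((x , y) , ρ) = trans (horner-shift _ (⟦zero⟧ ds ρ) (λ c c′ → ⟦add⟧ ds c c′ ρ) p (x - y) y)
    (cong (λ z → horner (λ c → ⟦_⟧ {ds = ds} c ρ) p (z , y)) (l x y))
  where
  l : ∀ x y → x - y + y ≡ x
  l = solve-∀
⟦restrict⟧ (d ∷ ds) here y≥x p ((x , y) , ρ) = trans (horner-reverse _ (shiftWith (zeroForm ds) (add ds) (reverse p)) x (y - x))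
    (trans (horner-shift _ (⟦zero⟧ ds ρ) (λ c c′ → ⟦add⟧ ds c c′ ρ) (reverse p) (y - x) x)
      (trans (horner-reverse _ p (y - x + x) x) (cong (λ z → horner (λ c → ⟦_⟧ {ds = ds} c ρ) p (x , z)) (l y x))))
  where
  l : ∀ x y → x - y + y ≡ x
  l = solve-∀
⟦restrict⟧ (d ∷ ds) (there i) h p (xy , ρ) = trans (horner-map (λ c → ⟦_⟧ {ds = ds} c (move i h ρ)) (λ c → ⟦_⟧ {ds = ds} c ρ) (restrict ds i h) 1ℤ (λ c → trans (⟦restrict⟧ ds i h c ρ) (sym (*-identityˡ _))) p xy) (*-identityˡ _)

NonNegative² : ℤ × ℤ → Set
NonNegative² (x , y) = 0ℤ ≤ x × 0ℤ ≤ y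

0≤Point : ∀ {k} → Point k → Set
0≤Point {zero}  ρ        = ⊤
0≤Point {suc k} (xy , ρ) = NonNegative² xy × 0≤Point ρ

inHalf : HalfSpace → ℤ × ℤ → Set
inHalf x≥y (x , y) = y ≤ x
inHalf y≥x (x , y) = x ≤ y

0≤move : ∀ {k} (i : Axis k) h ρ → 0≤Point ρ → inHalf h (coordinates i ρ) → 0≤Point (move i h ρ)
0≤move here      x≥y ((x , y) , ρ) ((0≤x , 0≤y) , 0≤ρ) y≤x = (≤⇒0≤- y≤x , 0≤y) , 0≤ρ
0≤move here      y≥x ((x , y) , ρ) ((0≤x , 0≤y) , 0≤ρ) x≤y = (0≤x , ≤⇒0≤- x≤y) , 0≤ρ
0≤move (there i) h   (xy , ρ)      (0≤xy , 0≤ρ)        p   = 0≤xy , 0≤move i h ρ 0≤ρ p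

every : ∀ {k} (ds : Vec ℕ k) → (ℤ → Bool) → Form ds → Bool
every []       P c = P c
every (d ∷ ds) P p = Vec.foldr (λ _ → Bool) (λ c b → every ds P c ∧ b) true p

0≤^′ : ∀ {y} n → 0ℤ ≤ y → 0ℤ ≤ y ^′ n
0≤^′ zero    0≤y = 0≤+ℕ 1
0≤^′ (suc n) 0≤y = 0≤* 0≤y (0≤^′ n 0≤y)

module _ {C : Set} (ev : C → ℤ) (P : C → Bool) {x y : ℤ} (0≤x : 0ℤ ≤ x) (0≤y : 0ℤ ≤ y) where

  0≤horner : (∀ c → IsTrue (P c) → 0ℤ ≤ ev c) → ∀ {n} (cs : Vec C n) → IsTrue (Vec.foldr (λ _ → Bool) (λ c b → P c ∧ b) true cs) →
             0ℤ ≤ horner ev cs (x , y)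
  0≤horner h []       t = ≤-refl
  0≤horner h {suc n} (c ∷ cs) t with Equivalence.to (T-∧ {P c}) t
  ... | tc , tcs = 0≤+ (0≤* (h c tc) (0≤^′ n 0≤y)) (0≤* 0≤x (0≤horner h cs tcs))

  horner≤0 : (∀ c → IsTrue (P c) → ev c ≤ 0ℤ) → ∀ {n} (cs : Vec C n) → IsTrue (Vec.foldr (λ _ → Bool) (λ c b → P c ∧ b) true cs) →
             horner ev cs (x , y) ≤ 0ℤ
  horner≤0 h []       t = ≤-refl
  horner≤0 h {suc n} (c ∷ cs) t with Equivalence.to (T-∧ {P c}) t
  ... | tc , tcs = ≤-slack _ (0≤+ (0≤* (≤⇒0≤- (h c tc)) (0≤^′ n 0≤y)) (0≤* 0≤x (≤⇒0≤- (horner≤0 h cs tcs)))) (l (ev c) (y ^′ n) x _)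
    where
    l : ∀ c z x h → 0ℤ - (c * z + x * h) ≡ (0ℤ - c) * z + x * (0ℤ - h)
    l = solve-∀

all≥0-sound : ∀ {k} (ds : Vec ℕ k) p ρ → 0≤Point ρ → IsTrue (every ds (0ℤ ≤ᵇ_) p) → 0ℤ ≤ ⟦_⟧ {ds = ds} p ρ
all≥0-sound []       c ρ              0≤ρ                  t = ≤ᵇ⇒≤ t
all≥0-sound (d ∷ ds) p (xy , ρ) ((0≤x , 0≤y) , 0≤ρ) t =
  0≤horner _ (every ds (0ℤ ≤ᵇ_)) 0≤x 0≤y (λ c → all≥0-sound ds c ρ 0≤ρ) p t

all≤0-sound : ∀ {k} (ds : Vec ℕ k) p ρ → 0≤Point ρ → IsTrue (every ds (_≤ᵇ 0ℤ) p) → ⟦_⟧ {ds = ds} p ρ ≤ 0ℤ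
all≤0-sound []       c ρ              0≤ρ                  t = ≤ᵇ⇒≤ t
all≤0-sound (d ∷ ds) p (xy , ρ) ((0≤x , 0≤y) , 0≤ρ) t =
  horner≤0 _ (every ds (_≤ᵇ 0ℤ)) 0≤x 0≤y (λ c → all≤0-sound ds c ρ 0≤ρ) p t

-- A subdivision of the nonnegative orthant into cones.
data Subdivision (k : ℕ) : Set where
  □     : Subdivision k
  split : Axis k → (on-x≥y on-y≥x : Subdivision k) → Subdivision k

module _ {k : ℕ} (ns : Vec ℕ k) where

  -- On every cone, G₁ ≥ 0 where N ≥ 0, and G₂ ≥ 0 where N ≤ 0.
  record Claim : Set where
    constructor claim
    field G₁ G₂ N : Form ns

  restrictClaim : Axis k → HalfSpace → Claim → Claim
  restrictClaim i h (claim g₁ g₂ n) = claim (restrict ns i h g₁) (restrict ns i h g₂) (restrict ns i h n)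

  -- If both g₁ and g₂ have only nonnegative coefficients, the sign of n may vary over the cone.
  -- Otherwise the coefficients of n must fix its sign, and only the corresponding form is tested.
  leaf : Claim → Bool
  leaf (claim g₁ g₂ n) = (every ns (0ℤ ≤ᵇ_) g₁ ∧ every ns (0ℤ ≤ᵇ_) g₂) ∨ ((every ns (0ℤ ≤ᵇ_) g₁ ∧ every ns (0ℤ ≤ᵇ_) n) ∨ (every ns (0ℤ ≤ᵇ_) g₂ ∧ every ns (_≤ᵇ 0ℤ) n))

  certified : Subdivision k → Claim → Bool
  certified □             t = leaf t
  certified (split i s r) t = certified s (restrictClaim i x≥y t) ∧ certified r (restrictClaim i y≥x t)

  Dichotomy : Claim → Point k → Set
  Dichotomy (claim g₁ g₂ n) ρ = (0ℤ ≤ ⟦_⟧ {ds = ns} n ρ × 0ℤ ≤ ⟦_⟧ {ds = ns} g₁ ρ) ⊎ (⟦_⟧ {ds = ns} n ρ ≤ 0ℤ × 0ℤ ≤ ⟦_⟧ {ds = ns} g₂ ρ)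

  leaf-sound : ∀ t ρ → 0≤Point ρ → IsTrue (leaf t) → Dichotomy t ρ
  leaf-sound (claim g₁ g₂ n) ρ 0≤ρ l with Equivalence.to (T-∨ {every ns (0ℤ ≤ᵇ_) g₁ ∧ every ns (0ℤ ≤ᵇ_) g₂}) l
  ... | inj₁ p with Equivalence.to (T-∧ {every ns (0ℤ ≤ᵇ_) g₁}) p
  ...   | p₁ , p₂ with ≤-total 0ℤ (⟦_⟧ {ds = ns} n ρ)
  ...     | inj₁ 0≤n = inj₁ (0≤n , all≥0-sound ns g₁ ρ 0≤ρ p₁)
  ...     | inj₂ n≤0 = inj₂ (n≤0 , all≥0-sound ns g₂ ρ 0≤ρ p₂)
  leaf-sound (claim g₁ g₂ n) ρ 0≤ρ l | inj₂ q with Equivalence.to (T-∨ {every ns (0ℤ ≤ᵇ_) g₁ ∧ every ns (0ℤ ≤ᵇ_) n}) q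
  ... | inj₁ p with Equivalence.to (T-∧ {every ns (0ℤ ≤ᵇ_) g₁}) p
  ...   | p₁ , p₂ = inj₁ (all≥0-sound ns n ρ 0≤ρ p₂ , all≥0-sound ns g₁ ρ 0≤ρ p₁)
  leaf-sound (claim g₁ g₂ n) ρ 0≤ρ l | inj₂ q | inj₂ p with Equivalence.to (T-∧ {every ns (0ℤ ≤ᵇ_) g₂}) p
  ...   | p₁ , p₂ = inj₂ (all≤0-sound ns n ρ 0≤ρ p₂ , all≥0-sound ns g₂ ρ 0≤ρ p₁)

  unrestrict : ∀ i h t ρ → Dichotomy (restrictClaim i h t) (move i h ρ) → Dichotomy t ρ
  unrestrict i h (claim g₁ g₂ n) ρ (inj₁ (p , q)) = inj₁ (subst (0ℤ ≤_) (⟦restrict⟧ ns i h n ρ) p , subst (0ℤ ≤_) (⟦restrict⟧ ns i h g₁ ρ) q)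
  unrestrict i h (claim g₁ g₂ n) ρ (inj₂ (p , q)) = inj₂ (subst (_≤ 0ℤ) (⟦restrict⟧ ns i h n ρ) p , subst (0ℤ ≤_) (⟦restrict⟧ ns i h g₂ ρ) q)

  certified-sound : ∀ s t ρ → 0≤Point ρ → IsTrue (certified s t) → Dichotomy t ρ
  certified-sound □ t ρ 0≤ρ c = leaf-sound t ρ 0≤ρ c
  certified-sound (split i s r) t ρ 0≤ρ c with Equivalence.to (T-∧ {certified s (restrictClaim i x≥y t)}) c
  ... | cs , cr with ≤-total (proj₂ (coordinates i ρ)) (proj₁ (coordinates i ρ))
  ...   | inj₁ p = unrestrict i x≥y t ρ (certified-sound s (restrictClaim i x≥y t) (move i x≥y ρ) (0≤move i x≥y ρ 0≤ρ p) cs)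
  ...   | inj₂ p = unrestrict i y≥x t ρ (certified-sound r (restrictClaim i y≥x t) (move i y≥x ρ) (0≤move i y≥x ρ 0≤ρ p) cr)

  -- Soundness on the region where x ≤ y for the two axes i and j.
  certify : ∀ {ρ : Point k} {x₁ x₂ y} (i j : Axis k) (p₁ : Poly ρ ns x₁) (p₂ : Poly ρ ns x₂) (q : Poly ρ ns y) s →
    IsTrue (certified s (restrictClaim j y≥x (restrictClaim i y≥x (claim (form p₁) (form p₂) (form q))))) →
    0≤Point ρ → inHalf y≥x (coordinates i ρ) → inHalf y≥x (coordinates j (move i y≥x ρ)) →
    (0ℤ ≤ y × 0ℤ ≤ x₁) ⊎ (y ≤ 0ℤ × 0ℤ ≤ x₂)
  certify {ρ} {x₁} {x₂} {y} i j p₁ p₂ q s c 0≤ρ hi hj = convert (unrestrict i y≥x t ρ (unrestrict j y≥x t′ ρ′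
      (certified-sound s (restrictClaim j y≥x t′) (move j y≥x ρ′) (0≤move j y≥x ρ′ (0≤move i y≥x ρ 0≤ρ hi) hj) c)))
    where
    t t′ : Claim
    t = claim (form p₁) (form p₂) (form q)
    t′ = restrictClaim i y≥x t
    ρ′ : Point k
    ρ′ = move i y≥x ρ
    convert : Dichotomy t ρ → (0ℤ ≤ y × 0ℤ ≤ x₁) ⊎ (y ≤ 0ℤ × 0ℤ ≤ x₂)
    convert (inj₁ (u , v)) = inj₁ (subst (0ℤ ≤_) (⟦form⟧ q) u , subst (0ℤ ≤_) (⟦form⟧ p₁) v)
    convert (inj₂ (u , v)) = inj₂ (subst (_≤ 0ℤ) (⟦form⟧ q) u , subst (0ℤ ≤_) (⟦form⟧ p₂) v)

-- For an edge with end degrees a and b, the combination F of EdgeBounds satisfies 10 m F ≥ ρ₁ if N₅ ≥ 0 and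
-- 10 m F ≥ ρ₂ if N₅ ≤ 0; with ρ in place of 10 m F, the summand of the weighted sum over the edges is Ψ.
N₅ P₁ W₂ : ℤ → ℤ → ℤ → ℤ
N₅ m a b = + 2 * m * m - + 2 * (+ 2 * m - a - b) * m - + 5 * ((m - a) * (m - b))
P₁ m a b = b * (+ 7 * m - + 5 * a) + a * (+ 7 * m - + 5 * b)
W₂ m a b = (+ 7 * m - + 5 * a) * (+ 7 * m - + 5 * b)

ρ₁ ρ₂ : ℤ → ℤ → ℤ → ℤ → ℤ
ρ₁ m a b Q = (+ 3 * m - a - b) * (m * m) * (+ 44 * m * m - + 9 * (+ 2 * m - a - b) * m - + 40 * ((m - a) * (m - b)))
ρ₂ m a b Q = (+ 3 * m - a - b) * (+ 35 * m * m * m * m - + 5 * m * m * (a * b) + + 10 * N₅ m a b * (Q - m * m))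

Ψ : ℤ → ℤ → ℤ → ℤ → ℤ → ℤ
Ψ m a b Q ρ = + 8 * m * m * (a * b) * (ρ - + 10 * m * P₁ m a b * (Q - + 2 * (a * b)))
            + + 3 * Q * Q * ((a + b) * Q - + 6 * m * (a * b)) * W₂ m a b

only-x : ∀ x y → 0ℤ * y + 1ℤ * x ≡ x
only-x = solve-∀
only-y : ∀ x y → 1ℤ * y + 0ℤ * x ≡ y
only-y = solve-∀
y-x : ∀ x y → 1ℤ * y + - 1ℤ * x ≡ y - x
y-x = solve-∀
7y-5x : ∀ x y → + 7 * y + - + 5 * x ≡ + 7 * y - + 5 * x
7y-5x = solve-∀
x-y : ∀ x y → - 1ℤ * y + 1ℤ * x ≡ x - y
x-y = solve-∀

m⁷ : ℤ → ℤ
m⁷ m = m * m * m * m * m * m * m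

-- Purely a certificate: the argument `tt` in `Homogeneous.positivity` makes the type checker carry
-- out all these cuts on the coefficient lists and inspect the signs at the leaves.
subdivision : Subdivision 3
subdivision =
  q′ (q′ (q′ (a′ (q′ □ (b′ (q′ □ (a′ (b′ (a′ (b′ (a′ (b′ □ □) □) □) □) □) □)) □)) □) (a′ (b′ (a′ (b′ (q′ (a′
  (b′ (a′ (b′ (q′ (a′ (b′ (q′ (a′ (a′ □ □) □) (a′ □ □)) (a′ □ □)) (q′ □ □)) (a′ (b′ □ □) (b′ □ □))) (q′ (a′ □
  □) (a′ (a′ □ □) □))) (b′ (q′ (b′ □ □) (b′ (b′ □ □) □)) □)) (a′ (q′ □ (a′ (a′ □ □) □)) □)) (b′ (b′ (q′ □ (b′
  (a′ □ □) □)) □) □)) (a′ (b′ (q′ (a′ (b′ (a′ □ (b′ □ □)) (a′ □ □)) (b′ (b′ □ □) □)) (a′ (b′ □ □) (b′ □ (q′ □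
  □)))) (q′ (a′ (a′ (a′ □ □) □) □) (a′ (q′ (a′ □ □) □) (q′ □ (b′ □ □))))) (b′ (q′ (b′ (b′ (b′ □ □) □) □) (b′
  (q′ (b′ □ □) □) (q′ □ (a′ □ □)))) (q′ □ (q′ □ (a′ □ □)))))) (q′ (q′ □ □) (a′ (q′ (a′ □ □) (a′ (q′ □ (a′ □
  □)) □)) □))) (q′ (q′ □ □) (b′ (b′ (q′ (b′ □ □) (b′ (q′ □ (a′ □ □)) □)) □) □))) (q′ □ □)) (b′ (q′ □ □) □)))
  (a′ (b′ (q′ (a′ (b′ (q′ (a′ □ (b′ □ □)) □) (q′ (a′ □ (b′ □ □)) □)) (b′ (q′ (b′ □ (a′ □ □)) □) (q′ (q′ (a′ □
  □) □) □))) (q′ (a′ □ (b′ □ □)) □)) (q′ (a′ (b′ □ □) □) (b′ (a′ □ □) □))) (b′ (q′ (b′ (a′ □ □) □) (a′ (b′ □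
  □) □)) (q′ □ □)))) (a′ (b′ □ (a′ (q′ (a′ □ □) □) □)) (b′ (b′ (q′ (a′ □ □) □) □) □))
  where
  a′ b′ q′ : Subdivision 3 → Subdivision 3 → Subdivision 3
  a′ = split here
  b′ = split (there here)
  q′ = split (there (there here))

-- The polynomials above as forms in the pairs (a , m), (b , m) and (Q , m²), multiplied by powers of m where necessary.
module Homogeneous (m a b Q : ℤ) where

  point : Point 3
  point = (a , m) , (b , m) , (Q , m * m) , tt

  K : ℤ → Set
  K = Poly point (0 ∷ 0 ∷ 0 ∷ [])

  k : ∀ c → K c
  k = con

  𝕒 : Poly point (1 ∷ 0 ∷ 0 ∷ []) a
  𝕒 = linear here 0ℤ 1ℤ ⟨ only-x a m ⟩
  𝕞₁ : Poly point (1 ∷ 0 ∷ 0 ∷ []) m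
  𝕞₁ = linear here 1ℤ 0ℤ ⟨ only-y a m ⟩
  m-a : Poly point (1 ∷ 0 ∷ 0 ∷ []) (m - a)
  m-a = linear here 1ℤ (- 1ℤ) ⟨ y-x a m ⟩
  7m-5a : Poly point (1 ∷ 0 ∷ 0 ∷ []) (+ 7 * m - + 5 * a)
  7m-5a = linear here (+ 7) (- + 5) ⟨ 7y-5x a m ⟩
  𝕓 : Poly point (0 ∷ 1 ∷ 0 ∷ []) b
  𝕓 = linear (there here) 0ℤ 1ℤ ⟨ only-x b m ⟩
  𝕞₂ : Poly point (0 ∷ 1 ∷ 0 ∷ []) m
  𝕞₂ = linear (there here) 1ℤ 0ℤ ⟨ only-y b m ⟩
  m-b : Poly point (0 ∷ 1 ∷ 0 ∷ []) (m - b)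
  m-b = linear (there here) 1ℤ (- 1ℤ) ⟨ y-x b m ⟩
  7m-5b : Poly point (0 ∷ 1 ∷ 0 ∷ []) (+ 7 * m - + 5 * b)
  7m-5b = linear (there here) (+ 7) (- + 5) ⟨ 7y-5x b m ⟩
  𝕢 : Poly point (0 ∷ 0 ∷ 1 ∷ []) Q
  𝕢 = linear (there (there here)) 0ℤ 1ℤ ⟨ only-x Q (m * m) ⟩
  m² : Poly point (0 ∷ 0 ∷ 1 ∷ []) (m * m)
  m² = linear (there (there here)) 1ℤ 0ℤ ⟨ only-y Q (m * m) ⟩
  Q-m² : Poly point (0 ∷ 0 ∷ 1 ∷ []) (Q - m * m)
  Q-m² = linear (there (there here)) (- 1ℤ) 1ℤ ⟨ x-y Q (m * m) ⟩

  mm : Poly point (1 ∷ 1 ∷ 0 ∷ []) (m * m)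
  mm = 𝕞₁ ⊠ 𝕞₂
  ab : Poly point (1 ∷ 1 ∷ 0 ∷ []) (a * b)
  ab = 𝕒 ⊠ 𝕓
  σ : Poly point (1 ∷ 1 ∷ 0 ∷ []) ((m - a) * m + m * (m - b))
  σ = m-a ⊠ 𝕞₂ ⊞ 𝕞₁ ⊠ m-b
  π : Poly point (1 ∷ 1 ∷ 0 ∷ []) ((m - a) * (m - b))
  π = m-a ⊠ m-b

  λ₃ : Poly point (1 ∷ 1 ∷ 0 ∷ []) (m * (+ 3 * m - a - b))
  λ₃ = (mm ⊞ σ) ⟨ l m a b ⟩
    where
    l : ∀ m a b → m * m + ((m - a) * m + m * (m - b)) ≡ m * (+ 3 * m - a - b)
    l = solve-∀

  quadratic : ∀ k₁ k₂ k₃ → Poly point (1 ∷ 1 ∷ 0 ∷ []) (k₁ * m * m - k₂ * (+ 2 * m - a - b) * m - k₃ * ((m - a) * (m - b)))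
  quadratic k₁ k₂ k₃ = (k k₁ ⊠ mm ⊞ k (- k₂) ⊠ σ ⊞ k (- k₃) ⊠ π) ⟨ l m a b k₁ k₂ k₃ ⟩
    where
    l : ∀ m a b k₁ k₂ k₃ → k₁ * (m * m) + - k₂ * ((m - a) * m + m * (m - b)) + - k₃ * ((m - a) * (m - b))
      ≡ k₁ * m * m - k₂ * (+ 2 * m - a - b) * m - k₃ * ((m - a) * (m - b))
    l = solve-∀

  ν₅ : Poly point (1 ∷ 1 ∷ 0 ∷ []) (N₅ m a b)
  ν₅ = quadratic (+ 2) (+ 2) (+ 5)

  p₁ : Poly point (1 ∷ 1 ∷ 0 ∷ []) (P₁ m a b)
  p₁ = (7m-5a ⊠ 𝕓 ⊞ 𝕒 ⊠ 7m-5b) ⟨ cong (_+ a * (+ 7 * m - + 5 * b)) (*-comm (+ 7 * m - + 5 * a) b) ⟩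

  w₂ : Poly point (1 ∷ 1 ∷ 0 ∷ []) (W₂ m a b)
  w₂ = 7m-5a ⊠ 7m-5b

  r₁ : Poly point (2 ∷ 2 ∷ 1 ∷ []) (m * ρ₁ m a b Q)
  r₁ = (λ₃ ⊠ quadratic (+ 44) (+ 9) (+ 40) ⊠ m²) ⟨ l m (+ 3 * m - a - b) _ ⟩
    where
    l : ∀ m x y → m * x * y * (m * m) ≡ m * (x * (m * m) * y)
    l = solve-∀

  r₂ : Poly point (2 ∷ 2 ∷ 1 ∷ []) (m * ρ₂ m a b Q)
  r₂ = (λ₃ ⊠ (k (+ 35) ⊠ mm ⊠ m² ⊞ k (- + 5) ⊠ ab ⊠ m² ⊞ k (+ 10) ⊠ ν₅ ⊠ Q-m²)) ⟨ l m (a * b) (+ 3 * m - a - b) (N₅ m a b) (Q - m * m) ⟩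
    where
    l : ∀ m x y n q → m * y * (+ 35 * (m * m) * (m * m) + - + 5 * x * (m * m) + + 10 * n * q) ≡ m * (y * (+ 35 * m * m * m * m - + 5 * m * m * x + + 10 * n * q))
    l = solve-∀

  -- The subtracted multiple of m⁷ is a margin that makes every edge contribute a strictly positive
  -- amount. The factor m³ lifts the expression from total degree 9 to 12 = 3 + 3 + 2 · 3, which is
  -- degree 3 in each pair, Q and m² counting twice.
  g : ∀ {ρ} → Poly point (2 ∷ 2 ∷ 1 ∷ []) (m * ρ) → Poly point (3 ∷ 3 ∷ 3 ∷ []) (m * m * m * (+ 5 * Ψ m a b Q ρ - + 4 * (a * b) * m⁷ m))
  g {ρ} r = (k (+ 5) ⊠ (k (+ 8) ⊠ ab ⊠ (r ⊞ k (- + 10) ⊠ p₁ ⊠ (𝕢 ⊠ mm ⊞ k (- + 2) ⊠ ab ⊠ m²)) ⊠ m² ⊠ m²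
                     ⊞ k (+ 3) ⊠ 𝕢 ⊠ 𝕢 ⊠ ((𝕒 ⊠ 𝕞₂ ⊞ 𝕞₁ ⊠ 𝕓) ⊠ mm ⊠ 𝕢 ⊞ k (- + 6) ⊠ ab ⊠ mm ⊠ m²) ⊠ w₂)
           ⊞ k (- + 4) ⊠ ab ⊠ mm ⊠ mm ⊠ m² ⊠ m² ⊠ m²) ⟨ l m a b Q ρ (P₁ m a b) (W₂ m a b) ⟩
    where
    l : ∀ m a b Q ρ P W →
       + 5 * (+ 8 * (a * b) * (m * ρ + - + 10 * P * (Q * (m * m) + - + 2 * (a * b) * (m * m))) * (m * m) * (m * m)
           + + 3 * Q * Q * ((a * m + m * b) * (m * m) * Q + - + 6 * (a * b) * (m * m) * (m * m)) * W)
       + - + 4 * (a * b) * (m * m) * (m * m) * (m * m) * (m * m) * (m * m)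
       ≡ m * m * m * (+ 5 * (+ 8 * m * m * (a * b) * (ρ - + 10 * m * P * (Q - + 2 * (a * b)))
          + + 3 * Q * Q * ((a + b) * Q - + 6 * m * (a * b)) * W) - + 4 * (a * b) * (m * m * m * m * m * m * m))
    l = solve-∀

  n : Poly point (3 ∷ 3 ∷ 3 ∷ []) (m * m * m * m * m * (m * m * m * m * m) * N₅ m a b)
  n = (ν₅ ⊠ mm ⊠ mm ⊠ m² ⊠ m² ⊠ m²) ⟨ l m (N₅ m a b) ⟩
    where
    l : ∀ m n → n * (m * m) * (m * m) * (m * m) * (m * m) * (m * m) ≡ m * m * m * m * m * (m * m * m * m * m) * n
    l = solve-∀

  -- The subdivision starts from the region a ≤ m, b ≤ m.
  positivity : 0≤Point point → a ≤ m → b ≤ m →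
    (0ℤ ≤ m * m * m * m * m * (m * m * m * m * m) * N₅ m a b × 0ℤ ≤ m * m * m * (+ 5 * Ψ m a b Q (ρ₁ m a b Q) - + 4 * (a * b) * m⁷ m)) ⊎
    (m * m * m * m * m * (m * m * m * m * m) * N₅ m a b ≤ 0ℤ × 0ℤ ≤ m * m * m * (+ 5 * Ψ m a b Q (ρ₂ m a b Q) - + 4 * (a * b) * m⁷ m))
  positivity = certify (3 ∷ 3 ∷ 3 ∷ []) here (there here) (g r₁) (g r₂) n subdivision tt

Ψ-positive : ∀ m a b Q → 0ℤ < m → 0ℤ ≤ a → a ≤ m → 0ℤ ≤ b → b ≤ m → 0ℤ ≤ Q →
  (0ℤ ≤ N₅ m a b × + 4 * (a * b) * m⁷ m ≤ + 5 * Ψ m a b Q (ρ₁ m a b Q)) ⊎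
  (N₅ m a b ≤ 0ℤ × + 4 * (a * b) * m⁷ m ≤ + 5 * Ψ m a b Q (ρ₂ m a b Q))
Ψ-positive m a b Q 0<m 0≤a a≤m 0≤b b≤m 0≤Q = conclude (Homogeneous.positivity m a b Q ((0≤a , 0≤m) , (0≤b , 0≤m) , (0≤Q , 0≤² m) , tt) a≤m b≤m)
  where
  0≤m : 0ℤ ≤ m
  0≤m = <⇒≤ 0<m
  0<m³ : 0ℤ < m * m * m
  0<m³ = 0<* (0<* 0<m 0<m) 0<m
  0<m⁵ : 0ℤ < m * m * m * m * m
  0<m⁵ = 0<* (0<* 0<m³ 0<m) 0<m
  conclude : (0ℤ ≤ m * m * m * m * m * (m * m * m * m * m) * N₅ m a b × 0ℤ ≤ m * m * m * (+ 5 * Ψ m a b Q (ρ₁ m a b Q) - + 4 * (a * b) * m⁷ m)) ⊎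
    (m * m * m * m * m * (m * m * m * m * m) * N₅ m a b ≤ 0ℤ × 0ℤ ≤ m * m * m * (+ 5 * Ψ m a b Q (ρ₂ m a b Q) - + 4 * (a * b) * m⁷ m)) →
    (0ℤ ≤ N₅ m a b × + 4 * (a * b) * m⁷ m ≤ + 5 * Ψ m a b Q (ρ₁ m a b Q)) ⊎
    (N₅ m a b ≤ 0ℤ × + 4 * (a * b) * m⁷ m ≤ + 5 * Ψ m a b Q (ρ₂ m a b Q))
  conclude (inj₁ (p , q)) = inj₁ (0≤-cancel (0<* 0<m⁵ 0<m⁵) p , 0≤-⇒≤ (0≤-cancel 0<m³ q))
  conclude (inj₂ (p , q)) = inj₂ (*-cancel-0< (0<* 0<m⁵ 0<m⁵) (subst (m * m * m * m * m * (m * m * m * m * m) * N₅ m a b ≤_) (sym (*-zeroʳ (m * m * m * m * m * (m * m * m * m * m)))) p)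
    , 0≤-⇒≤ (0≤-cancel 0<m³ q))

-- For an edge uv with d(u) = a and d(v) = b: X, Y and c are twice the numbers of edges that avoid N(v), N(u) and
-- both, α and β are the numbers of vertices that N(u) and N(v) lack to size m, and L = α + β + m is the size of C.
module EdgeBounds (m a b X Y c Q : ℤ) where

  α β L F : ℤ
  α = m - a
  β = m - b
  L = + 3 * m - a - b
  F = (+ 7 * m - + 5 * a) * b * X + (+ 7 * m - + 5 * b) * a * Y

  -- Nonnegative as soon as 2D ≥ m²: they express `fill-both`, `fill-one` with either neighbourhood
  -- in the role of I, and `random-third`, with D eliminated by that assumption.
  slack-both slack-I slack-J slack-third : ℤ
  slack-both  = + 2 * L * (α * X + β * Y) + + 2 * (m * m - m * (α + β) - + 2 * (α * β)) * c - L * L * (m * m)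
  slack-I     = + 25 * L * α * X + + 10 * L * (L - α) * Y - + 35 * α * (L - α) * c - + 11 * L * L * (m * m)
  slack-J     = + 25 * L * β * Y + + 10 * L * (L - β) * X - + 35 * β * (L - β) * c - + 11 * L * L * (m * m)
  slack-third = L * L * Q - L * m * (X + Y) + + 3 * (m * m) * c - L * L * (m * m)

  module _ (0≤m : 0ℤ ≤ m) (0≤a : 0ℤ ≤ a) (0≤b : 0ℤ ≤ b) (0≤α : 0ℤ ≤ α) (0≤β : 0ℤ ≤ β) (0<L : 0ℤ < L)
           (0≤c : 0ℤ ≤ c) (c≤X : c ≤ X) (c≤Y : c ≤ Y) (0≤slack-both : 0ℤ ≤ slack-both) where

    -- The multipliers are chosen such that c cancels completely and the coefficient of X becomes
    -- 10mL (7m - 5a) b, symmetrically for Y. This determines `N₅` as the multiplier of the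
    -- one-sided inequalities, which is why its sign has to be assumed.
    bound₁ : 0ℤ ≤ slack-I → 0ℤ ≤ slack-J → 0ℤ ≤ N₅ m a b → ρ₁ m a b Q ≤ + 10 * m * F
    bound₁ sI sJ 0≤N = *-cancel-0< 0<L (≤-slack _
      (0≤+ (0≤+ (0≤* (0≤* (0≤+ℕ 35) (0≤+ (0≤* 0≤m (0≤+ 0≤α 0≤β)) (0≤* (0≤+ℕ 2) (0≤* 0≤α 0≤β)))) 0≤slack-both)
                (0≤* 0≤N (0≤+ sI sJ)))
           (0≤* (0≤* (0≤+ℕ 35) (0≤* 0≤α 0≤β))
             (0≤+ (0≤+ (0≤* (0≤* 0≤L 0≤α) (≤⇒0≤- c≤X)) (0≤* (0≤* 0≤L 0≤β) (≤⇒0≤- c≤Y))) (0≤* (0≤+ (0≤² α) (0≤² β)) 0≤c))))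
      (l m a b X Y c Q))
      where
      0≤L : 0ℤ ≤ L
      0≤L = <⇒≤ 0<L
      l : ∀ m a b X Y c Q →
        (+ 3 * m - a - b) * (+ 10 * m * ((+ 7 * m - + 5 * a) * b * X + (+ 7 * m - + 5 * b) * a * Y))
        - (+ 3 * m - a - b) * ((+ 3 * m - a - b) * (m * m) * (+ 44 * m * m - + 9 * (+ 2 * m - a - b) * m - + 40 * ((m - a) * (m - b))))
        ≡ + 35 * (m * ((m - a) + (m - b)) + + 2 * ((m - a) * (m - b))) * (+ 2 * (+ 3 * m - a - b) * ((m - a) * X + (m - b) * Y) + + 2 * (m * m - m * ((m - a) + (m - b)) - + 2 * ((m - a) * (m - b))) * c - (+ 3 * m - a - b) * (+ 3 * m - a - b) * (m * m))
        + (+ 2 * m * m - + 2 * (+ 2 * m - a - b) * m - + 5 * ((m - a) * (m - b))) *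
          ((+ 25 * (+ 3 * m - a - b) * (m - a) * X + + 10 * (+ 3 * m - a - b) * ((+ 3 * m - a - b) - (m - a)) * Y - + 35 * (m - a) * ((+ 3 * m - a - b) - (m - a)) * c - + 11 * (+ 3 * m - a - b) * (+ 3 * m - a - b) * (m * m))
           + (+ 25 * (+ 3 * m - a - b) * (m - b) * Y + + 10 * (+ 3 * m - a - b) * ((+ 3 * m - a - b) - (m - b)) * X - + 35 * (m - b) * ((+ 3 * m - a - b) - (m - b)) * c - + 11 * (+ 3 * m - a - b) * (+ 3 * m - a - b) * (m * m)))
        + + 35 * ((m - a) * (m - b)) * ((+ 3 * m - a - b) * (m - a) * (X - c) + (+ 3 * m - a - b) * (m - b) * (Y - c) + ((m - a) * (m - a) + (m - b) * (m - b)) * c)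
      l = solve-∀

    -- For negative `N₅` the one-sided inequalities cannot be used, and `slack-third` enters with
    -- the multiplier -2 `N₅`. The multiple 2abm² of c that is left over is absorbed by Mantel's
    -- bound 2c ≤ L².
    bound₂ : 0ℤ ≤ slack-third → + 2 * c ≤ L * L → N₅ m a b ≤ 0ℤ → ρ₂ m a b Q ≤ + 10 * m * F
    bound₂ sU 2c≤L² N≤0 = *-cancel-0< 0<L (≤-slack _
      (0≤* (0≤+ℕ 5) (0≤+ (0≤+ (0≤* (0≤* (0≤+ℕ 7) (0≤² m)) 0≤slack-both) (0≤* (0≤* (0≤+ℕ 2) (≤⇒0≤- N≤0)) sU))
         (0≤* (0≤* (0≤* 0≤a 0≤b) (0≤² m)) (≤⇒0≤- 2c≤L²))))
      (l m a b X Y c Q))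
      where
      l : ∀ m a b X Y c Q →
        (+ 3 * m - a - b) * (+ 10 * m * ((+ 7 * m - + 5 * a) * b * X + (+ 7 * m - + 5 * b) * a * Y))
        - (+ 3 * m - a - b) * ((+ 3 * m - a - b) * (+ 35 * m * m * m * m - + 5 * m * m * (a * b) + + 10 * (+ 2 * m * m - + 2 * (+ 2 * m - a - b) * m - + 5 * ((m - a) * (m - b))) * (Q - m * m)))
        ≡ + 5 * (+ 7 * (m * m) * (+ 2 * (+ 3 * m - a - b) * ((m - a) * X + (m - b) * Y) + + 2 * (m * m - m * ((m - a) + (m - b)) - + 2 * ((m - a) * (m - b))) * c - (+ 3 * m - a - b) * (+ 3 * m - a - b) * (m * m))
        + + 2 * (0ℤ - (+ 2 * m * m - + 2 * (+ 2 * m - a - b) * m - + 5 * ((m - a) * (m - b)))) *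
          ((+ 3 * m - a - b) * (+ 3 * m - a - b) * Q - (+ 3 * m - a - b) * m * (X + Y) + + 3 * (m * m) * c - (+ 3 * m - a - b) * (+ 3 * m - a - b) * (m * m))
        + a * b * (m * m) * ((+ 3 * m - a - b) * (+ 3 * m - a - b) - + 2 * c))
      l = solve-∀

-- Triangle-free graphs

module TriangleFreeGraph {V : Set} (adj : V → V → Bool)
  (adj-sym : ∀ x y → adj x y ≡ adj y x) (adj-irr : ∀ x → adj x x ≡ false)
  (no-triangle : ∀ x y z → ¬ (adj x y ≡ true × adj y z ≡ true × adj x z ≡ true)) where

  A : V → V → ℤ
  A x y = if adj x y then 1ℤ else 0ℤ

  A-sym : ∀ x y → A x y ≡ A y x
  A-sym x y = cong (if_then 1ℤ else 0ℤ) (adj-sym x y)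

  A-irr : ∀ x → A x x ≡ 0ℤ
  A-irr x = cong (if_then 1ℤ else 0ℤ) (adj-irr x)

  A≥0 : ∀ x y → 0ℤ ≤ A x y
  A≥0 x y with adj x y
  ... | true  = +≤+ ℕ.z≤n
  ... | false = +≤+ ℕ.z≤n

  A≤1 : ∀ x y → A x y ≤ 1ℤ
  A≤1 x y with adj x y
  ... | true  = +≤+ (ℕ.s≤s ℕ.z≤n)
  ... | false = +≤+ ℕ.z≤n

  A-adj : ∀ {x y} → adj x y ≡ true → A x y ≡ 1ℤ
  A-adj p = cong (if_then 1ℤ else 0ℤ) p

  A-nonadj : ∀ {x y} → adj x y ≡ false → A x y ≡ 0ℤ
  A-nonadj p = cong (if_then 1ℤ else 0ℤ) p

  A-cases : ∀ x y (P : ℤ → Set) → (adj x y ≡ false → P 0ℤ) → (adj x y ≡ true → P 1ℤ) → P (A x y)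
  A-cases x y P p₀ p₁ = go (adj x y) refl
    where
    go : ∀ b → adj x y ≡ b → P (if b then 1ℤ else 0ℤ)
    go true  = p₁
    go false = p₀

  A-triangle : ∀ x y z → A x y * (A x z * A y z) ≡ 0ℤ
  A-triangle x y z with adj x y in p | adj x z in q | adj y z in r
  ... | false | _     | _     = refl
  ... | true  | false | _     = refl
  ... | true  | true  | false = refl
  ... | true  | true  | true  = ⊥-elim (no-triangle x y z (p , r , q))

  open Edges A A-sym A-irr A≥0 public

  nbrs others : V → List V → List V
  nbrs   v xs = filterᵇ (adj v) xs
  others v xs = filterᵇ (λ u → not (adj v u)) xs

  ∑-nbrs : ∀ v xs f → ∑ (nbrs v xs) f ≡ ∑ xs (λ u → A v u * f u)
  ∑-nbrs v []       f = refl
  ∑-nbrs v (x ∷ xs) f with adj v x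
  ... | true  = cong₂ _+_ (sym (*-identityˡ (f x))) (∑-nbrs v xs f)
  ... | false = trans (∑-nbrs v xs f) (sym (+-identityˡ _))

  nbrs-others : ∀ v xs → xs ≋ nbrs v xs ++ others v xs
  nbrs-others v xs = ≋-by λ f → trans (go f xs) (sym (∑-++ (nbrs v xs) (others v xs) f))
    where
    l : ∀ a b c → a + (b + c) ≡ b + (a + c)
    l = solve-∀
    go : ∀ f ys → ∑ ys f ≡ ∑ (nbrs v ys) f + ∑ (others v ys) f
    go f []       = refl
    go f (x ∷ ys) with adj v x
    ... | true  = trans (cong (_+_ (f x)) (go f ys)) (sym (+-assoc (f x) (∑ (nbrs v ys) f) (∑ (others v ys) f)))
    ... | false = trans (cong (_+_ (f x)) (go f ys)) (l (f x) (∑ (nbrs v ys) f) (∑ (others v ys) f))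

  #nbrs : ∀ v xs → # (nbrs v xs) ≡ deg xs v
  #nbrs v xs = trans (sym (*-identityʳ _)) (trans (sym (∑-const (nbrs v xs) 1ℤ))
    (trans (∑-nbrs v xs (λ _ → 1ℤ)) (∑-cong xs λ u → *-identityʳ (A v u))))

  E-nbrs : ∀ v xs ys → E (nbrs v xs) ys ≡ ∑ xs (λ u → A v u * deg ys u)
  E-nbrs v xs ys = ∑-nbrs v xs (deg ys)

  Q-nbrs : ∀ v xs → Q (nbrs v xs) ≡ 0ℤ
  Q-nbrs v xs = trans (E-nbrs v xs (nbrs v xs)) (trans (∑-cong xs λ u →
      trans (cong (A v u *_) (∑-nbrs v xs (A u)))
        (trans (sym (∑-* xs (A v u) _)) (trans (∑-cong xs λ w → A-triangle v u w) (∑-0 xs))))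
      (∑-0 xs))

  nbrDeg : List V → V → ℤ
  nbrDeg xs v = ∑ xs (λ u → A v u * deg xs u)

  E-nbrs-others : ∀ v xs → E (nbrs v xs) (others v xs) ≡ nbrDeg xs v
  E-nbrs-others v xs = begin
    E (nbrs v xs) (others v xs)                            ≡⟨ sym (+-identityˡ _) ⟩
    0ℤ + E (nbrs v xs) (others v xs)                       ≡⟨ cong (_+ E (nbrs v xs) (others v xs)) (sym (Q-nbrs v xs)) ⟩
    Q (nbrs v xs) + E (nbrs v xs) (others v xs)            ≡⟨ sym (E-++ʳ (nbrs v xs) (others v xs) (nbrs v xs)) ⟩
    E (nbrs v xs) (nbrs v xs ++ others v xs)               ≡⟨ E-≋ (≋-refl {xs = nbrs v xs}) (≋-sym (nbrs-others v xs)) ⟩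
    E (nbrs v xs) xs                                       ≡⟨ E-nbrs v xs xs ⟩
    nbrDeg xs v                                            ∎
    where open ≡-Reasoning

  -- N(v) spans no edge, so the degrees of its vertices count each edge that meets it exactly once.
  Q-others : ∀ v xs → Q (others v xs) ≡ Q xs - 2ℤ * nbrDeg xs v
  Q-others v xs = sym (trans (cong (_- 2ℤ * nbrDeg xs v) (trans (Q-≋ (nbrs-others v xs)) (trans (Q-++ (nbrs v xs) (others v xs))
      (cong₂ (λ a b → a + 2ℤ * b + Q (others v xs)) (Q-nbrs v xs) (E-nbrs-others v xs))))) (l (nbrDeg xs v) _))
    where
    l : ∀ s q → 0ℤ + + 2 * s + q - + 2 * s ≡ q
    l = solve-∀

  A≤deg : ∀ xs v u → u ∈ xs → A v u ≤ deg xs v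
  A≤deg (x ∷ xs) v .x (here refl) = ≤-slack _ (0≤deg xs v) (l (A v x) (deg xs v))
    where
    l : ∀ a b → a + b - a ≡ b
    l = solve-∀
  A≤deg (x ∷ xs) v u (there p) = ≤-trans (A≤deg xs v u p) (≤-slack _ (A≥0 v x) (l (A v x) (deg xs v)))
    where
    l : ∀ a b → a + b - b ≡ a
    l = solve-∀

  deg≤# : ∀ xs v → deg xs v ≤ # xs
  deg≤# xs v = subst (deg xs v ≤_) (trans (∑-const xs 1ℤ) (*-identityʳ _)) (∑-mono xs λ u → A≤1 v u)

-- Averages over random splits and over edges

module BalancedPartitions {V : Set} (adj : V → V → Bool)
  (adj-sym : ∀ x y → adj x y ≡ adj y x) (adj-irr : ∀ x → adj x x ≡ false)
  (no-triangle : ∀ x y z → ¬ (adj x y ≡ true × adj y z ≡ true × adj x z ≡ true)) where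

  open TriangleFreeGraph adj adj-sym adj-irr no-triangle

  -- The expectation over a uniformly random split, by conditioning on where the head of the list goes.
  split-binom : ∀ C r s → length C ≡ r ℕ.+ s → (p q : V → ℤ) (λ′ μ D : ℤ) →
    (∀ R S → C ≋ (R ++ S) → length R ≡ r → length S ≡ s → D ≤ ∑ R p + ∑ S q + (λ′ * Q R + μ * Q S)) →
    binom r s * D ≤ (binom₁ r s * ∑ C p + binom¹ r s * ∑ C q) + (λ′ * binom₂ r s + μ * binom² r s) * Q C
  split-binom [] zero zero eq p q λ′ μ D h = subst₂ _≤_ (sym (*-identityˡ D)) (l λ′ μ) (h [] [] ≋-refl refl refl)
    where
    l : ∀ λ′ μ → 0ℤ + 0ℤ + (λ′ * 0ℤ + μ * 0ℤ) ≡ (0ℤ * 0ℤ + 0ℤ * 0ℤ) + (λ′ * 0ℤ + μ * 0ℤ) * 0ℤ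
    l = solve-∀
  -- A single element needs its own case: the coefficient `binom² 0 1` of pairs is 0 rather than 1,
  -- which is harmless because `Q (x ∷ [])` vanishes.
  split-binom (x ∷ C) zero (suc zero) eq p q λ′ μ D h with C | ℕₚ.suc-injective eq
  ... | [] | _ = subst₂ _≤_ (sym (*-identityˡ D)) (trans (cong (λ z → 0ℤ + (q x + 0ℤ) + (λ′ * 0ℤ + μ * z)) Qx) (trans (l λ′ μ (p x) (q x)) (cong (λ z → (0ℤ * (p x + 0ℤ) + 1ℤ * (q x + 0ℤ)) + (λ′ * 0ℤ + μ * 0ℤ) * z) (sym Qx)))) (h [] (x ∷ []) ≋-refl refl refl)
    where
    Qx : Q (x ∷ []) ≡ 0ℤ
    Qx = Q-∷ x []
    l : ∀ λ′ μ p q → 0ℤ + (q + 0ℤ) + (λ′ * 0ℤ + μ * 0ℤ) ≡ (0ℤ * (p + 0ℤ) + 1ℤ * (q + 0ℤ)) + (λ′ * 0ℤ + μ * 0ℤ) * 0ℤ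
    l = solve-∀
  split-binom (x ∷ C) zero (suc (suc s)) eq p q λ′ μ D h =
    subst₂ _≤_ (sym (*-identityˡ D)) (l λ′ μ (∑ (x ∷ C) p) (∑ (x ∷ C) q) (Q (x ∷ C))) (h [] (x ∷ C) ≋-refl refl eq)
    where
    l : ∀ λ′ μ p q Q → 0ℤ + q + (λ′ * 0ℤ + μ * Q) ≡ (0ℤ * p + 1ℤ * q) + (λ′ * 0ℤ + μ * 1ℤ) * Q
    l = solve-∀
  split-binom (x ∷ C) (suc zero) zero eq p q λ′ μ D h with C | ℕₚ.suc-injective eq
  ... | [] | _ = subst₂ _≤_ (sym (*-identityˡ D)) (trans (cong (λ z → (p x + 0ℤ) + 0ℤ + (λ′ * z + μ * 0ℤ)) Qx) (trans (l λ′ μ (p x) (q x)) (cong (λ z → (1ℤ * (p x + 0ℤ) + 0ℤ * (q x + 0ℤ)) + (λ′ * 0ℤ + μ * 0ℤ) * z) (sym Qx)))) (h (x ∷ []) [] ≋-refl refl refl)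
    where
    Qx : Q (x ∷ []) ≡ 0ℤ
    Qx = Q-∷ x []
    l : ∀ λ′ μ p q → (p + 0ℤ) + 0ℤ + (λ′ * 0ℤ + μ * 0ℤ) ≡ (1ℤ * (p + 0ℤ) + 0ℤ * (q + 0ℤ)) + (λ′ * 0ℤ + μ * 0ℤ) * 0ℤ
    l = solve-∀
  split-binom (x ∷ C) (suc (suc r)) zero eq p q λ′ μ D h =
    subst₂ _≤_ (sym (*-identityˡ D))
      (trans (l λ′ μ (∑ (x ∷ C) p) (∑ (x ∷ C) q) (Q (x ∷ C)))
             (cong (λ b → (1ℤ * ∑ (x ∷ C) p + 0ℤ * ∑ (x ∷ C) q) + (λ′ * b + μ * 0ℤ) * Q (x ∷ C)) (sym (binom-r0 r))))
      (h (x ∷ C) [] (≋-by λ f → sym (trans (∑-++ (x ∷ C) [] f) (+-identityʳ _))) (trans eq (ℕₚ.+-identityʳ _)) refl)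
    where
    l : ∀ λ′ μ p q Q → p + 0ℤ + (λ′ * Q + μ * 0ℤ) ≡ (1ℤ * p + 0ℤ * q) + (λ′ * 1ℤ + μ * 0ℤ) * Q
    l = solve-∀
  split-binom (x ∷ C) (suc r) (suc s) eq p q λ′ μ D h =
    ≤-slack _ (0≤+ (≤⇒0≤- ihR) (≤⇒0≤- ihS)) final
    where
    -- Once x has been placed, its edges into its own part become linear weights on the remaining
    -- vertices. This is why the statement carries arbitrary weights p and q.
    p′ q′ : V → ℤ
    p′ y = p y + 2ℤ * λ′ * A x y
    q′ y = q y + 2ℤ * μ * A x y
    ∑p′ : ∀ R → ∑ R p′ ≡ ∑ R p + 2ℤ * λ′ * deg R x
    ∑p′ R = trans (∑-+ R p _) (cong (_+_ (∑ R p)) (∑-* R (2ℤ * λ′) (A x)))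
    ∑q′ : ∀ R → ∑ R q′ ≡ ∑ R q + 2ℤ * μ * deg R x
    ∑q′ R = trans (∑-+ R q _) (cong (_+_ (∑ R q)) (∑-* R (2ℤ * μ) (A x)))
    mid : ∀ R S f → ∑ (R ++ (x ∷ S)) f ≡ ∑ (x ∷ (R ++ S)) f
    mid []      S f = refl
    mid (y ∷ R) S f = trans (cong (_+_ (f y)) (mid R S f)) (l (f y) (f x) _)
      where
      l : ∀ a b c → a + (b + c) ≡ b + (a + c)
      l = solve-∀
    ihR : binom r (suc s) * (D - p x) ≤ (binom₁ r (suc s) * ∑ C p′ + binom r s * ∑ C q) + (λ′ * binom₂ r (suc s) + μ * binom¹ r s) * Q C
    ihR = split-binom C r (suc s) (ℕₚ.suc-injective eq) p′ q λ′ μ (D - p x) λ R S C≋ lR lS →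
      ≤-slack _ (≤⇒0≤- (h (x ∷ R) S (≋-by λ f → cong (_+_ (f x)) (∑≡ C≋ f)) (cong suc lR) lS))
        (trans (cong (λ z → z + ∑ S q + (λ′ * Q R + μ * Q S) - (D - p x)) (∑p′ R))
          (trans (l D (p x) (∑ R p) (∑ S q) λ′ μ (deg R x) (Q R) (Q S))
            (cong (λ z → p x + ∑ R p + ∑ S q + (λ′ * z + μ * Q S) - D) (sym (Q-∷ x R)))))
      where
      l : ∀ D px P q λ′ μ d QR QS → (P + + 2 * λ′ * d) + q + (λ′ * QR + μ * QS) - (D - px) ≡ px + P + q + (λ′ * (+ 2 * d + QR) + μ * QS) - D
      l = solve-∀
    ihS : binom (suc r) s * (D - q x) ≤ (binom r s * ∑ C p + binom¹ (suc r) s * ∑ C q′) + (λ′ * binom₁ r s + μ * binom² (suc r) s) * Q C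
    ihS = split-binom C (suc r) s (trans (ℕₚ.suc-injective eq) (ℕₚ.+-suc r s)) p q′ λ′ μ (D - q x) λ R S C≋ lR lS →
      ≤-slack _ (≤⇒0≤- (h R (x ∷ S) (≋-by λ f → trans (cong (_+_ (f x)) (∑≡ C≋ f)) (sym (mid R S f))) lR (cong suc lS)))
        (trans (cong (λ z → ∑ R p + z + (λ′ * Q R + μ * Q S) - (D - q x)) (∑q′ S))
          (trans (l D (q x) (∑ R p) (∑ S q) λ′ μ (deg S x) (Q R) (Q S))
            (cong (λ z → ∑ R p + (q x + ∑ S q) + (λ′ * Q R + μ * z) - D) (sym (Q-∷ x S)))))
      where
      l : ∀ D qx P q λ′ μ d QR QS → P + (q + + 2 * μ * d) + (λ′ * QR + μ * QS) - (D - qx) ≡ P + (qx + q) + (λ′ * QR + μ * (+ 2 * d + QS)) - D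
      l = solve-∀
    final : (binom r (suc s) * ∑ (x ∷ C) p + binom (suc r) s * ∑ (x ∷ C) q) + (λ′ * binom₁ r (suc s) + μ * binom¹ (suc r) s) * Q (x ∷ C)
              - binom (suc r) (suc s) * D
          ≡ ((binom₁ r (suc s) * ∑ C p′ + binom r s * ∑ C q) + (λ′ * binom₂ r (suc s) + μ * binom¹ r s) * Q C - binom r (suc s) * (D - p x))
          + ((binom r s * ∑ C p + binom¹ (suc r) s * ∑ C q′) + (λ′ * binom₁ r s + μ * binom² (suc r) s) * Q C - binom (suc r) s * (D - q x))
    final = combine (binom r s) (binom₂ r (suc s)) (binom₁ r s) (binom¹ r s) (binom² (suc r) s)
              (pascal₂ r s) (pascal² r s) (pascal₁ r s) (pascal¹ r s) (Q-∷ x C) (∑p′ C) (∑q′ C)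
      where
      l : ∀ b b20 c10 c01 b02 D px qx P R d Q λ′ μ →
        (((b20 + c10) + b) * (px + P) + (b + (c01 + b02)) * (qx + R)) + (λ′ * (b20 + c10) + μ * (c01 + b02)) * (+ 2 * d + Q) - (((b20 + c10) + b) + (b + (c01 + b02))) * D
        ≡ (((b20 + c10) * (P + + 2 * λ′ * d) + b * R) + (λ′ * b20 + μ * c01) * Q - ((b20 + c10) + b) * (D - px))
        + ((b * P + (c01 + b02) * (R + + 2 * μ * d)) + (λ′ * c10 + μ * b02) * Q - (b + (c01 + b02)) * (D - qx))
      l = solve-∀
      combine : ∀ b b20 c10 c01 b02 {b10 b01 B₁ B₂ Qx P′ R′} → b20 + c10 ≡ b10 → c01 + b02 ≡ b01 → b10 + b ≡ B₁ → b + b01 ≡ B₂ →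
        Qx ≡ 2ℤ * deg C x + Q C → P′ ≡ ∑ C p + 2ℤ * λ′ * deg C x → R′ ≡ ∑ C q + 2ℤ * μ * deg C x →
        (B₁ * (p x + ∑ C p) + B₂ * (q x + ∑ C q)) + (λ′ * b10 + μ * b01) * Qx - (B₁ + B₂) * D
        ≡ ((b10 * P′ + b * ∑ C q) + (λ′ * b20 + μ * c01) * Q C - B₁ * (D - p x))
        + ((b * ∑ C p + b01 * R′) + (λ′ * c10 + μ * b02) * Q C - B₂ * (D - q x))
      combine b b20 c10 c01 b02 refl refl refl refl refl refl refl = l b b20 c10 c01 b02 D (p x) (q x) (∑ C p) (∑ C q) (deg C x) (Q C) λ′ μ

  private
    0≤k[k-1] : ∀ n → 0ℤ ≤ + n * (+ n - 1ℤ)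
    0≤k[k-1] zero    = ≤-refl
    0≤k[k-1] (suc n) = 0≤* {+ suc n} {+ suc n - 1ℤ} (0≤+ℕ (suc n)) (subst (0ℤ ≤_) (sym (l (+ n))) (0≤+ℕ n))
      where
      l : ∀ n → 1ℤ + n - 1ℤ ≡ n
      l = solve-∀

    0<n-1 : ∀ {n} → 2 ℕ.≤ n → 0ℤ < + n - 1ℤ
    0<n-1 (ℕ.s≤s (ℕ.s≤s _)) = +<+ (ℕ.s≤s ℕ.z≤n)

  -- `split-binom` divided by the number of splits: the coefficients become the probabilities r / N
  -- of one vertex and r (r - 1) / (N (N - 1)) of two vertices falling into a part, with N = r + s.
  split-exact : ∀ C r s → length C ≡ r ℕ.+ s → (p q : V → ℤ) (λ′ μ D : ℤ) →
    (∀ R S → C ≋ R ++ S → length R ≡ r → length S ≡ s → D ≤ ∑ R p + ∑ S q + (λ′ * Q R + μ * Q S)) →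
    (+ r + + s) * (+ r + + s - 1ℤ) * D ≤
      (+ r + + s - 1ℤ) * (+ r * ∑ C p + + s * ∑ C q) + (λ′ * (+ r * (+ r - 1ℤ)) + μ * (+ s * (+ s - 1ℤ))) * Q C
  split-exact C r s len p q λ′ μ D h =
    *-cancel-0< (binom>0 r s) (≤-slack _ (0≤* (0≤k[k-1] (r ℕ.+ s)) (≤⇒0≤- (split-binom C r s len p q λ′ μ D h))) eq)
    where
    l₁ : ∀ N b D X → b * X - b * (N * (N - 1ℤ) * D) ≡ b * X - N * (N - 1ℤ) * (b * D)
    l₁ = solve-∀
    l₂ : ∀ N b r s b₁ b₁′ b₂ b₂′ P R Q λ′ μ → N * b₁ ≡ r * b → N * b₁′ ≡ s * b →
      N * (N - 1ℤ) * b₂ ≡ r * (r - 1ℤ) * b → N * (N - 1ℤ) * b₂′ ≡ s * (s - 1ℤ) * b →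
      b * ((N - 1ℤ) * (r * P + s * R) + (λ′ * (r * (r - 1ℤ)) + μ * (s * (s - 1ℤ))) * Q) ≡
      N * (N - 1ℤ) * ((b₁ * P + b₁′ * R) + (λ′ * b₂ + μ * b₂′) * Q)
    l₂ N b r s b₁ b₁′ b₂ b₂′ P R Q λ′ μ e₁ e₂ e₃ e₄ =
      trans (a N b r s P R Q λ′ μ) (trans (cong₄′ (sym e₁) (sym e₂) (sym e₃) (sym e₄)) (c N b₁ b₁′ b₂ b₂′ P R Q λ′ μ))
      where
      a : ∀ N b r s P R Q λ′ μ → b * ((N - 1ℤ) * (r * P + s * R) + (λ′ * (r * (r - 1ℤ)) + μ * (s * (s - 1ℤ))) * Q)
        ≡ (N - 1ℤ) * ((r * b) * P + (s * b) * R) + (λ′ * (r * (r - 1ℤ) * b) + μ * (s * (s - 1ℤ) * b)) * Q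
      a = solve-∀
      c : ∀ N b₁ b₁′ b₂ b₂′ P R Q λ′ μ → (N - 1ℤ) * ((N * b₁) * P + (N * b₁′) * R) + (λ′ * (N * (N - 1ℤ) * b₂) + μ * (N * (N - 1ℤ) * b₂′)) * Q
        ≡ N * (N - 1ℤ) * ((b₁ * P + b₁′ * R) + (λ′ * b₂ + μ * b₂′) * Q)
      c = solve-∀
      cong₄′ : ∀ {x x′ y y′ z z′ w w′} → x ≡ x′ → y ≡ y′ → z ≡ z′ → w ≡ w′ →
        (N - 1ℤ) * (x * P + y * R) + (λ′ * z + μ * w) * Q ≡ (N - 1ℤ) * (x′ * P + y′ * R) + (λ′ * z′ + μ * w′) * Q
      cong₄′ refl refl refl refl = refl
    eq = trans (l₁ (+ r + + s) (binom r s) D _)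
           (trans (cong (_- (+ r + + s) * (+ r + + s - 1ℤ) * (binom r s * D))
                    (l₂ (+ r + + s) (binom r s) (+ r) (+ s) (binom₁ r s) (binom¹ r s) (binom₂ r s) (binom² r s) (∑ C p) (∑ C q) (Q C) λ′ μ
                      (binom₁-ratio r s) (binom¹-ratio r s) (binom₂-ratio r s) (binom²-ratio r s)))
             (l₃ ((+ r + + s) * (+ r + + s - 1ℤ)) _ (binom r s * D)))
      where
      l₃ : ∀ k x y → k * x - k * y ≡ k * (x - y)
      l₃ = solve-∀

  -- Relaxes r (r - 1) / (N (N - 1)) to (r / N)². The difference is a nonnegative multiple of (λ +
  -- μ) r s Q(C), so the signs of λ and μ matter here.
  split-average : ∀ C r s → length C ≡ r ℕ.+ s → 2 ℕ.≤ r ℕ.+ s → (p q : V → ℤ) (λ′ μ D : ℤ) → 0ℤ ≤ λ′ → 0ℤ ≤ μ →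
    (∀ R S → C ≋ R ++ S → length R ≡ r → length S ≡ s → D ≤ ∑ R p + ∑ S q + (λ′ * Q R + μ * Q S)) →
    (+ r + + s) * (+ r + + s) * D ≤
      (+ r + + s) * (+ r * ∑ C p + + s * ∑ C q) + (λ′ * (+ r * + r) + μ * (+ s * + s)) * Q C
  split-average C r s len 2≤ p q λ′ μ D 0≤λ 0≤μ h = *-cancel-0< N>0
    (≤-slack _ (0≤+ (0≤* (0≤+ℕ (r ℕ.+ s)) (≤⇒0≤- (split-exact C r s len p q λ′ μ D h)))
                    (0≤* (0≤* (0≤+ 0≤λ 0≤μ) (0≤* (0≤+ℕ r) (0≤+ℕ s))) (0≤Q C)))
             (l (+ r) (+ s) (∑ C p) (∑ C q) (Q C) λ′ μ D))
    where
    N>0 : 0ℤ < + r + + s - 1ℤ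
    N>0 = 0<n-1 2≤
    l : ∀ r s P R Q λ′ μ D →
      (r + s - 1ℤ) * ((r + s) * (r * P + s * R) + (λ′ * (r * r) + μ * (s * s)) * Q) - (r + s - 1ℤ) * ((r + s) * (r + s) * D)
      ≡ (r + s) * ((r + s - 1ℤ) * (r * P + s * R) + (λ′ * (r * (r - 1ℤ)) + μ * (s * (s - 1ℤ))) * Q - (r + s) * (r + s - 1ℤ) * D)
        + (λ′ + μ) * (r * s) * Q
    l = solve-∀

  -- Two nested splits: R is separated from U, and U is then split into S and T. The inner bound,
  -- multiplied by (s + t)² to stay integral, is again of the form that the outer average accepts.
  split₃-average : ∀ C r s t → length C ≡ r ℕ.+ (s ℕ.+ t) → 2 ℕ.≤ s ℕ.+ t → (p q : V → ℤ) (D : ℤ) →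
    (∀ R S T → C ≋ R ++ (S ++ T) → length R ≡ r → length S ≡ s → length T ≡ t →
       D ≤ ∑ R p + ∑ S q + (Q R + Q S + Q T)) →
    (+ r + (+ s + + t)) * (+ r + (+ s + + t)) * D ≤
      (+ r + (+ s + + t)) * (+ r * ∑ C p + + s * ∑ C q) + (+ r * + r + + s * + s + + t * + t) * Q C
  split₃-average C r s t len 2≤ p q D h =
    *-cancel-0< (0<* N>0 N>0) (≤-slack _ (≤⇒0≤- outer) (fin (+ r) (+ s) (+ t) (∑ C p) (∑ C q) (Q C) D _ _ (∑-* C (N′ * N′) p) (∑-* C (N′ * + s) q)))
    where
    N′ = + s + + t
    N>0 : 0ℤ < N′
    N>0 = +<+ (ℕₚ.≤-trans (ℕ.s≤s ℕ.z≤n) 2≤)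
    inner : ∀ R U → C ≋ R ++ U → length R ≡ r → length U ≡ s ℕ.+ t →
      N′ * N′ * (D - (∑ R p + Q R)) ≤ N′ * (+ s * ∑ U q + + t * ∑ U (λ _ → 0ℤ)) + (1ℤ * (+ s * + s) + 1ℤ * (+ t * + t)) * Q U
    inner R U C≋ lR lU = split-average U s t lU 2≤ q (λ _ → 0ℤ) 1ℤ 1ℤ _ (0≤+ℕ 1) (0≤+ℕ 1) λ S T U≋ lS lT →
      ≤-slack _ (≤⇒0≤- (h R S T (≋-trans C≋ (≋-++ (≋-refl {xs = R}) U≋)) lR lS lT))
        (trans (cong (λ z → ∑ S q + z + (1ℤ * Q S + 1ℤ * Q T) - (D - (∑ R p + Q R))) (∑-0 T)) (l (∑ R p) (∑ S q) (Q R) (Q S) (Q T) D))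
      where
      l : ∀ P R a b c D → R + 0ℤ + (1ℤ * b + 1ℤ * c) - (D - (P + a)) ≡ P + R + (a + b + c) - D
      l = solve-∀
    outer : _ ≤ _
    outer = split-average C r (s ℕ.+ t) len (ℕₚ.≤-trans 2≤ (ℕₚ.m≤n+m _ r)) (λ x → N′ * N′ * p x) (λ x → N′ * + s * q x)
      (N′ * N′) (+ s * + s + + t * + t) (N′ * N′ * D) (0≤² N′) (0≤+ (0≤² (+ s)) (0≤² (+ t))) λ R U C≋ lR lU →
        ≤-slack _ (≤⇒0≤- (inner R U C≋ lR lU))
          (fin′ (+ s) (+ t) (∑ R p) (∑ U q) (Q R) (Q U) D _ _ _ (∑-* R (N′ * N′) p) (∑-* U (N′ * + s) q) (∑-0 U))
      where
      fin′ : ∀ s t P R a b D X Y Z → X ≡ (s + t) * (s + t) * P → Y ≡ (s + t) * s * R → Z ≡ 0ℤ →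
        X + Y + ((s + t) * (s + t) * a + (s * s + t * t) * b) - (s + t) * (s + t) * D
        ≡ (s + t) * (s * R + t * Z) + (1ℤ * (s * s) + 1ℤ * (t * t)) * b - (s + t) * (s + t) * (D - (P + a))
      fin′ s t P R a b D _ _ _ refl refl refl = l s t P R a b D
        where
        l : ∀ s t P R a b D → (s + t) * (s + t) * P + (s + t) * s * R + ((s + t) * (s + t) * a + (s * s + t * t) * b) - (s + t) * (s + t) * D
          ≡ (s + t) * (s * R + t * 0ℤ) + (1ℤ * (s * s) + 1ℤ * (t * t)) * b - (s + t) * (s + t) * (D - (P + a))
        l = solve-∀
    fin : ∀ r s t P R Q D X Y → X ≡ (s + t) * (s + t) * P → Y ≡ (s + t) * s * R →
      (s + t) * (s + t) * ((r + (s + t)) * (r * P + s * R) + (r * r + s * s + t * t) * Q) - (s + t) * (s + t) * ((r + (s + t)) * (r + (s + t)) * D)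
      ≡ (r + (s + t)) * (r * X + (s + t) * Y) + ((s + t) * (s + t) * (r * r) + (s * s + t * t) * ((s + t) * (s + t))) * Q
        - (r + (s + t)) * (r + (s + t)) * ((s + t) * (s + t) * D)
    fin r s t P R Q D _ _ refl refl = l r s t P R Q D
      where
      l : ∀ r s t P R Q D →
        (s + t) * (s + t) * ((r + (s + t)) * (r * P + s * R) + (r * r + s * s + t * t) * Q) - (s + t) * (s + t) * ((r + (s + t)) * (r + (s + t)) * D)
        ≡ (r + (s + t)) * (r * ((s + t) * (s + t) * P) + (s + t) * ((s + t) * s * R)) + ((s + t) * (s + t) * (r * r) + (s * s + t * t) * ((s + t) * (s + t))) * Q
          - (r + (s + t)) * (r + (s + t)) * ((s + t) * (s + t) * D)
      l = solve-∀

  -- An edgewise inequality g ≥ 0 summed with weights 1 / (deg u · deg v), denominators being cleared by recip.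
  edge-average : ∀ H M → (∀ v → v ∈ H → deg H v ≤ + M) → (c : ℤ) (T : ℤ → ℤ) → T 0ℤ ≤ 0ℤ →
    (∀ u v → u ∈ H → v ∈ H → adj u v ≡ true →
       0ℤ ≤ c * (deg H u * deg H u * (deg H v * deg H v)) - deg H v * T (deg H u) - deg H u * T (deg H v)) →
    2ℤ * ∑ H (λ v → T (deg H v)) ≤ c * ∑ H (λ v → deg H v * nbrDeg H v)
  edge-average H M bd c T T0 g≥0 =
    *-cancel-0< (0<* (0<! M) (0<! M)) (≤-slack _ (0≤+ W≥0 (0≤* (0≤* (0≤+ℕ 2) (0≤+ℕ (M !))) (≤⇒0≤- low))) fin)
    where
    K = + (M !)
    d w : V → ℤ
    d = deg H
    w v = recip M (d v)
    wd : ∀ u v → u ∈ H → v ∈ H → A u v * (w u * d u) ≡ A u v * K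
    wd u v u∈ v∈ with adj u v in eq
    ... | false = refl
    ... | true  = cong (1ℤ *_) (recip-* M (d u) (subst (_≤ d u) (A-adj eq) (A≤deg H u v v∈)) (bd u u∈))
    wd′ : ∀ u v → u ∈ H → v ∈ H → A u v * (w v * d v) ≡ A u v * K
    wd′ u v u∈ v∈ = trans (cong (_* (w v * d v)) (A-sym u v)) (trans (wd v u v∈ u∈) (cong (_* K) (A-sym v u)))
    G : V → V → ℤ
    G u v = A u v * (w u * w v * (c * (d u * d u * (d v * d v)) - d v * T (d u) - d u * T (d v)))
    G≥0 : ∀ u v → u ∈ H → v ∈ H → 0ℤ ≤ G u v
    G≥0 u v u∈ v∈ with adj u v in eq
    ... | false = ≤-refl
    ... | true  = 0≤* {1ℤ} (0≤+ℕ 1) (0≤* (0≤* (0≤recip M (d u)) (0≤recip M (d v))) (g≥0 u v u∈ v∈ eq))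
    W≥0 : 0ℤ ≤ ∑ H (λ u → ∑ H (G u))
    W≥0 = 0≤∑∈ H λ u u∈ → 0≤∑∈ H λ v v∈ → G≥0 u v u∈ v∈
    expand : ∀ u v → u ∈ H → v ∈ H → G u v ≡ (c * (K * K) * d u * (A u v * d v) + - (K * (w u * T (d u))) * A u v) + - K * (A u v * (w v * T (d v)))
    expand u v u∈ v∈ = trans (l₁ (A u v) (w u) (w v) (d u) (d v) c (T (d u)) (T (d v)))
      (l₃ _ _ (wd u v u∈ v∈) (wd′ u v u∈ v∈))
      where
      l₁ : ∀ A wu wv du dv c Tu Tv → A * (wu * wv * (c * (du * du * (dv * dv)) - dv * Tu - du * Tv))
           ≡ c * ((A * (wu * du)) * (du * ((wv * dv) * dv))) - wu * Tu * (A * (wv * dv)) - wv * Tv * (A * (wu * du))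
      l₁ = solve-∀
      l₃ : ∀ X Y → X ≡ A u v * K → Y ≡ A u v * K →
        c * (X * (d u * ((w v * d v) * d v))) - w u * T (d u) * Y - w v * T (d v) * X
        ≡ (c * (K * K) * d u * (A u v * d v) + - (K * (w u * T (d u))) * A u v) + - K * (A u v * (w v * T (d v)))
      l₃ _ _ refl refl = trans (cong (_- w v * T (d v) * (A u v * K)) (cong (_- w u * T (d u) * (A u v * K))
           (trans (l₄ (A u v) c K (d u) (w v * d v) (d v)) (trans (cong (λ z → c * K * d u * d v * z) (wd′ u v u∈ v∈)) refl))))
           (l₅ (A u v) c K (d u) (d v) (w u) (w v) (T (d u)) (T (d v)))
        where
        l₄ : ∀ A c K du x dv → c * (A * K * (du * (x * dv))) ≡ c * K * du * dv * (A * x)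
        l₄ = solve-∀
        l₅ : ∀ A c K du dv wu wv Tu Tv → c * K * du * dv * (A * K) - wu * Tu * (A * K) - wv * Tv * (A * K)
           ≡ (c * (K * K) * du * (A * dv) + - (K * (wu * Tu)) * A) + - K * (A * (wv * Tv))
        l₅ = solve-∀
    rowsum : ∀ u → ∑ H (λ v → (c * (K * K) * d u * (A u v * d v) + - (K * (w u * T (d u))) * A u v) + - K * (A u v * (w v * T (d v))))
           ≡ (c * (K * K) * (d u * nbrDeg H u) + - K * (w u * T (d u) * d u)) + - K * ∑ H (λ v → A u v * (w v * T (d v)))
    rowsum u = trans (∑-+ H _ _) (cong₂ _+_ (trans (∑-+ H _ _) (cong₂ _+_
        (trans (∑-* H (c * (K * K) * d u) _) (l₁ (c * (K * K)) (d u) (nbrDeg H u)))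
        (trans (∑-* H (- (K * (w u * T (d u)))) (A u)) (l₂ K (w u * T (d u)) (d u))))) (∑-* H (- K) _))
      where
      l₁ : ∀ a b c → a * b * c ≡ a * (b * c)
      l₁ = solve-∀
      l₂ : ∀ k x d → - (k * x) * d ≡ - k * (x * d)
      l₂ = solve-∀
    colsum : ∑ H (λ u → ∑ H (λ v → A u v * (w v * T (d v)))) ≡ ∑ H (λ v → w v * T (d v) * d v)
    colsum = trans (∑-swap H H _) (∑-cong H λ v → trans (∑-*ʳ H (w v * T (d v)) (λ u → A u v))
      (trans (cong (_* (w v * T (d v))) (∑-cong H λ u → A-sym u v)) (*-comm (d v) _)))
    total : ∑ H (λ u → ∑ H (G u)) ≡ c * (K * K) * ∑ H (λ v → d v * nbrDeg H v) - 2ℤ * K * ∑ H (λ v → w v * T (d v) * d v)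
    total = trans (∑-cong∈ H λ u u∈ → trans (∑-cong∈ H λ v v∈ → expand u v u∈ v∈) (rowsum u))
      (trans (∑-+ H _ _) (trans (cong₂ _+_ (trans (∑-+ H _ _) (cong₂ _+_ (∑-* H (c * (K * K)) _) (∑-* H (- K) _)))
        (trans (∑-* H (- K) _) (cong (- K *_) colsum))) (l (c * (K * K)) K _ _)))
      where
      l : ∀ a k x y → (a * x + - k * y) + - k * y ≡ a * x - + 2 * k * y
      l = solve-∀
    -- At an isolated vertex `recip` is 0 and the right-hand term vanishes, so the hypothesis T 0 ≤
    -- 0 is what saves the inequality there. At all other vertices it is an equality.
    low : K * ∑ H (λ v → T (d v)) ≤ ∑ H (λ v → w v * T (d v) * d v)
    low = subst (_≤ ∑ H (λ v → w v * T (d v) * d v)) (∑-* H K (λ v → T (d v))) (∑-mono∈ H pointwise)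
      where
      pointwise : ∀ v → v ∈ H → K * T (d v) ≤ w v * T (d v) * d v
      pointwise v v∈ with d v in eq | bd v v∈
      ... | -[1+ k ] | _ = ⊥-elim (absurd (subst (0ℤ ≤_) eq (0≤deg H v)))
        where
        absurd : ¬ (0ℤ ≤ -[1+ k ])
        absurd ()
      ... | + zero | _ = subst (K * T 0ℤ ≤_) (l (recip M 0ℤ) (T 0ℤ)) (subst (K * T 0ℤ ≤_) (*-zeroʳ K) (*-mono-0≤ (0≤+ℕ (M !)) T0))
        where
        l : ∀ a b → 0ℤ ≡ a * b * 0ℤ
        l = solve-∀
      ... | + suc k | b = ≤-reflexive (sym (trans (l (recip M (+ suc k)) (T (+ suc k)) (+ suc k))
             (cong (_* T (+ suc k)) (recip-* M (+ suc k) (+≤+ (ℕ.s≤s ℕ.z≤n)) b))))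
        where
        l : ∀ a b c → a * b * c ≡ a * c * b
        l = solve-∀
    fin : K * K * (c * ∑ H (λ v → d v * nbrDeg H v)) - K * K * (2ℤ * ∑ H (λ v → T (d v)))
        ≡ ∑ H (λ u → ∑ H (G u)) + 2ℤ * K * (∑ H (λ v → w v * T (d v) * d v) - K * ∑ H (λ v → T (d v)))
    fin = trans (l c K _ _ (∑ H (λ v → w v * T (d v) * d v))) (cong (_+ 2ℤ * K * (∑ H (λ v → w v * T (d v) * d v) - K * ∑ H (λ v → T (d v)))) (sym total))
      where
      l : ∀ c K x t y → K * K * (c * x) - K * K * (+ 2 * t) ≡ (c * (K * K) * x - + 2 * K * y) + + 2 * K * (y - K * t)
      l = solve-∀

  -- Halvings of a triangle-free graph with small degrees

  module Halves
    (m : ℕ) (1≤m : 1 ℕ.≤ m) (H : List V) (lenH : length H ≡ m ℕ.+ m) (D : ℤ)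
    (D≤ : ∀ X Y → H ≋ X ++ Y → length X ≡ m → length Y ≡ m → D ≤ Q X + Q Y) where

    M : ℤ
    M = + m

    1≤M : 1ℤ ≤ M
    1≤M = +≤+ 1≤m

    0<M : 0ℤ < M
    0<M = +<+ 1≤m

    #H : # H ≡ M + M
    #H = cong +_ lenH

    2M-1>0 : 0ℤ < + 2 * M - 1ℤ
    2M-1>0 = subst (0ℤ <_) (l M) (+-mono-≤-< (≤⇒0≤- 1≤M) 0<M)
      where
      l : ∀ M → M - 1ℤ + M ≡ + 2 * M - 1ℤ
      l = solve-∀

    -- A uniformly random halving.
    halving : + 2 * D ≤ Q H
    halving = *-cancel-0< (0<* 0<M 2M-1>0) (≤-slack _ (0≤+ (≤⇒0≤- avg) (0≤* (0≤+ℕ m) (0≤Q H))) (l M (Q H) D))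
      where
      avg : (M + M) * (M + M - 1ℤ) * D ≤ (M + M - 1ℤ) * (M * 0ℤ + M * 0ℤ) + (1ℤ * (M * (M - 1ℤ)) + 1ℤ * (M * (M - 1ℤ))) * Q H
      avg = subst (λ z → (M + M) * (M + M - 1ℤ) * D ≤ (M + M - 1ℤ) * (M * z + M * z) + (1ℤ * (M * (M - 1ℤ)) + 1ℤ * (M * (M - 1ℤ))) * Q H) (∑-0 H)
        (split-exact H m m lenH (λ _ → 0ℤ) (λ _ → 0ℤ) 1ℤ 1ℤ D λ X Y H≋ lX lY → ≤-trans (D≤ X Y H≋ lX lY)
          (≤-reflexive (trans (l₀ (Q X) (Q Y)) (sym (cong₂ (λ a b → a + b + (1ℤ * Q X + 1ℤ * Q Y)) (∑-0 X) (∑-0 Y))))))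
        where
        l₀ : ∀ a b → a + b ≡ 0ℤ + 0ℤ + (1ℤ * a + 1ℤ * b)
        l₀ = solve-∀
      l : ∀ M Q D → M * (+ 2 * M - 1ℤ) * Q - M * (+ 2 * M - 1ℤ) * (+ 2 * D)
        ≡ (M + M - 1ℤ) * (M * 0ℤ + M * 0ℤ) + (1ℤ * (M * (M - 1ℤ)) + 1ℤ * (M * (M - 1ℤ))) * Q - (M + M) * (M + M - 1ℤ) * D + M * Q
      l = solve-∀

    module Vertex (v : V) (d<m : deg H v ≤ M - 1ℤ) where
      d S r : ℤ
      d = deg H v
      S = nbrDeg H v
      r = M - d

      -- Place all neighbours of v in the first half.
      bound : (r + M) * (r + M - 1ℤ) * D ≤ (r + M - 1ℤ) * (r * (+ 2 * S)) + (r * (r - 1ℤ) + M * (M - 1ℤ)) * (Q H - + 2 * S)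
      bound = transport {+ r′} r≡ (split-exact (others v H) r′ m lenO (λ u → + 2 * deg N u) (λ _ → 0ℤ) 1ℤ 1ℤ D step)
        where
        N = nbrs v H
        k = length N
        k≡d : + k ≡ d
        k≡d = #nbrs v H
        k≤m : k ℕ.≤ m
        k≤m = drop‿+≤+ (≤-trans (≤-reflexive k≡d) (≤-trans d<m (≤-slack 1ℤ (0≤+ℕ 1) (l M))))
          where
          l : ∀ M → M - (M - 1ℤ) ≡ 1ℤ
          l = solve-∀
        r′ = m ℕ.∸ k
        r+k : r′ ℕ.+ k ≡ m
        r+k = ℕₚ.m∸n+n≡m k≤m
        r≡ : + r′ ≡ r
        r≡ = trans (l (+ r′) (+ k)) (cong₂ _-_ (cong +_ r+k) k≡d)
          where
          l : ∀ a b → a ≡ (a + b) - b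
          l = solve-∀
        lenO : length (others v H) ≡ r′ ℕ.+ m
        lenO = ℕₚ.+-cancelˡ-≡ k _ _ (trans (sym (trans (sym lenH) (trans (+-injective (≋-# (nbrs-others v H))) (length-++ N))) ) (trans (cong (ℕ._+ m) (sym (trans (ℕₚ.+-comm k r′) r+k))) (ℕₚ.+-assoc k r′ m)))
        step : ∀ R T → others v H ≋ R ++ T → length R ≡ r′ → length T ≡ m →
          D ≤ ∑ R (λ u → + 2 * deg N u) + ∑ T (λ _ → 0ℤ) + (1ℤ * Q R + 1ℤ * Q T)
        step R T O≋ lR lT = ≤-trans
          (D≤ (N ++ R) T (≋-trans (nbrs-others v H) (≋-trans (≋-++ (≋-refl {xs = N}) O≋) (≋-sym (≋-assoc N R T))))
              (trans (length-++ N) (trans (cong (k ℕ.+_) lR) (trans (ℕₚ.+-comm k r′) r+k))) lT)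
          (≤-reflexive (trans (cong (_+ Q T) (Q-++ N R)) (trans (cong₂ (λ a b → a + + 2 * b + Q R + Q T) (Q-nbrs v H) (E-sym N R))
             (trans (l (E R N) (Q R) (Q T)) (sym (cong₂ (λ a b → a + b + (1ℤ * Q R + 1ℤ * Q T)) (∑-* R (+ 2) (deg N)) (∑-0 T)))))))
          where
          l : ∀ e a b → 0ℤ + + 2 * e + a + b ≡ + 2 * e + 0ℤ + (1ℤ * a + 1ℤ * b)
          l = solve-∀
        transport : ∀ {r″} → r″ ≡ r →
          (r″ + M) * (r″ + M - 1ℤ) * D ≤ (r″ + M - 1ℤ) * (r″ * ∑ (others v H) (λ u → + 2 * deg N u) + M * ∑ (others v H) (λ _ → 0ℤ)) + (1ℤ * (r″ * (r″ - 1ℤ)) + 1ℤ * (M * (M - 1ℤ))) * Q (others v H) →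
          (r + M) * (r + M - 1ℤ) * D ≤ (r + M - 1ℤ) * (r * (+ 2 * S)) + (r * (r - 1ℤ) + M * (M - 1ℤ)) * (Q H - + 2 * S)
        transport refl p = ≤-trans p (≤-reflexive (trans
          (cong₂ (λ a b → (r + M - 1ℤ) * (r * a + M * b) + (1ℤ * (r * (r - 1ℤ)) + 1ℤ * (M * (M - 1ℤ))) * Q (others v H))
            (trans (∑-* (others v H) (+ 2) (deg N)) (cong (+ 2 *_) (trans (E-sym (others v H) N) (E-nbrs-others v H)))) (∑-0 (others v H)))
          (trans (cong (λ z → (r + M - 1ℤ) * (r * (+ 2 * S) + M * 0ℤ) + (1ℤ * (r * (r - 1ℤ)) + 1ℤ * (M * (M - 1ℤ))) * z) (Q-others v H))
            (l r M S (Q H)))))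
          where
          l : ∀ r M S Q → (r + M - 1ℤ) * (r * (+ 2 * S) + M * 0ℤ) + (1ℤ * (r * (r - 1ℤ)) + 1ℤ * (M * (M - 1ℤ))) * (Q - + 2 * S)
            ≡ (r + M - 1ℤ) * (r * (+ 2 * S)) + (r * (r - 1ℤ) + M * (M - 1ℤ)) * (Q - + 2 * S)
          l = solve-∀

      1≤r : 1ℤ ≤ r
      1≤r = ≤-slack _ (≤⇒0≤- d<m) (l M d)
        where
        l : ∀ M d → M - d - 1ℤ ≡ M - 1ℤ - d
        l = solve-∀

      0≤r : 0ℤ ≤ r
      0≤r = ≤-trans (0≤+ℕ 1) 1≤r

      N-1>0 : 0ℤ < r + M - 1ℤ
      N-1>0 = subst (0ℤ <_) (l r M) (+-mono-≤-< (≤⇒0≤- 1≤r) 0<M)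
        where
        l : ∀ r M → (r - 1ℤ) + M ≡ r + M - 1ℤ
        l = solve-∀

      0≤Q-2S : 0ℤ ≤ Q H - + 2 * S
      0≤Q-2S = subst (0ℤ ≤_) (Q-others v H) (0≤Q (others v H))

      slack : ℤ
      slack = (r + M - 1ℤ) * (r * (+ 2 * S)) + (r * (r - 1ℤ) + M * (M - 1ℤ)) * (Q H - + 2 * S) - (r + M) * (r + M - 1ℤ) * D

      0≤slack : 0ℤ ≤ slack
      0≤slack = ≤⇒0≤- bound

      -- `bound` without the corrections by 1. The relaxation gives away 2rM (Q - 2S), where Q - 2S
      -- is twice the number of edges avoiding N(v); this loss is what excludes equality later.
      average : (+ 2 * M - d) * (+ 2 * M - d) * D + + 2 * M * (d * S) ≤ (+ 2 * M * M - + 2 * M * d + d * d) * Q H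
      average = *-cancel-0< N-1>0 (≤-slack _ (0≤+ (0≤* (0≤+ 0≤r (0≤+ℕ m)) 0≤slack) (0≤* (0≤* (0≤* (0≤+ℕ 2) 0≤r) (0≤+ℕ m)) 0≤Q-2S)) (l M d S (Q H) D))
        where
        l : ∀ M d S Q D → (M - d + M - 1ℤ) * ((+ 2 * M * M - + 2 * M * d + d * d) * Q) - (M - d + M - 1ℤ) * ((+ 2 * M - d) * (+ 2 * M - d) * D + + 2 * M * (d * S))
          ≡ (M - d + M) * ((M - d + M - 1ℤ) * ((M - d) * (+ 2 * S)) + ((M - d) * (M - d - 1ℤ) + M * (M - 1ℤ)) * (Q - + 2 * S) - (M - d + M) * (M - d + M - 1ℤ) * D)
            + + 2 * (M - d) * M * (Q - + 2 * S)
        l = solve-∀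

    module SmallDegrees (small : ∀ v → v ∈ H → deg H v ≤ M - 1ℤ) where

      deg≤m : ∀ v → v ∈ H → deg H v ≤ M
      deg≤m v v∈ = ≤-trans (small v v∈) (≤-slack 1ℤ (0≤+ℕ 1) (l M))
        where
        l : ∀ M → M - (M - 1ℤ) ≡ 1ℤ
        l = solve-∀

      module Pair (u v : V) (u∈ : u ∈ H) (v∈ : v ∈ H) (u∼v : adj u v ≡ true) where
        s t p q : ℤ
        s = deg H u
        t = deg H v
        p = s + t
        q = s * t
        1≤s : 1ℤ ≤ s
        1≤s = subst (_≤ s) (A-adj u∼v) (A≤deg H u v v∈)
        0≤s : 0ℤ ≤ s
        0≤s = 0≤deg H u
        0≤t : 0ℤ ≤ t
        0≤t = 0≤deg H v
        0<p : 0ℤ < p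
        0<p = +-mono-<-≤ (<-≤-trans (+<+ (ℕ.s≤s ℕ.z≤n)) 1≤s) 0≤t
        0≤p : 0ℤ ≤ p
        0≤p = <⇒≤ 0<p
        0≤q : 0ℤ ≤ q
        0≤q = 0≤* 0≤s 0≤t
        0<2m-p : 0ℤ < + 2 * M - p
        0<2m-p = <-≤-trans (+<+ (ℕ.s≤s ℕ.z≤n)) (≤-slack _ (0≤+ (0≤+ (≤⇒0≤- (small u u∈)) (≤⇒0≤- (small v v∈))) (0≤+ℕ 1)) (l M s t))
          where
          l : ∀ M s t → + 2 * M - (s + t) - 1ℤ ≡ ((M - 1ℤ) - s) + ((M - 1ℤ) - t) + 1ℤ
          l = solve-∀
        4q≤p² : 0ℤ ≤ p * p - + 4 * q
        4q≤p² = subst (0ℤ ≤_) (l s t) (0≤² (s - t))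
          where
          l : ∀ s t → (s - t) * (s - t) ≡ (s + t) * (s + t) - + 4 * (s * t)
          l = solve-∀

      ∑1 : ∑ H (λ _ → 1ℤ) ≡ M + M
      ∑1 = trans (∑-const H 1ℤ) (trans (*-identityʳ (# H)) #H)

      ∑-quadratic : ∀ a b c → ∑ H (λ v → a + b * deg H v + c * (deg H v * deg H v))
                    ≡ (M + M) * a + b * Q H + c * ∑ H (λ v → deg H v * deg H v)
      ∑-quadratic a b c = trans (∑-+ H _ _) (cong₂ _+_ (trans (∑-+ H _ _) (cong₂ _+_ (trans (∑-const H a) (cong (_* a) #H)) (∑-* H b (deg H)))) (∑-* H c _))

      Σ² : ℤ
      Σ² = ∑ H (λ v → deg H v * deg H v)

      ∑S : ℤ
      ∑S = ∑ H (λ v → deg H v * nbrDeg H v)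

      module Tight (M²≤2D : M * M ≤ + 2 * D) where

        -- T - 3Θ = 5Q (2Md - Q) has sum 0 over H, since the 2M degrees add up to Q. Replacing 3Θ by
        -- T thus leaves the sum unchanged, while for T the inequality holds edge by edge.
        Θ T : ℤ → ℤ
        Θ d = + 2 * (+ 2 * M * M - + 2 * M * d + d * d) * Q H - (+ 2 * M - d) * (+ 2 * M - d) * (M * M)
        T d = Q H * (+ 12 * M * M - + 2 * M * d + + 6 * (d * d)) - + 5 * Q H * Q H - + 3 * M * M * ((+ 2 * M - d) * (+ 2 * M - d))

        pointwise : ∀ v → v ∈ H → + 4 * M * (deg H v * nbrDeg H v) ≤ Θ (deg H v)
        pointwise v v∈ = ≤-slack _ (0≤+ (0≤* (0≤+ℕ 2) (≤⇒0≤- average)) (0≤* (0≤² (+ 2 * M - d)) (≤⇒0≤- M²≤2D))) (l M d S (Q H) D)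
          where
          open Vertex v (small v v∈)
          l : ∀ M d S Q D → + 2 * (+ 2 * M * M - + 2 * M * d + d * d) * Q - (+ 2 * M - d) * (+ 2 * M - d) * (M * M) - + 4 * M * (d * S)
            ≡ + 2 * ((+ 2 * M * M - + 2 * M * d + d * d) * Q - ((+ 2 * M - d) * (+ 2 * M - d) * D + + 2 * M * (d * S)))
              + (+ 2 * M - d) * (+ 2 * M - d) * (+ 2 * D - M * M)
          l = solve-∀

        ∑T : ∑ H (λ v → T (deg H v)) ≡ + 3 * ∑ H (λ v → Θ (deg H v))
        ∑T = trans (∑-cong H λ v → lT M (Q H) (deg H v)) (trans (∑-quadratic (+ 12 * M * M * Q H - + 5 * Q H * Q H - + 12 * M * M * M * M) (+ 12 * M * M * M - + 2 * M * Q H) (+ 6 * Q H - + 3 * M * M))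
               (trans (l M (Q H) Σ²) (sym (cong (+ 3 *_) (trans (∑-cong H λ v → lΘ M (Q H) (deg H v))
                 (∑-quadratic (+ 4 * M * M * Q H - + 4 * M * M * M * M) (+ 4 * M * M * M - + 4 * M * Q H) (+ 2 * Q H - M * M)))))))
          where
          lT : ∀ M Q d → Q * (+ 12 * M * M - + 2 * M * d + + 6 * (d * d)) - + 5 * Q * Q - + 3 * M * M * ((+ 2 * M - d) * (+ 2 * M - d))
             ≡ (+ 12 * M * M * Q - + 5 * Q * Q - + 12 * M * M * M * M) + (+ 12 * M * M * M - + 2 * M * Q) * d + (+ 6 * Q - + 3 * M * M) * (d * d)
          lT = solve-∀
          lΘ : ∀ M Q d → + 2 * (+ 2 * M * M - + 2 * M * d + d * d) * Q - (+ 2 * M - d) * (+ 2 * M - d) * (M * M)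
             ≡ (+ 4 * M * M * Q - + 4 * M * M * M * M) + (+ 4 * M * M * M - + 4 * M * Q) * d + (+ 2 * Q - M * M) * (d * d)
          lΘ = solve-∀
          l : ∀ M Q z → (M + M) * (+ 12 * M * M * Q - + 5 * Q * Q - + 12 * M * M * M * M) + (+ 12 * M * M * M - + 2 * M * Q) * Q + (+ 6 * Q - + 3 * M * M) * z
            ≡ + 3 * ((M + M) * (+ 4 * M * M * Q - + 4 * M * M * M * M) + (+ 4 * M * M * M - + 4 * M * Q) * Q + (+ 2 * Q - M * M) * z)
          l = solve-∀

        T0≤0 : T 0ℤ ≤ 0ℤ
        T0≤0 = *-cancel-0< {+ 5} (+<+ (ℕ.s≤s ℕ.z≤n)) (≤-slack _ (0≤+ (0≤² (+ 5 * Q H - + 6 * M * M)) (0≤* (0≤+ℕ 24) (0≤² (M * M)))) (l M (Q H)))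
          where
          l : ∀ M Q → + 5 * 0ℤ - + 5 * (Q * (+ 12 * M * M - + 2 * M * 0ℤ + + 6 * (0ℤ * 0ℤ)) - + 5 * Q * Q - + 3 * M * M * ((+ 2 * M - 0ℤ) * (+ 2 * M - 0ℤ)))
            ≡ (+ 5 * Q - + 6 * M * M) * (+ 5 * Q - + 6 * M * M) + + 24 * (M * M * (M * M))
          l = solve-∀

        edge : ∀ u v → u ∈ H → v ∈ H → adj u v ≡ true →
          0ℤ ≤ + 24 * M * (deg H u * deg H u * (deg H v * deg H v)) - deg H v * T (deg H u) - deg H u * T (deg H v)
        edge u v u∈ v∈ u∼v = 0≤-cancel (0<* {+ 20} (+<+ (ℕ.s≤s ℕ.z≤n)) 0<p) (subst (0ℤ ≤_) (sym (l M (Q H) s t))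
          (0≤+ (0≤² (+ 10 * p * Q H - (+ 12 * M * M * p - + 4 * M * q + + 6 * p * q)))
               (0≤* (0≤+ℕ 4) (0≤discriminant M p q 0≤p 0≤q (0≤+ℕ m) 4q≤p² 0<p 0<2m-p))))
          where
          open Pair u v u∈ v∈ u∼v
          l : ∀ M Q s t → + 20 * (s + t) * (+ 24 * M * (s * s * (t * t))
               - t * (Q * (+ 12 * M * M - + 2 * M * s + + 6 * (s * s)) - + 5 * Q * Q - + 3 * M * M * ((+ 2 * M - s) * (+ 2 * M - s)))
               - s * (Q * (+ 12 * M * M - + 2 * M * t + + 6 * (t * t)) - + 5 * Q * Q - + 3 * M * M * ((+ 2 * M - t) * (+ 2 * M - t))))
            ≡ (+ 10 * (s + t) * Q - (+ 12 * M * M * (s + t) - + 4 * M * (s * t) + + 6 * (s + t) * (s * t))) * (+ 10 * (s + t) * Q - (+ 12 * M * M * (s + t) - + 4 * M * (s * t) + + 6 * (s + t) * (s * t)))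
              + + 4 * ((s * t) * (s * t) * (+ 132 * M * (s + t) - + 4 * M * M - + 9 * (s + t) * (s + t)) - (s * t) * (s + t) * (+ 96 * M * M * M + + 21 * M * M * (s + t)) + + 24 * M * M * M * M * (s + t) * (s + t))
          l = solve-∀

        -- `edge-average` yields the sum of the `pointwise` inequalities in the opposite direction,
        -- so that every vertex is an equality case.
        all-tight : ∀ v → v ∈ H → + 4 * M * (deg H v * nbrDeg H v) ≡ Θ (deg H v)
        all-tight = ∑-≡-split H (λ v → + 4 * M * (deg H v * nbrDeg H v)) (λ v → Θ (deg H v)) pointwise
          (*-cancel-0< {+ 6} (+<+ (ℕ.s≤s ℕ.z≤n)) (≤-slack _ (≤⇒0≤- (edge-average H m deg≤m (+ 24 * M) T T0≤0 edge))
            (trans (cong (λ z → + 6 * z - + 6 * ∑ H (λ v → Θ (deg H v))) (∑-* H (+ 4 * M) _))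
              (trans (l M ∑S (∑ H (λ v → Θ (deg H v)))) (cong (λ z → + 24 * M * ∑S - + 2 * z) (sym ∑T))))))
          where
          l : ∀ M S θ → + 6 * (+ 4 * M * S) - + 6 * θ ≡ + 24 * M * S - + 2 * (+ 3 * θ)
          l = solve-∀

        module At (v : V) (v∈ : v ∈ H) where
          open Vertex v (small v v∈)

          -- Equality at v leaves no room for the term 2rM (Q - 2S) given away in `average`, and r
          -- and M are positive. So the vertices outside N(v) span no edge.
          Q≡2S : Q H - + 2 * S ≡ 0ℤ
          Q≡2S = ≤-antisym (*-cancel-0< 0<k (≤-slack _ (0≤+ (0≤* (0≤* (0≤+ℕ 2) (0≤+ 0≤r (0≤+ℕ m))) 0≤slack) (0≤* (0≤* (<⇒≤ N-1>0) (0≤² (+ 2 * M - d))) (≤⇒0≤- M²≤2D)))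
              (go (sym (all-tight v v∈))))) 0≤Q-2S
            where
            k : ℤ
            k = + 4 * r * M
            0<k : 0ℤ < k
            0<k = 0<* (0<* {+ 4} (+<+ (ℕ.s≤s ℕ.z≤n)) (<-≤-trans (+<+ (ℕ.s≤s ℕ.z≤n)) 1≤r)) 0<M
            l : ∀ M d S Q D → + 4 * (M - d) * M * 0ℤ - + 4 * (M - d) * M * (Q - + 2 * S)
              ≡ + 2 * (M - d + M) * ((M - d + M - 1ℤ) * ((M - d) * (+ 2 * S)) + ((M - d) * (M - d - 1ℤ) + M * (M - 1ℤ)) * (Q - + 2 * S) - (M - d + M) * (M - d + M - 1ℤ) * D)
                + (M - d + M - 1ℤ) * ((+ 2 * M - d) * (+ 2 * M - d)) * (+ 2 * D - M * M)
                + (M - d + M - 1ℤ) * (+ 4 * M * (d * S) - (+ 2 * (+ 2 * M * M - + 2 * M * d + d * d) * Q - (+ 2 * M - d) * (+ 2 * M - d) * (M * M)))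
            l = solve-∀
            go : Θ d ≡ + 4 * M * (d * S) → _ ≡ _
            go e = trans (l M d S (Q H) D) (trans (cong (λ z → + 2 * (r + M) * slack + (r + M - 1ℤ) * ((+ 2 * M - d) * (+ 2 * M - d)) * (+ 2 * D - M * M) + (r + M - 1ℤ) * (+ 4 * M * (d * S) - z)) e)
                     (l′ (+ 2 * (r + M) * slack + (r + M - 1ℤ) * ((+ 2 * M - d) * (+ 2 * M - d)) * (+ 2 * D - M * M)) (r + M - 1ℤ) (+ 4 * M * (d * S))))
              where
              l′ : ∀ a b c → a + b * (c - c) ≡ a
              l′ = solve-∀

          S≤dM : S ≤ d * M
          S≤dM = ≤-trans (∑-mono∈ H λ u u∈ → *-mono-0≤ (A≥0 v u) (deg≤m u u∈)) (≤-reflexive (∑-*ʳ H M (A v)))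

          -- With no edge outside N(v), `bound` reduces to (2M - d) D ≤ 2rS. Together with S ≤ dM
          -- and M² ≤ 2D this gives (2M - d) M ≤ 4 (M - d) d. But 16 times the difference of the two
          -- sides is (8d - 5M)² + 7M² > 0.
          contradiction : ⊥
          contradiction = ≤-absurd {0ℤ} {+ 16 * (+ 4 * r * d - (r + M) * M)} (0≤* (0≤+ℕ 16) (≤⇒0≤- NM≤4rd))
            (≤-trans (+≤+ (ℕ.s≤s ℕ.z≤n)) (≤-slack _ (0≤+ (0≤² (+ 8 * d - + 5 * M)) (0≤* (0≤+ℕ 7) (0≤+ (≤⇒0≤- 1≤M²) (0≤+ℕ 0)))) (l₀ M d)))
            where
            1≤M² : 1ℤ ≤ M * M
            1≤M² = ≤-trans 1≤M (≤-slack _ (0≤* (0≤+ℕ m) (≤⇒0≤- 1≤M)) (l M))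
              where
              l : ∀ M → M * M - M ≡ M * (M - 1ℤ)
              l = solve-∀
            l₀ : ∀ M d → 0ℤ - + 16 * (+ 4 * (M - d) * d - (M - d + M) * M) - + 7 ≡ (+ 8 * d - + 5 * M) * (+ 8 * d - + 5 * M) + + 7 * (M * M - 1ℤ + 0ℤ)
            l₀ = solve-∀
            ND≤2rS : (r + M) * D ≤ + 2 * r * S
            ND≤2rS = *-cancel-0< N-1>0 (≤-slack _ 0≤slack (trans (l r M D S) (sym (trans (cong (λ z → (r + M - 1ℤ) * (r * (+ 2 * S)) + (r * (r - 1ℤ) + M * (M - 1ℤ)) * z - (r + M) * (r + M - 1ℤ) * D) Q≡2S) (l′ r M D S)))))
              where
              l : ∀ r M D S → (r + M - 1ℤ) * (+ 2 * r * S) - (r + M - 1ℤ) * ((r + M) * D) ≡ (r + M - 1ℤ) * (r * (+ 2 * S)) - (r + M) * (r + M - 1ℤ) * D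
              l = solve-∀
              l′ : ∀ r M D S → (r + M - 1ℤ) * (r * (+ 2 * S)) + (r * (r - 1ℤ) + M * (M - 1ℤ)) * 0ℤ - (r + M) * (r + M - 1ℤ) * D ≡ (r + M - 1ℤ) * (r * (+ 2 * S)) - (r + M) * (r + M - 1ℤ) * D
              l′ = solve-∀
            NM≤4rd : (r + M) * M ≤ + 4 * r * d
            NM≤4rd = *-cancel-0< 0<M (≤-slack _ (0≤+ (0≤+ (0≤* (0≤+ 0≤r (0≤+ℕ m)) (≤⇒0≤- M²≤2D)) (0≤* (0≤+ℕ 2) (≤⇒0≤- ND≤2rS)))
                       (0≤* (0≤* (0≤+ℕ 4) 0≤r) (≤⇒0≤- S≤dM))) (l r M D S d))
              where
              l : ∀ r M D S d → M * (+ 4 * r * d) - M * ((r + M) * M) ≡ (r + M) * (+ 2 * D - M * M) + + 2 * (+ 2 * r * S - (r + M) * D) + + 4 * r * (d * M - S)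
              l = solve-∀

      quarter : + 2 * D < M * M
      quarter = ≰⇒> λ le → contra le H refl
        where
        contra : M * M ≤ + 2 * D → ∀ H′ → H ≡ H′ → ⊥
        contra le []       eq = ℕₚ.<⇒≢ (ℕₚ.≤-trans 1≤m (ℕₚ.m≤m+n m m)) (trans (sym (cong length eq)) lenH)
        contra le (x ∷ H′) eq = Tight.At.contradiction le x (subst (x ∈_) (sym eq) (here refl))

      -- The tangent line of 2e(1 - e) / (2 - e)² near e = 2/5, slightly raised.
      tangent : + 50 * D ≤ + 20 * Q H + + 3 * M * M
      tangent with ≤-total (+ 11 * M * M) (+ 10 * Q H)
      -- The line reaches the height 25M² at 10Q = 11M²; to the right of this point `quarter` is
      -- already sufficient.
      ... | inj₁ le = ≤-slack _ (0≤+ (0≤* (0≤+ℕ 2) (≤⇒0≤- le)) (0≤* (0≤+ℕ 25) (≤⇒0≤- (<⇒≤ quarter)))) (l M (Q H) D)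
        where
        l : ∀ M Q D → + 20 * Q + + 3 * M * M - + 50 * D ≡ + 2 * (+ 10 * Q - + 11 * M * M) + + 25 * (M * M - + 2 * D)
        l = solve-∀
      ... | inj₂ Q≤ = ≮⇒≥ λ lt → contra (0<⇒1≤ (subst (0ℤ <_) refl (i<j⇒0<j-i lt)))
        where
        i<j⇒0<j-i : ∀ {i j} → i < j → 0ℤ < j - i
        i<j⇒0<j-i {i} {j} p = subst (_< j - i) (+-inverseʳ i) (+-monoˡ-< (- i) p)
        -- As in `Tight`, T - 3Θ has sum 0 over H; here it equals 50M² (2Md - Q).
        Θ T : ℤ → ℤ
        Θ d = + 50 * (+ 2 * M * M - + 2 * M * d + d * d) * Q H - (+ 2 * M - d) * (+ 2 * M - d) * (+ 20 * Q H + + 3 * M * M)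
        T d = + 10 * Q H * ((M - + 3 * d) * (M - + 3 * d)) - + 9 * M * M * ((+ 2 * M - d) * (+ 2 * M - d)) + + 100 * M * M * M * d
        T0≤0 : T 0ℤ ≤ 0ℤ
        T0≤0 = ≤-slack _ (0≤+ (0≤* (0≤² M) (≤⇒0≤- Q≤)) (0≤* (0≤+ℕ 25) (0≤² (M * M)))) (l M (Q H))
          where
          l : ∀ M Q → 0ℤ - (+ 10 * Q * ((M - + 3 * 0ℤ) * (M - + 3 * 0ℤ)) - + 9 * M * M * ((+ 2 * M - 0ℤ) * (+ 2 * M - 0ℤ)) + + 100 * M * M * M * 0ℤ)
            ≡ M * M * (+ 11 * M * M - + 10 * Q) + + 25 * (M * M * (M * M))
          l = solve-∀
        edge : ∀ u v → u ∈ H → v ∈ H → adj u v ≡ true →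
          0ℤ ≤ + 600 * M * (deg H u * deg H u * (deg H v * deg H v)) - deg H v * T (deg H u) - deg H u * T (deg H v)
        edge u v u∈ v∈ u∼v = subst (0ℤ ≤_) (sym (l M (Q H) s t))
          (0≤+ (0≤* (0≤* (0≤+ℕ 5) (0≤+ℕ m)) (0≤linear-form M p q 0≤p 0≤q (0≤+ℕ m) 4q≤p² (<⇒≤ 0<2m-p)))
               (0≤* (≤⇒0≤- Q≤) (0≤+ (0≤* 0≤t (0≤² (M - + 3 * s))) (0≤* 0≤s (0≤² (M - + 3 * t))))))
          where
          open Pair u v u∈ v∈ u∼v
          l : ∀ M Q s t → + 600 * M * (s * s * (t * t))
               - t * (+ 10 * Q * ((M - + 3 * s) * (M - + 3 * s)) - + 9 * M * M * ((+ 2 * M - s) * (+ 2 * M - s)) + + 100 * M * M * M * s)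
               - s * (+ 10 * Q * ((M - + 3 * t) * (M - + 3 * t)) - + 9 * M * M * ((+ 2 * M - t) * (+ 2 * M - t)) + + 100 * M * M * M * t)
            ≡ + 5 * M * (+ 120 * (s * t) * (s * t) - (+ 28 * M * M + + 18 * M * (s + t)) * (s * t) + + 5 * M * M * M * (s + t))
              + (+ 11 * M * M - + 10 * Q) * (t * ((M - + 3 * s) * (M - + 3 * s)) + s * ((M - + 3 * t) * (M - + 3 * t)))
          l = solve-∀
        ∑T : ∑ H (λ v → T (deg H v)) ≡ + 3 * ∑ H (λ v → Θ (deg H v))
        ∑T = trans (∑-cong H λ v → lT M (Q H) (deg H v)) (trans (∑-quadratic (+ 10 * M * M * Q H - + 36 * M * M * M * M) (+ 136 * M * M * M - + 60 * M * Q H) (+ 90 * Q H - + 9 * M * M))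
               (trans (l M (Q H) Σ²) (sym (cong (+ 3 *_) (trans (∑-cong H λ v → lΘ M (Q H) (deg H v))
                 (∑-quadratic (+ 20 * M * M * Q H - + 12 * M * M * M * M) (+ 12 * M * M * M - + 20 * M * Q H) (+ 30 * Q H - + 3 * M * M)))))))
          where
          lT : ∀ M Q d → + 10 * Q * ((M - + 3 * d) * (M - + 3 * d)) - + 9 * M * M * ((+ 2 * M - d) * (+ 2 * M - d)) + + 100 * M * M * M * d
             ≡ (+ 10 * M * M * Q - + 36 * M * M * M * M) + (+ 136 * M * M * M - + 60 * M * Q) * d + (+ 90 * Q - + 9 * M * M) * (d * d)
          lT = solve-∀
          lΘ : ∀ M Q d → + 50 * (+ 2 * M * M - + 2 * M * d + d * d) * Q - (+ 2 * M - d) * (+ 2 * M - d) * (+ 20 * Q + + 3 * M * M)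
             ≡ (+ 20 * M * M * Q - + 12 * M * M * M * M) + (+ 12 * M * M * M - + 20 * M * Q) * d + (+ 30 * Q - + 3 * M * M) * (d * d)
          lΘ = solve-∀
          l : ∀ M Q z → (M + M) * (+ 10 * M * M * Q - + 36 * M * M * M * M) + (+ 136 * M * M * M - + 60 * M * Q) * Q + (+ 90 * Q - + 9 * M * M) * z
            ≡ + 3 * ((M + M) * (+ 20 * M * M * Q - + 12 * M * M * M * M) + (+ 12 * M * M * M - + 20 * M * Q) * Q + (+ 30 * Q - + 3 * M * M) * z)
          l = solve-∀
        contra : 1ℤ ≤ + 50 * D - (+ 20 * Q H + + 3 * M * M) → ⊥
        contra 1≤δ = ≤-absurd {0ℤ} {+ 6 * (+ 100 * M * ∑S - ∑ H (λ v → Θ (deg H v)))} below above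
          where
          -- The assumed excess of at least 1 enters with the factor (2M - d)² ≥ 1. Keeping a single
          -- unit per vertex is enough to make the summed inequality strict.
          pointwise : ∀ v → v ∈ H → + 100 * M * (deg H v * nbrDeg H v) + 1ℤ ≤ Θ (deg H v)
          pointwise v v∈ = ≤-slack _ (0≤+ (0≤+ (0≤* (0≤+ℕ 50) (≤⇒0≤- average)) (0≤* (0≤² (+ 2 * M - d)) (≤⇒0≤- 1≤δ)))
                (0≤* (0≤+ (<⇒≤ N-1>0) (0≤+ℕ 2)) (<⇒≤ N-1>0))) (l M d S (Q H) D)
            where
            open Vertex v (small v v∈)
            l : ∀ M d S Q D → + 50 * (+ 2 * M * M - + 2 * M * d + d * d) * Q - (+ 2 * M - d) * (+ 2 * M - d) * (+ 20 * Q + + 3 * M * M) - (+ 100 * M * (d * S) + 1ℤ)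
              ≡ + 50 * ((+ 2 * M * M - + 2 * M * d + d * d) * Q - ((+ 2 * M - d) * (+ 2 * M - d) * D + + 2 * M * (d * S)))
                + (+ 2 * M - d) * (+ 2 * M - d) * (+ 50 * D - (+ 20 * Q + + 3 * M * M) - 1ℤ) + (M - d + M - 1ℤ + + 2) * (M - d + M - 1ℤ)
            l = solve-∀
          summed : + 100 * M * ∑S + (M + M) ≤ ∑ H (λ v → Θ (deg H v))
          summed = subst (_≤ ∑ H (λ v → Θ (deg H v))) (trans (∑-+ H _ _) (cong₂ _+_ (∑-* H (+ 100 * M) (λ v → deg H v * nbrDeg H v)) ∑1)) (∑-mono∈ H pointwise)
          below : 0ℤ ≤ + 6 * (+ 100 * M * ∑S - ∑ H (λ v → Θ (deg H v)))
          below = subst (0ℤ ≤_) (trans (cong (λ z → + 600 * M * ∑S - + 2 * z) ∑T) (l M ∑S _)) (≤⇒0≤- (edge-average H m deg≤m (+ 600 * M) T T0≤0 edge))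
            where
            l : ∀ M S θ → + 600 * M * S - + 2 * (+ 3 * θ) ≡ + 6 * (+ 100 * M * S - θ)
            l = solve-∀
          above : 1ℤ ≤ 0ℤ - + 6 * (+ 100 * M * ∑S - ∑ H (λ v → Θ (deg H v)))
          above = ≤-slack _ (0≤+ (0≤* (0≤+ℕ 6) (≤⇒0≤- summed)) (0≤+ (0≤* (0≤+ℕ 12) (≤⇒0≤- 1≤M)) (0≤+ℕ 11))) (l M ∑S (∑ H (λ v → Θ (deg H v))))
            where
            l : ∀ M S θ → 0ℤ - + 6 * (+ 100 * M * S - θ) - 1ℤ ≡ + 6 * (θ - (+ 100 * M * S + (M + M))) + (+ 12 * (M - 1ℤ) + + 11)
            l = solve-∀

  -- Mantel's theorem and its equality case

  module Mantel
    (C : List V) where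

    L Σ² : ℤ
    L = # C
    Σ² = ∑ C (λ x → deg C x * deg C x)

    -- Adjacent vertices have disjoint neighbourhoods.
    edge-degrees : ∀ x y → A x y * (deg C x + deg C y) ≤ A x y * L
    edge-degrees x y with adj x y in eq
    ... | false = ≤-refl
    ... | true  = *-mono-0≤ {1ℤ} (0≤+ℕ 1) (subst₂ _≤_ (∑-+ C (A x) (A y)) (trans (∑-const C 1ℤ) (*-identityʳ L)) (∑-mono C disjoint))
      where
      disjoint : ∀ z → A x z + A y z ≤ 1ℤ
      disjoint z with adj x z in p | adj y z in q
      ... | true  | true  = ⊥-elim (no-triangle x y z (eq , q , p))
      ... | true  | false = +≤+ (ℕ.s≤s ℕ.z≤n)
      ... | false | true  = +≤+ (ℕ.s≤s ℕ.z≤n)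
      ... | false | false = +≤+ ℕ.z≤n

    2Σ²≤LQ : + 2 * Σ² ≤ L * Q C
    2Σ²≤LQ = subst₂ _≤_ lhs rhs (∑-mono C λ x → ∑-mono C λ y → edge-degrees x y)
      where
      rhs : ∑ C (λ x → ∑ C (λ y → A x y * L)) ≡ L * Q C
      rhs = trans (∑-cong C λ x → ∑-*ʳ C L (A x)) (trans (∑-*ʳ C L (deg C)) (*-comm (Q C) L))
      one : ∑ C (λ x → ∑ C (λ y → A x y * deg C x)) ≡ Σ²
      one = ∑-cong C λ x → ∑-*ʳ C (deg C x) (A x)
      two : ∑ C (λ x → ∑ C (λ y → A x y * deg C y)) ≡ Σ²
      two = trans (∑-swap C C _) (trans (∑-cong C λ y → ∑-cong C λ x → cong (_* deg C y) (A-sym x y)) one)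
      lhs : ∑ C (λ x → ∑ C (λ y → A x y * (deg C x + deg C y))) ≡ + 2 * Σ²
      lhs = trans (∑-cong C λ x → trans (∑-cong C λ y → *-distribˡ-+ (A x y) (deg C x) (deg C y)) (∑-+ C _ _))
        (trans (∑-+ C _ _) (trans (cong₂ _+_ one two) (l Σ²)))
        where
        l : ∀ a → a + a ≡ + 2 * a
        l = solve-∀

    -- Cauchy-Schwarz is kept in the form of an explicit sum of squares, so that equality in
    -- Mantel's theorem makes every square vanish and the graph regular.
    variance : ∑ C (λ x → (L * deg C x - Q C) * (L * deg C x - Q C)) ≡ L * L * Σ² - L * Q C * Q C
    variance = trans (∑-cong C λ x → l L (deg C x) (Q C)) (trans (∑-+ C _ _) (trans (cong₂ _+_ (trans (∑-+ C _ _) (cong₂ _+_ (∑-* C (L * L) _) (∑-* C (- (+ 2 * L * Q C)) (deg C)))) (∑-const C (Q C * Q C))) (l′ L Σ² (Q C))))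
      where
      l : ∀ L d Q → (L * d - Q) * (L * d - Q) ≡ L * L * (d * d) + - (+ 2 * L * Q) * d + Q * Q
      l = solve-∀
      l′ : ∀ L s Q → L * L * s + - (+ 2 * L * Q) * Q + L * (Q * Q) ≡ L * L * s - L * Q * Q
      l′ = solve-∀

    variance≤ : + 2 * ∑ C (λ x → (L * deg C x - Q C) * (L * deg C x - Q C)) ≤ L * Q C * (L * L - + 2 * Q C)
    variance≤ = ≤-slack _ (0≤* (0≤² L) (≤⇒0≤- 2Σ²≤LQ)) (trans (cong (λ z → L * Q C * (L * L - + 2 * Q C) - + 2 * z) variance) (l L Σ² (Q C)))
      where
      l : ∀ L s Q → L * Q * (L * L - + 2 * Q) - + 2 * (L * L * s - L * Q * Q) ≡ L * L * (L * Q - + 2 * s)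
      l = solve-∀

    0≤variance : 0ℤ ≤ ∑ C (λ x → (L * deg C x - Q C) * (L * deg C x - Q C))
    0≤variance = 0≤∑ C λ x → 0≤² (L * deg C x - Q C)

    mantel : + 2 * Q C ≤ L * L
    mantel with ≤-total (+ 2 * Q C) (L * L)
    ... | inj₁ p = p
    ... | inj₂ p with Q C ≟ 0ℤ
    ...   | yes e = subst (λ z → + 2 * z ≤ L * L) (sym e) (0≤² L)
    ...   | no ne = 0≤-⇒≤ (0≤-cancel 0<LQ (≤-trans (0≤* (0≤+ℕ 2) 0≤variance) variance≤))
      where
      0<Q : 0ℤ < Q C
      0<Q = ≤∧≢⇒< (0≤Q C) (λ e → ne (sym e))
      0<L : 0ℤ < L
      0<L = nonempty C refl
        where
        nonempty : ∀ C′ → C ≡ C′ → 0ℤ < L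
        nonempty []       eq = ⊥-elim (ne (cong Q eq))
        nonempty (x ∷ C′) eq = subst (λ z → 0ℤ < # z) (sym eq) (+<+ (ℕ.s≤s ℕ.z≤n))
      0<LQ : 0ℤ < L * Q C
      0<LQ = 0<* 0<L 0<Q

    regular : + 2 * Q C ≡ L * L → ∀ x → x ∈ C → + 2 * deg C x ≡ L
    regular eq x x∈ = ≤-antisym (cancel (≤-reflexive e)) (cancel′ (≤-reflexive (sym e)))
      where
      0<L : 0ℤ < L
      0<L = nonempty C x∈
        where
        nonempty : ∀ C′ → x ∈ C′ → 0ℤ < # C′
        nonempty (x ∷ C′) _ = +<+ (ℕ.s≤s ℕ.z≤n)
      sq : (L * deg C x - Q C) * (L * deg C x - Q C) ≡ 0ℤ
      sq = sym (∑-≡-split C (λ _ → 0ℤ) (λ y → (L * deg C y - Q C) * (L * deg C y - Q C)) (λ y _ → 0≤² (L * deg C y - Q C))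
             (subst (∑ C (λ y → (L * deg C y - Q C) * (L * deg C y - Q C)) ≤_) (sym (∑-0 C))
               (*-cancel-0< {+ 2} (+<+ (ℕ.s≤s ℕ.z≤n)) (≤-trans variance≤ (≤-reflexive (trans (cong (λ z → L * Q C * (z - + 2 * Q C)) (sym eq)) (l L (Q C)))))))
             x x∈)
        where
        l : ∀ L Q → L * Q * (+ 2 * Q - + 2 * Q) ≡ + 2 * 0ℤ
        l = solve-∀
      Ld≡Q : L * deg C x ≡ Q C
      Ld≡Q = i-j≡0⇒i≡j (L * deg C x) (Q C) (x²≡0⇒x≡0 (L * deg C x - Q C) sq)
      e : L * (+ 2 * deg C x) ≡ L * L
      e = trans (l L (deg C x)) (trans (cong (+ 2 *_) Ld≡Q) eq)
        where
        l : ∀ L d → L * (+ 2 * d) ≡ + 2 * (L * d)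
        l = solve-∀
      cancel : L * (+ 2 * deg C x) ≤ L * L → + 2 * deg C x ≤ L
      cancel = *-cancel-0< 0<L
      cancel′ : L * L ≤ L * (+ 2 * deg C x) → L ≤ + 2 * deg C x
      cancel′ = *-cancel-0< 0<L

  -- Partitions into thirds when all degrees are below m

  module Thirds
    (m : ℕ) (1≤m : 1 ℕ.≤ m) (all : List V) (len : length all ≡ m ℕ.+ (m ℕ.+ m)) (D : ℤ)
    (D≤ : ∀ X Y Z → all ≋ X ++ (Y ++ Z) → length X ≡ m → length Y ≡ m → length Z ≡ m → D ≤ Q X + Q Y + Q Z)
    (small : ∀ v → deg all v ≤ + m - 1ℤ) (M²≤2D : + m * + m ≤ + 2 * D) where

    M : ℤ
    M = + m

    1≤M : 1ℤ ≤ M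
    1≤M = +≤+ 1≤m

    0<M : 0ℤ < M
    0<M = +<+ 1≤m

    -- Disjoint independent sets I and J, the remaining vertices C, and what I and J lack to size m.
    module Triple (I J C : List V) (a′ b′ : ℕ) (all≋ : all ≋ I ++ (J ++ C)) (QI : Q I ≡ 0ℤ) (QJ : Q J ≡ 0ℤ)
      (lI : length I ℕ.+ a′ ≡ m) (lJ : length J ℕ.+ b′ ≡ m) (lC : length C ≡ a′ ℕ.+ (b′ ℕ.+ m)) where

      α β L yI yJ c : ℤ
      α = + a′
      β = + b′
      L = α + (β + M)
      yI = E I C
      yJ = E J C
      c = Q C

      ∑deg-E : ∀ k X Y → ∑ X (λ u → k * deg Y u) ≡ k * E Y X
      ∑deg-E k X Y = trans (∑-* X k (deg Y)) (cong (k *_) (E-sym X Y))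

      -- I and J are filled up by random vertices of C.
      fill-both : 2 ℕ.≤ b′ ℕ.+ m → L * L * D ≤ L * (α * (+ 2 * yI) + β * (+ 2 * yJ)) + (α * α + β * β + M * M) * c
      fill-both 2≤ = ≤-trans (split₃-average C a′ b′ m lC 2≤ (λ u → + 2 * deg I u) (λ u → + 2 * deg J u) D step)
        (≤-reflexive (cong₂ (λ x y → L * (α * x + β * y) + (α * α + β * β + M * M) * c) (∑deg-E (+ 2) C I) (∑deg-E (+ 2) C J)))
        where
        step : ∀ R S T → C ≋ R ++ (S ++ T) → length R ≡ a′ → length S ≡ b′ → length T ≡ m →
          D ≤ ∑ R (λ u → + 2 * deg I u) + ∑ S (λ u → + 2 * deg J u) + (Q R + Q S + Q T)
        step R S T C≋ lR lS lT = ≤-trans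
          (D≤ (I ++ R) (J ++ S) T perm (trans (length-++ I) (trans (cong (length I ℕ.+_) lR) lI)) (trans (length-++ J) (trans (cong (length J ℕ.+_) lS) lJ)) lT)
          (≤-reflexive (trans (cong₂ (λ x y → x + y + Q T) (Q-++ I R) (Q-++ J S))
            (trans (cong₂ (λ x y → x + + 2 * E I R + Q R + (y + + 2 * E J S + Q S) + Q T) QI QJ)
              (trans (l (E I R) (Q R) (E J S) (Q S) (Q T)) (sym (cong₂ (λ x y → x + y + (Q R + Q S + Q T)) (∑deg-E (+ 2) R I) (∑deg-E (+ 2) S J)))))))
          where
          l : ∀ a b c d e → 0ℤ + + 2 * a + b + (0ℤ + + 2 * c + d) + e ≡ + 2 * a + + 2 * c + (b + d + e)
          l = solve-∀
          perm : all ≋ (I ++ R) ++ ((J ++ S) ++ T)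
          perm = ≋-by λ f → trans (∑≡ all≋ f) (trans (∑-++ I _ f) (trans (cong (_+_ (∑ I f)) (trans (∑-++ J C f) (cong (_+_ (∑ J f)) (trans (∑≡ C≋ f) (trans (∑-++ R _ f) (cong (_+_ (∑ R f)) (∑-++ S T f)))))))
            (trans (l′ (∑ I f) (∑ J f) (∑ R f) (∑ S f) (∑ T f)) (sym (trans (∑-++ (I ++ R) _ f) (cong₂ _+_ (∑-++ I R f) (trans (∑-++ (J ++ S) T f) (cong (_+ ∑ T f) (∑-++ J S f)))))))))
            where
            l′ : ∀ i j r s t → i + (j + (r + (s + t))) ≡ (i + r) + ((j + s) + t)
            l′ = solve-∀

      -- I is filled up by random vertices of C, and the remaining graph is halved.
      fill-one : 2 ℕ.≤ a′ ℕ.+ (b′ ℕ.+ m) →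
        L * L * (+ 50 * D - + 3 * M * M) ≤ L * (α * (+ 100 * yI) + (β + M) * (+ 40 * yJ)) + (+ 50 * (α * α) + + 20 * ((β + M) * (β + M))) * c
      fill-one 2≤ = ≤-trans (split-average C a′ (b′ ℕ.+ m) lC 2≤ (λ u → + 100 * deg I u) (λ u → + 40 * deg J u) (+ 50) (+ 20) _ (0≤+ℕ 50) (0≤+ℕ 20) step)
        (≤-reflexive (cong₂ (λ x y → L * (α * x + (β + M) * y) + (+ 50 * (α * α) + + 20 * ((β + M) * (β + M))) * c) (∑deg-E (+ 100) C I) (∑deg-E (+ 40) C J)))
        where
        step : ∀ R U → C ≋ R ++ U → length R ≡ a′ → length U ≡ b′ ℕ.+ m →
          + 50 * D - + 3 * M * M ≤ ∑ R (λ u → + 100 * deg I u) + ∑ U (λ u → + 40 * deg J u) + (+ 50 * Q R + + 20 * Q U)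
        step R U C≋ lR lU = ≤-slack _ (≤⇒0≤- tangent′)
          (trans (cong₂ (λ x y → x + y + (+ 50 * Q R + + 20 * Q U) - (+ 50 * D - + 3 * M * M)) (∑deg-E (+ 100) R I) (∑deg-E (+ 40) U J))
            (trans (l D M (E I R) (E J U) (Q R) (Q U)) (sym (cong₂ (λ x y → + 20 * x + + 3 * M * M - + 50 * (D - y)) (trans (Q-++ J U) (cong (λ z → z + + 2 * E J U + Q U) QJ)) (trans (Q-++ I R) (cong (λ z → z + + 2 * E I R + Q R) QI))))))
          where
          l : ∀ D M a b r u → + 100 * a + + 40 * b + (+ 50 * r + + 20 * u) - (+ 50 * D - + 3 * M * M)
            ≡ + 20 * (0ℤ + + 2 * b + u) + + 3 * M * M - + 50 * (D - (0ℤ + + 2 * a + r))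
          l = solve-∀
          all≋′ : all ≋ (I ++ R) ++ (J ++ U)
          all≋′ = ≋-by λ f → trans (∑≡ all≋ f) (trans (∑-++ I _ f) (trans (cong (_+_ (∑ I f)) (trans (∑-++ J C f) (cong (_+_ (∑ J f)) (trans (∑≡ C≋ f) (∑-++ R U f)))))
            (trans (l′ (∑ I f) (∑ J f) (∑ R f) (∑ U f)) (sym (trans (∑-++ (I ++ R) _ f) (cong₂ _+_ (∑-++ I R f) (∑-++ J U f)))))))
            where
            l′ : ∀ i j r s → i + (j + (r + s)) ≡ (i + r) + (j + s)
            l′ = solve-∀
          lIR : length (I ++ R) ≡ m
          lIR = trans (length-++ I) (trans (cong (length I ℕ.+_) lR) lI)
          l″ : ∀ D a x y → x + y - (D - a) ≡ a + x + y - D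
          l″ = solve-∀
          -- `J ++ U` has 2m vertices and inherits the degree bound from the whole graph, so that
          -- `tangent` applies to its halving; the weights 50 and 20 of the average come from there.
          tangent′ : + 50 * (D - Q (I ++ R)) ≤ + 20 * Q (J ++ U) + + 3 * M * M
          tangent′ = Halves.SmallDegrees.tangent m 1≤m (J ++ U) (trans (length-++ J) (trans (cong (length J ℕ.+_) lU) (trans (sym (ℕₚ.+-assoc (length J) b′ m)) (cong (ℕ._+ m) lJ)))) (D - Q (I ++ R)) (λ X Y H≋ lX lY → ≤-slack _ (≤⇒0≤- (D≤ (I ++ R) X Y (≋-trans all≋′ (≋-++ (≋-refl {xs = I ++ R}) H≋)) lIR lX lY)) (l″ D (Q (I ++ R)) (Q X) (Q Y))) λ v _ → ≤-trans (≤-slack _ (0≤deg (I ++ R) v) (trans (cong (_- deg (J ++ U) v) (trans (deg-≋ all≋′ v) (deg-++ (I ++ R) (J ++ U) v))) (l‴ (deg (I ++ R) v) (deg (J ++ U) v)))) (small v)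
              where
              l‴ : ∀ a b → a + b - b ≡ a
              l‴ = solve-∀

      -- A random m-subset of C is one part, and the remaining graph is halved.
      random-third : 2 ℕ.≤ m ℕ.+ (a′ ℕ.+ b′) → length C ≡ m ℕ.+ (a′ ℕ.+ b′) →
        L * L * (+ 2 * D - + 2 * E I J) ≤ L * ((α + β) * (+ 2 * (yI + yJ))) + (+ 2 * (M * M) + (α + β) * (α + β)) * c
      random-third 2≤ lC′ = ≤-slack _ (≤⇒0≤- (split-average C m (a′ ℕ.+ b′) lC′ 2≤ (λ _ → 0ℤ) (λ u → + 2 * deg (I ++ J) u) (+ 2) 1ℤ _ (0≤+ℕ 2) (0≤+ℕ 1) step))
        (trans (l M α β (yI + yJ) c (+ 2 * D - + 2 * E I J)) (sym (cong₂ (λ x y → (M + (α + β)) * (M * x + (α + β) * y) + (+ 2 * (M * M) + 1ℤ * ((α + β) * (α + β))) * c - (M + (α + β)) * (M + (α + β)) * (+ 2 * D - + 2 * E I J))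
          (∑-0 C) (trans (∑deg-E (+ 2) C (I ++ J)) (cong (+ 2 *_) (E-++ˡ I J C))))))
        where
        l : ∀ M α β y c z → (α + (β + M)) * ((α + β) * (+ 2 * y)) + (+ 2 * (M * M) + (α + β) * (α + β)) * c - (α + (β + M)) * (α + (β + M)) * z
          ≡ (M + (α + β)) * (M * 0ℤ + (α + β) * (+ 2 * y)) + (+ 2 * (M * M) + 1ℤ * ((α + β) * (α + β))) * c - (M + (α + β)) * (M + (α + β)) * z
        l = solve-∀
        step : ∀ R U → C ≋ R ++ U → length R ≡ m → length U ≡ a′ ℕ.+ b′ →
          + 2 * D - + 2 * E I J ≤ ∑ R (λ _ → 0ℤ) + ∑ U (λ u → + 2 * deg (I ++ J) u) + (+ 2 * Q R + 1ℤ * Q U)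
        step R U C≋ lR lU = ≤-slack _ (≤⇒0≤- (Halves.halving m 1≤m ((I ++ J) ++ U) lens (D - Q R) (λ X Y H≋ lX lY → ≤-slack _ (≤⇒0≤- (D≤ R X Y (≋-trans all≋′ (≋-++ (≋-refl {xs = R}) H≋)) lR lX lY)) (l″ D (Q R) (Q X) (Q Y)))))
          (trans (cong₂ (λ x y → x + y + (+ 2 * Q R + 1ℤ * Q U) - (+ 2 * D - + 2 * E I J)) (∑-0 R) (∑deg-E (+ 2) U (I ++ J)))
            (trans (l₁ D (E I J) (E (I ++ J) U) (Q R) (Q U)) (sym (cong (_- + 2 * (D - Q R)) (trans (Q-++ (I ++ J) U) (cong (λ z → z + + 2 * E (I ++ J) U + Q U) (trans (Q-++ I J) (cong₂ (λ x y → x + + 2 * E I J + y) QI QJ))))))))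
          where
          l₁ : ∀ D e y r u → 0ℤ + + 2 * y + (+ 2 * r + 1ℤ * u) - (+ 2 * D - + 2 * e) ≡ 0ℤ + + 2 * e + 0ℤ + + 2 * y + u - + 2 * (D - r)
          l₁ = solve-∀
          all≋′ : all ≋ R ++ ((I ++ J) ++ U)
          all≋′ = ≋-by λ f → trans (∑≡ all≋ f) (trans (∑-++ I _ f) (trans (cong (_+_ (∑ I f)) (trans (∑-++ J C f) (cong (_+_ (∑ J f)) (trans (∑≡ C≋ f) (∑-++ R U f)))))
            (trans (l′ (∑ I f) (∑ J f) (∑ R f) (∑ U f)) (sym (trans (∑-++ R _ f) (cong (_+_ (∑ R f)) (trans (∑-++ (I ++ J) U f) (cong (_+ ∑ U f) (∑-++ I J f)))))))))
            where
            l′ : ∀ i j r s → i + (j + (r + s)) ≡ r + ((i + j) + s)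
            l′ = solve-∀
          lens : length ((I ++ J) ++ U) ≡ m ℕ.+ m
          lens = trans (length-++ (I ++ J)) (trans (cong₂ ℕ._+_ (length-++ I) lU) (trans (arrange (length I) (length J) a′ b′) (cong₂ ℕ._+_ lI lJ)))
            where
            arrange : ∀ i j a b → (i ℕ.+ j) ℕ.+ (a ℕ.+ b) ≡ (i ℕ.+ a) ℕ.+ (j ℕ.+ b)
            arrange i j a b = +-injective (l‴ (+ i) (+ j) (+ a) (+ b))
              where
              l‴ : ∀ i j a b → (i + j) + (a + b) ≡ (i + a) + (j + b)
              l‴ = solve-∀
          l″ : ∀ D a x y → x + y - (D - a) ≡ a + x + y - D
          l″ = solve-∀

    d : V → ℤ
    d = deg all

    q : ℤ
    q = Q all

    module OnEdge (u v : V) (v∈ : v ∈ all) (u∼v : adj u v ≡ true) where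

      rest I J C : List V
      I    = nbrs u all
      rest = others u all
      J    = nbrs v rest
      C    = others v rest

      all≋ : all ≋ I ++ (J ++ C)
      all≋ = ≋-trans (nbrs-others u all) (≋-++ (≋-refl {xs = I}) (nbrs-others v rest))

      -- The adjacent vertices u and v have no common neighbour, so nothing of N(v) is lost by first
      -- removing N(u). Defining `J` inside `rest` makes the three lists disjoint by construction.
      J≋ : J ≋ nbrs v all
      J≋ = ≋-by λ f → sym (trans (∑-nbrs v all f) (trans (∑≡ (nbrs-others u all) (λ w → A v w * f w))
        (trans (∑-++ I rest _) (trans (cong₂ _+_ (disjoint f) (sym (∑-nbrs v rest f))) (+-identityˡ _)))))
        where
        disjoint : ∀ f → ∑ I (λ w → A v w * f w) ≡ 0ℤ
        disjoint f = trans (∑-nbrs u all _) (trans (∑-cong all λ w → trans (l (A u v) (A u w) (A v w) (f w) (A-adj u∼v)) (cong (_* f w) (A-triangle u v w))) (∑-0 all))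
          where
          l : ∀ e x y z → e ≡ 1ℤ → x * (y * z) ≡ e * (x * y) * z
          l _ x y z refl = l′ x y z
            where
            l′ : ∀ x y z → x * (y * z) ≡ 1ℤ * (x * y) * z
            l′ = solve-∀

      others≋ : others v all ≋ I ++ C
      others≋ = ≋-by λ f → +-cancelˡ-≡′ (∑ (nbrs v all) f) _ _ (trans (sym (trans (∑≡ (nbrs-others v all) f) (∑-++ (nbrs v all) _ f)))
        (trans (∑≡ all≋ f) (trans (∑-++ I _ f) (trans (cong (_+_ (∑ I f)) (trans (∑-++ J C f) (cong (_+ ∑ C f) (∑≡ J≋ f))))
          (trans (l (∑ I f) (∑ (nbrs v all) f) (∑ C f)) (cong (_+_ (∑ (nbrs v all) f)) (sym (∑-++ I C f))))))))
        where
        +-cancelˡ-≡′ : ∀ x y z → x + y ≡ x + z → y ≡ z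
        +-cancelˡ-≡′ x y z e = trans (l′ x y) (trans (cong (_- x) e) (sym (l′ x z)))
          where
          l′ : ∀ x y → y ≡ (x + y) - x
          l′ = solve-∀
        l : ∀ i j c → i + (j + c) ≡ j + (i + c)
        l = solve-∀

      QI : Q I ≡ 0ℤ
      QI = Q-nbrs u all
      QJ : Q J ≡ 0ℤ
      QJ = Q-nbrs v rest

      #I : # I ≡ d u
      #I = #nbrs u all
      #J : # J ≡ d v
      #J = trans (≋-# J≋) (#nbrs v all)

      a′ b′ : ℕ
      a′ = m ℕ.∸ length I
      b′ = m ℕ.∸ length J

      fits : ∀ {n x} → + n ≡ d x → suc n ℕ.≤ m
      fits {n} {x} e = drop‿+≤+ (≤-slack _ (≤⇒0≤- (subst (_≤ M - 1ℤ) (sym e) (small x))) (l M (+ n)))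
        where
        l : ∀ m n → m - (1ℤ + n) ≡ m - 1ℤ - n
        l = solve-∀

      <I : suc (length I) ℕ.≤ m
      <I = fits {x = u} #I
      <J : suc (length J) ℕ.≤ m
      <J = fits {x = v} #J

      lI : length I ℕ.+ a′ ≡ m
      lI = ℕₚ.m+[n∸m]≡n (ℕₚ.<⇒≤ <I)
      lJ : length J ℕ.+ b′ ≡ m
      lJ = ℕₚ.m+[n∸m]≡n (ℕₚ.<⇒≤ <J)

      α β a b : ℤ
      a = d u
      b = d v
      α = M - a
      β = M - b

      α≡ : + a′ ≡ α
      α≡ = trans (l (+ length I) (+ a′)) (cong₂ _-_ (cong +_ lI) #I)
        where
        l : ∀ x y → y ≡ (x + y) - x
        l = solve-∀
      β≡ : + b′ ≡ β
      β≡ = trans (l (+ length J) (+ b′)) (cong₂ _-_ (cong +_ lJ) #J)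
        where
        l : ∀ x y → y ≡ (x + y) - x
        l = solve-∀

      lC : length C ≡ a′ ℕ.+ (b′ ℕ.+ m)
      lC = +-injective (trans (l (# I) (# J) (# C)) (trans (cong (λ z → z - # I - # J) (trans (cong (_+_ (# I)) (sym (#-++ J C))) (trans (sym (#-++ I (J ++ C))) (trans (sym (≋-# all≋)) (cong +_ len)))))
          (trans (cong₂ (λ x y → M + (M + M) - x - y) #I #J) (trans (l′ M a b) (sym (cong₂ (λ x y → x + (y + M)) α≡ β≡))))))
        where
        l : ∀ i j c → c ≡ i + (j + c) - i - j
        l = solve-∀
        l′ : ∀ m a b → m + (m + m) - a - b ≡ (m - a) + ((m - b) + m)
        l′ = solve-∀

      1≤a′ : 1 ℕ.≤ a′
      1≤a′ = ℕₚ.m<n⇒0<n∸m <I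
      1≤b′ : 1 ℕ.≤ b′
      1≤b′ = ℕₚ.m<n⇒0<n∸m <J

      private
        swap : ∀ i j c → i + (j + c) ≡ j + (i + c)
        swap = solve-∀

      X Y c yI yJ : ℤ
      X = q - + 2 * nbrDeg all v
      Y = q - + 2 * nbrDeg all u
      c = Q C
      yI = E I C
      yJ = E J C

      X≡ : X ≡ + 2 * yI + c
      X≡ = trans (sym (Q-others v all)) (trans (Q-≋ others≋) (trans (Q-++ I C) (trans (cong (λ z → z + + 2 * yI + c) QI) (cong (_+ c) (+-identityˡ (+ 2 * yI))))))

      Y≡ : Y ≡ + 2 * yJ + c
      Y≡ = trans (sym (Q-others u all)) (trans (Q-≋ (nbrs-others v rest)) (trans (Q-++ J C) (trans (cong (λ z → z + + 2 * yJ + c) QJ) (cong (_+ c) (+-identityˡ (+ 2 * yJ))))))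

      q≡ : q ≡ + 2 * E I J + + 2 * yI + + 2 * yJ + c
      q≡ = trans (Q-≋ all≋) (trans (Q-++ I (J ++ C)) (trans (cong₃ (QI) (E-++ʳ J C I) (trans (Q-++ J C) (cong (λ z → z + + 2 * yJ + c) QJ))) (l (E I J) yI yJ c)))
        where
        cong₃ : ∀ {x x′ y y′ z z′} → x ≡ x′ → y ≡ y′ → z ≡ z′ → x + + 2 * y + z ≡ x′ + + 2 * y′ + z′
        cong₃ refl refl refl = refl
        l : ∀ e i j c → 0ℤ + + 2 * (e + i) + (0ℤ + + 2 * j + c) ≡ + 2 * e + + 2 * i + + 2 * j + c
        l = solve-∀

      module B = EdgeBounds M a b X Y c q

      0≤c : 0ℤ ≤ c
      0≤c = 0≤Q C

      0≤slack-both : 0ℤ ≤ B.slack-both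
      0≤slack-both = subst (0ℤ ≤_) (go α≡ β≡ X≡ Y≡) (0≤+ (0≤* (0≤+ℕ 2) (≤⇒0≤- (Triple.fill-both I J C a′ b′ all≋ QI QJ lI lJ lC (ℕₚ.+-mono-≤ 1≤b′ 1≤m)))) (0≤* (0≤² (+ a′ + (+ b′ + M))) (≤⇒0≤- M²≤2D)))
        where
        l : ∀ m a b i j c D → + 2 * (((m - a) + ((m - b) + m)) * ((m - a) * (+ 2 * i) + (m - b) * (+ 2 * j)) + ((m - a) * (m - a) + (m - b) * (m - b) + m * m) * c - ((m - a) + ((m - b) + m)) * ((m - a) + ((m - b) + m)) * D)
            + ((m - a) + ((m - b) + m)) * ((m - a) + ((m - b) + m)) * (+ 2 * D - m * m)
          ≡ + 2 * (+ 3 * m - a - b) * ((m - a) * (+ 2 * i + c) + (m - b) * (+ 2 * j + c)) + + 2 * (m * m - m * ((m - a) + (m - b)) - + 2 * ((m - a) * (m - b))) * c - (+ 3 * m - a - b) * (+ 3 * m - a - b) * (m * m)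
        l = solve-∀
        go : ∀ {A B x y} → A ≡ M - a → B ≡ M - b → x ≡ + 2 * yI + c → y ≡ + 2 * yJ + c →
          + 2 * ((A + (B + M)) * (A * (+ 2 * yI) + B * (+ 2 * yJ)) + (A * A + B * B + M * M) * c - (A + (B + M)) * (A + (B + M)) * D) + (A + (B + M)) * (A + (B + M)) * (+ 2 * D - M * M)
          ≡ + 2 * (+ 3 * M - a - b) * ((M - a) * x + (M - b) * y) + + 2 * (M * M - M * ((M - a) + (M - b)) - + 2 * ((M - a) * (M - b))) * c - (+ 3 * M - a - b) * (+ 3 * M - a - b) * (M * M)
        go refl refl refl refl = l M a b yI yJ c D

      private
        one-sided : ∀ {A B x y} i j → A ≡ M - a → B ≡ M - b → x ≡ + 2 * i + c → y ≡ + 2 * j + c →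
          ((A + (B + M)) * (A * (+ 100 * i) + (B + M) * (+ 40 * j)) + (+ 50 * (A * A) + + 20 * ((B + M) * (B + M))) * c - (A + (B + M)) * (A + (B + M)) * (+ 50 * D - + 3 * M * M))
          + + 25 * ((A + (B + M)) * (A + (B + M)) * (+ 2 * D - M * M))
          ≡ + 2 * (+ 25 * (+ 3 * M - a - b) * (M - a) * x + + 10 * (+ 3 * M - a - b) * ((+ 3 * M - a - b) - (M - a)) * y - + 35 * (M - a) * ((+ 3 * M - a - b) - (M - a)) * c - + 11 * (+ 3 * M - a - b) * (+ 3 * M - a - b) * (M * M))
        one-sided i j refl refl refl refl = l M a b i j c D
          where
          l : ∀ m a b i j c D →
            (((m - a) + ((m - b) + m)) * ((m - a) * (+ 100 * i) + ((m - b) + m) * (+ 40 * j)) + (+ 50 * ((m - a) * (m - a)) + + 20 * (((m - b) + m) * ((m - b) + m))) * c - ((m - a) + ((m - b) + m)) * ((m - a) + ((m - b) + m)) * (+ 50 * D - + 3 * m * m))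
            + + 25 * (((m - a) + ((m - b) + m)) * ((m - a) + ((m - b) + m)) * (+ 2 * D - m * m))
            ≡ + 2 * (+ 25 * (+ 3 * m - a - b) * (m - a) * (+ 2 * i + c) + + 10 * (+ 3 * m - a - b) * ((+ 3 * m - a - b) - (m - a)) * (+ 2 * j + c) - + 35 * (m - a) * ((+ 3 * m - a - b) - (m - a)) * c - + 11 * (+ 3 * m - a - b) * (+ 3 * m - a - b) * (m * m))
          l = solve-∀

        one-sided′ : ∀ {A B x y} i j → A ≡ M - a → B ≡ M - b → x ≡ + 2 * i + c → y ≡ + 2 * j + c →
          ((B + (A + M)) * (B * (+ 100 * j) + (A + M) * (+ 40 * i)) + (+ 50 * (B * B) + + 20 * ((A + M) * (A + M))) * c - (B + (A + M)) * (B + (A + M)) * (+ 50 * D - + 3 * M * M))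
          + + 25 * ((B + (A + M)) * (B + (A + M)) * (+ 2 * D - M * M))
          ≡ + 2 * (+ 25 * (+ 3 * M - a - b) * (M - b) * y + + 10 * (+ 3 * M - a - b) * ((+ 3 * M - a - b) - (M - b)) * x - + 35 * (M - b) * ((+ 3 * M - a - b) - (M - b)) * c - + 11 * (+ 3 * M - a - b) * (+ 3 * M - a - b) * (M * M))
        one-sided′ i j refl refl refl refl = l M a b i j c D
          where
          l : ∀ m a b i j c D →
            (((m - b) + ((m - a) + m)) * ((m - b) * (+ 100 * j) + ((m - a) + m) * (+ 40 * i)) + (+ 50 * ((m - b) * (m - b)) + + 20 * (((m - a) + m) * ((m - a) + m))) * c - ((m - b) + ((m - a) + m)) * ((m - b) + ((m - a) + m)) * (+ 50 * D - + 3 * m * m))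
            + + 25 * (((m - b) + ((m - a) + m)) * ((m - b) + ((m - a) + m)) * (+ 2 * D - m * m))
            ≡ + 2 * (+ 25 * (+ 3 * m - a - b) * (m - b) * (+ 2 * j + c) + + 10 * (+ 3 * m - a - b) * ((+ 3 * m - a - b) - (m - b)) * (+ 2 * i + c) - + 35 * (m - b) * ((+ 3 * m - a - b) - (m - b)) * c - + 11 * (+ 3 * m - a - b) * (+ 3 * m - a - b) * (m * m))
          l = solve-∀

      0≤slack-I : 0ℤ ≤ B.slack-I
      0≤slack-I = 0≤-cancel {+ 2} (+<+ (ℕ.s≤s ℕ.z≤n)) (subst (0ℤ ≤_) (one-sided yI yJ α≡ β≡ X≡ Y≡)
        (0≤+ (≤⇒0≤- (Triple.fill-one I J C a′ b′ all≋ QI QJ lI lJ lC (ℕₚ.≤-trans (ℕₚ.+-mono-≤ 1≤b′ 1≤m) (ℕₚ.m≤n+m _ a′)))) (0≤* (0≤+ℕ 25) (0≤* (0≤² (+ a′ + (+ b′ + M))) (≤⇒0≤- M²≤2D)))))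

      0≤slack-J : 0ℤ ≤ B.slack-J
      0≤slack-J = 0≤-cancel {+ 2} (+<+ (ℕ.s≤s ℕ.z≤n)) (subst (0ℤ ≤_) (one-sided′ yI yJ α≡ β≡ X≡ Y≡)
        (0≤+ (≤⇒0≤- (Triple.fill-one J I C b′ a′ (≋-by λ f → trans (∑≡ all≋ f) (trans (∑-++ I _ f) (trans (cong (_+_ (∑ I f)) (∑-++ J C f)) (trans (swap (∑ I f) (∑ J f) (∑ C f)) (sym (trans (∑-++ J _ f) (cong (_+_ (∑ J f)) (∑-++ I C f)))))))) QJ QI lJ lI (trans lC (trans (sym (ℕₚ.+-assoc a′ b′ m)) (trans (cong (ℕ._+ m) (ℕₚ.+-comm a′ b′)) (ℕₚ.+-assoc b′ a′ m)))) (ℕₚ.≤-trans (ℕₚ.+-mono-≤ 1≤a′ 1≤m) (ℕₚ.m≤n+m _ b′)))) (0≤* (0≤+ℕ 25) (0≤* (0≤² (+ b′ + (+ a′ + M))) (≤⇒0≤- M²≤2D)))))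

      0≤slack-third : 0ℤ ≤ B.slack-third
      0≤slack-third = subst (0ℤ ≤_) (go (E I J) α≡ β≡ X≡ Y≡ q≡)
        (0≤+ (≤⇒0≤- (Triple.random-third I J C a′ b′ all≋ QI QJ lI lJ lC (ℕₚ.+-mono-≤ 1≤m (ℕₚ.≤-trans 1≤a′ (ℕₚ.m≤m+n a′ b′))) (trans lC (trans (sym (ℕₚ.+-assoc a′ b′ m)) (ℕₚ.+-comm (a′ ℕ.+ b′) m)))))
             (0≤* (0≤² (+ a′ + (+ b′ + M))) (≤⇒0≤- M²≤2D)))
        where
        l : ∀ m a b i j c D e →
          (((m - a) + ((m - b) + m)) * (((m - a) + (m - b)) * (+ 2 * (i + j))) + (+ 2 * (m * m) + ((m - a) + (m - b)) * ((m - a) + (m - b))) * c - ((m - a) + ((m - b) + m)) * ((m - a) + ((m - b) + m)) * (+ 2 * D - + 2 * e))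
          + ((m - a) + ((m - b) + m)) * ((m - a) + ((m - b) + m)) * (+ 2 * D - m * m)
          ≡ (+ 3 * m - a - b) * (+ 3 * m - a - b) * (+ 2 * e + + 2 * i + + 2 * j + c) - (+ 3 * m - a - b) * m * ((+ 2 * i + c) + (+ 2 * j + c)) + + 3 * (m * m) * c - (+ 3 * m - a - b) * (+ 3 * m - a - b) * (m * m)
        l = solve-∀
        go : ∀ {A B x y z} e → A ≡ M - a → B ≡ M - b → x ≡ + 2 * yI + c → y ≡ + 2 * yJ + c → z ≡ + 2 * e + + 2 * yI + + 2 * yJ + c →
          ((A + (B + M)) * ((A + B) * (+ 2 * (yI + yJ))) + (+ 2 * (M * M) + (A + B) * (A + B)) * c - (A + (B + M)) * (A + (B + M)) * (+ 2 * D - + 2 * e)) + (A + (B + M)) * (A + (B + M)) * (+ 2 * D - M * M)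
          ≡ (+ 3 * M - a - b) * (+ 3 * M - a - b) * z - (+ 3 * M - a - b) * M * (x + y) + + 3 * (M * M) * c - (+ 3 * M - a - b) * (+ 3 * M - a - b) * (M * M)
        go e refl refl refl refl refl = l M a b yI yJ c D e

      c≤X : c ≤ X
      c≤X = ≤-slack (+ 2 * yI) (0≤* (0≤+ℕ 2) (0≤E I C)) (trans (cong (_- c) X≡) (l (+ 2 * yI) c))
        where
        l : ∀ x c → x + c - c ≡ x
        l = solve-∀
      c≤Y : c ≤ Y
      c≤Y = ≤-slack (+ 2 * yJ) (0≤* (0≤+ℕ 2) (0≤E J C)) (trans (cong (_- c) Y≡) (l (+ 2 * yJ) c))
        where
        l : ∀ x c → x + c - c ≡ x
        l = solve-∀

      #C : # C ≡ B.L
      #C = trans (cong +_ lC) (trans (cong₂ (λ x y → x + (y + M)) α≡ β≡) (l M a b))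
        where
        l : ∀ m a b → (m - a) + ((m - b) + m) ≡ + 3 * m - a - b
        l = solve-∀

      2c≤L² : + 2 * c ≤ B.L * B.L
      2c≤L² = subst (λ z → + 2 * c ≤ z * z) #C (Mantel.mantel C)

      0<L : 0ℤ < B.L
      0<L = subst (0ℤ <_) (trans (sym (cong +_ lC)) #C) (+<+ (ℕₚ.≤-trans 1≤a′ (ℕₚ.m≤m+n a′ _)))

      0≤α : 0ℤ ≤ α
      0≤α = subst (0ℤ ≤_) α≡ (0≤+ℕ a′)
      0≤β : 0ℤ ≤ β
      0≤β = subst (0ℤ ≤_) β≡ (0≤+ℕ b′)

      -- `P₁` times q - 2ab is what `B.F` becomes when S(u) and S(v) are both replaced by ab, so the
      -- first difference sums to 0 under the weights. The term `w` is, up to the weights, q³ (1/a +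
      -- 1/b - 6m/q); its sum over all edges is at most 0, because the sum of 1/d(u) over the edges
      -- at a vertex u is at most 1 and there are 3m vertices.
      gain w : ℤ
      w    = + 3 * q * q * ((a + b) * q - + 6 * M * (a * b)) * W₂ M a b
      gain = + 80 * M * M * M * (a * b) * (B.F - P₁ M a b * (q - + 2 * (a * b))) + w

      edge-gain : + 4 * (a * b) * m⁷ M ≤ + 5 * gain
      edge-gain = conclude (Ψ-positive M a b q 0<M (0≤deg all u) (0≤-⇒≤ 0≤α) (0≤deg all v) (0≤-⇒≤ 0≤β) (0≤Q all))
        where
        0≤a : 0ℤ ≤ a
        0≤a = 0≤deg all u
        0≤b : 0ℤ ≤ b
        0≤b = 0≤deg all v
        weaken : ∀ ρ → ρ ≤ + 10 * M * B.F → + 4 * (a * b) * m⁷ M ≤ + 5 * Ψ M a b q ρ → + 4 * (a * b) * m⁷ M ≤ + 5 * gain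
        weaken ρ ρ≤ h = ≤-trans h (≤-slack (+ 40 * (M * M * (a * b)) * (+ 10 * M * B.F - ρ))
            (0≤* (0≤* (0≤+ℕ 40) (0≤* (0≤² M) (0≤* 0≤a 0≤b))) (≤⇒0≤- ρ≤)) (l M (a * b) B.F ρ (P₁ M a b) (q - + 2 * (a * b)) w))
          where
          l : ∀ m t F ρ P x w →
            + 5 * (+ 80 * m * m * m * t * (F - P * x) + w) - + 5 * (+ 8 * m * m * t * (ρ - + 10 * m * P * x) + w)
            ≡ + 40 * (m * m * t) * (+ 10 * m * F - ρ)
          l = solve-∀
        conclude : (0ℤ ≤ N₅ M a b × + 4 * (a * b) * m⁷ M ≤ + 5 * Ψ M a b q (ρ₁ M a b q)) ⊎
                   (N₅ M a b ≤ 0ℤ × + 4 * (a * b) * m⁷ M ≤ + 5 * Ψ M a b q (ρ₂ M a b q)) → + 4 * (a * b) * m⁷ M ≤ + 5 * gain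
        conclude (inj₁ (n , h)) = weaken (ρ₁ M a b q) (B.bound₁ (0≤+ℕ m) 0≤a 0≤b 0≤α 0≤β 0<L 0≤c c≤X c≤Y 0≤slack-both 0≤slack-I 0≤slack-J n) h
        conclude (inj₂ (n , h)) = weaken (ρ₂ M a b q) (B.bound₂ (0≤+ℕ m) 0≤a 0≤b 0≤α 0≤β 0<L 0≤c c≤X c≤Y 0≤slack-both 0≤slack-third 2c≤L² n) h

    -- Both d(v) and w(v) = 7m - 5 d(v) are at most 7m, so (7m)! is a multiple of each positive one,
    -- and K clears the denominator of 1 / (d(v) w(v)).
    N K : ℤ
    N = + (7 ℕ.* m)
    K = + ((7 ℕ.* m) !) * + ((7 ℕ.* m) !)

    w z S : V → ℤ
    w v = + 7 * M - + 5 * d v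
    z v = recip (7 ℕ.* m) (d v) * recip (7 ℕ.* m) (w v)
    S = nbrDeg all

    0<K : 0ℤ < K
    0<K = 0<* (0<! (7 ℕ.* m)) (0<! (7 ℕ.* m))

    0≤z : ∀ v → 0ℤ ≤ z v
    0≤z v = 0≤* (0≤recip (7 ℕ.* m) (d v)) (0≤recip (7 ℕ.* m) (w v))

    1≤w : ∀ v → 1ℤ ≤ w v
    1≤w v = ≤-slack _ (0≤+ (0≤* (0≤+ℕ 5) (≤⇒0≤- (small v))) (0≤+ (0≤* (0≤+ℕ 2) (0≤+ℕ m)) (0≤+ℕ 4))) (l M (d v))
      where
      l : ∀ m d → + 7 * m - + 5 * d - 1ℤ ≡ + 5 * (m - 1ℤ - d) + (+ 2 * m + + 4)
      l = solve-∀

    zdw : ∀ v → 1ℤ ≤ d v → z v * (d v * w v) ≡ K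
    zdw v 1≤d = trans (l (recip (7 ℕ.* m) (d v)) (recip (7 ℕ.* m) (w v)) (d v) (w v))
        (cong₂ _*_ (recip-* (7 ℕ.* m) (d v) 1≤d d≤) (recip-* (7 ℕ.* m) (w v) (1≤w v) w≤))
      where
      l : ∀ r s d w → r * s * (d * w) ≡ (r * d) * (s * w)
      l = solve-∀
      d≤ : d v ≤ N
      d≤ = subst (d v ≤_) (sym (pos-* 7 m)) (≤-slack _ (0≤+ (0≤+ (≤⇒0≤- (small v)) (0≤* (0≤+ℕ 6) (0≤+ℕ m))) (0≤+ℕ 1)) (l′ M (d v)))
        where
        l′ : ∀ m d → + 7 * m - d ≡ (m - 1ℤ - d) + + 6 * m + 1ℤ
        l′ = solve-∀
      w≤ : w v ≤ N
      w≤ = subst (w v ≤_) (sym (pos-* 7 m)) (≤-slack _ (0≤* (0≤+ℕ 5) (0≤deg all v)) (l′ M (d v)))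
        where
        l′ : ∀ m d → + 7 * m - (+ 7 * m - + 5 * d) ≡ + 5 * d
        l′ = solve-∀

    -- The weighted gains, split into a contribution t u v of each orientation of the edge.
    s t gain′ G : V → V → ℤ
    s u v     = - (+ 160) * (M * M * M) * K * (z u * (d u * d u) * (S u - d u * d v)) + + 3 * q * q * (K * q * (z u * w u) - + 3 * M * (K * K))
    t u v     = A u v * s u v
    gain′ u v = + 80 * M * M * M * (d u * d v) * ((w u * d v * (q - + 2 * S v) + w v * d u * (q - + 2 * S u)) - P₁ M (d u) (d v) * (q - + 2 * (d u * d v)))
      + + 3 * q * q * ((d u + d v) * q - + 6 * M * (d u * d v)) * (w u * w v)
    G u v     = A u v * (z u * z v * gain′ u v)

    1≤d : ∀ u v → v ∈ all → adj u v ≡ true → 1ℤ ≤ d u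
    1≤d u v v∈ p = subst (_≤ d u) (A-adj p) (A≤deg all u v v∈)

    1≤d′ : ∀ u v → u ∈ all → adj u v ≡ true → 1ℤ ≤ d v
    1≤d′ u v u∈ p = 1≤d v u u∈ (trans (adj-sym v u) p)

    gain-split : ∀ u v → z u * (d u * w u) ≡ K → z v * (d v * w v) ≡ K → z u * z v * gain′ u v ≡ s u v + s v u
    gain-split u v e e′ = identity M q (d u) (d v) (w u) (w v) (z u) (z v) (S v) (S u) K K e e′
      where
      l : ∀ m q a b wa wb x y s r →
        x * y * (+ 80 * m * m * m * (a * b) * ((wa * b * (q - + 2 * s) + wb * a * (q - + 2 * r)) - (b * wa + a * wb) * (q - + 2 * (a * b)))
          + + 3 * q * q * ((a + b) * q - + 6 * m * (a * b)) * (wa * wb))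
        ≡ - (+ 160) * (m * m * m) * (y * (b * wb)) * (x * (a * a) * (r - a * b)) + + 3 * q * q * ((y * (b * wb)) * q * (x * wa) - + 3 * m * ((x * (a * wa)) * (y * (b * wb))))
        + (- (+ 160) * (m * m * m) * (x * (a * wa)) * (y * (b * b) * (s - b * a)) + + 3 * q * q * ((x * (a * wa)) * q * (y * wb) - + 3 * m * ((x * (a * wa)) * (y * (b * wb)))))
      l = solve-∀
      identity : ∀ m q a b wa wb x y s r k k′ → x * (a * wa) ≡ k → y * (b * wb) ≡ k′ →
        x * y * (+ 80 * m * m * m * (a * b) * ((wa * b * (q - + 2 * s) + wb * a * (q - + 2 * r)) - (b * wa + a * wb) * (q - + 2 * (a * b)))
          + + 3 * q * q * ((a + b) * q - + 6 * m * (a * b)) * (wa * wb))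
        ≡ - (+ 160) * (m * m * m) * k′ * (x * (a * a) * (r - a * b)) + + 3 * q * q * (k′ * q * (x * wa) - + 3 * m * (k * k′))
        + (- (+ 160) * (m * m * m) * k * (y * (b * b) * (s - b * a)) + + 3 * q * q * (k * q * (y * wb) - + 3 * m * (k * k′)))
      identity m q a b wa wb x y s r _ _ refl refl = l m q a b wa wb x y s r

    G≡ : ∀ u v → u ∈ all → v ∈ all → G u v ≡ t u v + t v u
    G≡ u v u∈ v∈ = trans
      (A-cases u v (λ x → x * (z u * z v * gain′ u v) ≡ x * s u v + x * s v u)
        (λ _ → l₀ (z u * z v * gain′ u v) (s u v) (s v u))
        (λ p → l₁ (z u * z v * gain′ u v) (s u v) (s v u) (gain-split u v (zdw u (1≤d u v v∈ p)) (zdw v (1≤d′ u v u∈ p)))))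
      (cong (λ x → A u v * s u v + x * s v u) (A-sym u v))
      where
      l₀ : ∀ x y z → 0ℤ * x ≡ 0ℤ * y + 0ℤ * z
      l₀ = solve-∀
      l₁ : ∀ x y z → x ≡ y + z → 1ℤ * x ≡ 1ℤ * y + 1ℤ * z
      l₁ x y z e = trans (cong (1ℤ *_) e) (*-distribˡ-+ 1ℤ y z)

    -- Summed over the neighbours v of u, the terms S(u) - d(u)d(v) cancel, because the d(v) add up
    -- to S(u). In the remaining term `z u * (d u * w u)` is K, or 0 if u is isolated.
    ∑t≤ : ∀ u → ∑ all (t u) ≤ + 3 * q * q * (K * K * q - + 3 * M * (K * K) * d u)
    ∑t≤ u = ≤-trans (≤-reflexive row) (bound (z u * (d u * w u)) K≥)
      where
      c₁ c₂ : ℤ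
      c₁ = - (+ 160) * (M * M * M) * K * (z u * (d u * d u))
      c₂ = + 3 * q * q * (K * q * (z u * w u) - + 3 * M * (K * K))
      row : ∑ all (t u) ≡ + 3 * q * q * (K * q * (z u * (d u * w u)) - + 3 * M * (K * K) * d u)
      row = trans (∑-cong all λ v → l (A u v) (- (+ 160) * (M * M * M) * K) (z u * (d u * d u)) c₂ (S u) (d u) (d v)) (trans (∑-+ all _ _) (trans (cong₂ _+_ (∑-*ʳ all (c₁ * S u + c₂) (A u)) (∑-* all (- (c₁ * d u)) _))
          (l′ (z u) (w u) K q M (d u) (S u))))
        where
        l : ∀ A x y c₂ s a b → A * (x * (y * (s - a * b)) + c₂) ≡ A * (x * y * s + c₂) + - (x * y * a) * (A * b)
        l = solve-∀
        l′ : ∀ z w K q m d s →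
          d * (- (+ 160) * (m * m * m) * K * (z * (d * d)) * s + + 3 * q * q * (K * q * (z * w) - + 3 * m * (K * K))) + - (- (+ 160) * (m * m * m) * K * (z * (d * d)) * d) * s
          ≡ + 3 * q * q * (K * q * (z * (d * w)) - + 3 * m * (K * K) * d)
        l′ = solve-∀
      K≥ : z u * (d u * w u) ≤ K
      K≥ with d u ≟ 0ℤ
      ... | yes e = subst (λ x → z u * (x * w u) ≤ K) (sym e) (≤-trans (≤-reflexive (*-zeroʳ (z u))) (<⇒≤ 0<K))
      ... | no ne = ≤-reflexive (zdw u (0<⇒1≤ (≤∧≢⇒< (0≤deg all u) λ e → ne (sym e))))
      bound : ∀ x → x ≤ K → + 3 * q * q * (K * q * x - + 3 * M * (K * K) * d u) ≤ + 3 * q * q * (K * K * q - + 3 * M * (K * K) * d u)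
      bound x x≤K = ≤-slack _ (0≤* (0≤* (0≤* (0≤* (0≤+ℕ 3) (0≤Q all)) (0≤Q all)) (0≤* (<⇒≤ 0<K) (0≤Q all))) (≤⇒0≤- x≤K)) (l q K x (+ 3 * M * (K * K) * d u))
        where
        l : ∀ q K x y → + 3 * q * q * (K * K * q - y) - + 3 * q * q * (K * q * x - y) ≡ + 3 * q * q * (K * q) * (K - x)
        l = solve-∀

    -- The bounds of `∑t≤` cancel exactly: 3m vertices contribute K²q each, and 3MK² times the
    -- degree sum q is subtracted.
    ∑∑t≤0 : ∑ all (λ u → ∑ all (t u)) ≤ 0ℤ
    ∑∑t≤0 = ≤-trans (∑-mono all ∑t≤) (≤-reflexive (trans (∑-* all (+ 3 * q * q) _) (trans (cong (+ 3 * q * q *_)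
        (trans (∑-cong all λ u → l₀ (K * K * q) (+ 3 * M * (K * K)) (d u)) (trans (∑-+ all _ _) (cong₂ _+_ (trans (∑-const all (K * K * q)) (cong (_* (K * K * q)) (cong +_ len))) (∑-* all (- (+ 3 * M * (K * K))) d)))))
        (l M q K))))
      where
      l₀ : ∀ x y d → x - y * d ≡ x + - y * d
      l₀ = solve-∀
      l : ∀ m q K → + 3 * q * q * ((m + (m + m)) * (K * K * q) + - (+ 3 * m * (K * K)) * q) ≡ 0ℤ
      l = solve-∀

    ∑∑G≤0 : ∑ all (λ u → ∑ all (G u)) ≤ 0ℤ
    ∑∑G≤0 = ≤-trans (≤-reflexive (trans (∑-cong∈ all λ u u∈ → trans (∑-cong∈ all λ v v∈ → G≡ u v u∈ v∈) (∑-+ all _ _))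
        (trans (∑-+ all _ _) (cong (_+_ (∑ all (λ u → ∑ all (t u)))) (∑-swap all all (λ u v → t v u)))))) (+-mono-≤ ∑∑t≤0 ∑∑t≤0)

    A≤G : ∀ u v → u ∈ all → v ∈ all → + 4 * m⁷ M * A u v ≤ + 5 * G u v
    A≤G u v u∈ v∈ = A-cases u v (λ x → + 4 * m⁷ M * x ≤ + 5 * (x * (z u * z v * gain′ u v)))
        (λ _ → ≤-reflexive (l₀ (m⁷ M) (z u * z v * gain′ u v)))
        (λ p → combine (m⁷ M) (z u) (z v) (d u * d v) (gain′ u v) 0≤m⁷ (0≤z u) (0≤z v) (1≤zzab p) (OnEdge.edge-gain u v v∈ p))
      where
      0≤m⁷ : 0ℤ ≤ m⁷ M
      0≤m⁷ = 0≤* (0≤* (0≤* (0≤* (0≤* (0≤² M) (0≤+ℕ m)) (0≤+ℕ m)) (0≤+ℕ m)) (0≤+ℕ m)) (0≤+ℕ m)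
      l₀ : ∀ k g → + 4 * k * 0ℤ ≡ + 5 * (0ℤ * g)
      l₀ = solve-∀
      combine : ∀ k x y s g → 0ℤ ≤ k → 0ℤ ≤ x → 0ℤ ≤ y → 1ℤ ≤ x * y * s → + 4 * s * k ≤ + 5 * g → + 4 * k * 1ℤ ≤ + 5 * (1ℤ * (x * y * g))
      combine k x y s g 0≤k 0≤x 0≤y 1≤xys h = ≤-slack (+ 4 * k * (x * y * s - 1ℤ) + x * y * (+ 5 * g - + 4 * s * k))
          (0≤+ (0≤* (0≤* (0≤+ℕ 4) 0≤k) (≤⇒0≤- 1≤xys)) (0≤* (0≤* 0≤x 0≤y) (≤⇒0≤- h))) (l k x y s g)
        where
        l : ∀ k x y s g → + 5 * (1ℤ * (x * y * g)) - + 4 * k * 1ℤ ≡ + 4 * k * (x * y * s - 1ℤ) + x * y * (+ 5 * g - + 4 * s * k)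
        l = solve-∀
      -- Its product with another factor is K² > 0, so this nonnegative integer is not 0 and is
      -- therefore at least 1. Hence the weights do not diminish the margin of an edge.
      positive-product : ∀ x y a b f g → 0ℤ ≤ x → 0ℤ ≤ y → 0ℤ ≤ a → 0ℤ ≤ b → x * (a * f) ≡ K → y * (b * g) ≡ K → 1ℤ ≤ x * y * (a * b)
      positive-product x y a b f g 0≤x 0≤y 0≤a 0≤b e e′ = 0<⇒1≤ (≤∧≢⇒< (0≤* (0≤* 0≤x 0≤y) (0≤* 0≤a 0≤b)) λ 0≡ →
          <-irrefl (trans (sym (*-zeroˡ (f * g))) (trans (cong (_* (f * g)) 0≡) (trans (l x y a b f g) (cong₂ _*_ e e′)))) (0<* 0<K 0<K))
        where
        l : ∀ x y a b s t → x * y * (a * b) * (s * t) ≡ (x * (a * s)) * (y * (b * t))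
        l = solve-∀
      1≤zzab : adj u v ≡ true → 1ℤ ≤ z u * z v * (d u * d v)
      1≤zzab p = positive-product (z u) (z v) (d u) (d v) (w u) (w v) (0≤z u) (0≤z v) (0≤deg all u) (0≤deg all v)
        (zdw u (1≤d u v v∈ p)) (zdw v (1≤d′ u v u∈ p))

    -- Every edge has a weighted gain above a positive constant, yet by `∑∑G≤0` the total is at most
    -- 0. So there are no edges.
    q≤0 : q ≤ 0ℤ
    q≤0 = *-cancel-0< 0<4m⁷ (≤-trans (≤-reflexive (sym (trans (∑-cong all λ u → ∑-* all (+ 4 * m⁷ M) (A u)) (∑-* all (+ 4 * m⁷ M) d))))
        (≤-trans (∑-mono∈ all λ u u∈ → ∑-mono∈ all λ v v∈ → A≤G u v u∈ v∈)
          (≤-trans (≤-reflexive (trans (∑-cong all λ u → ∑-* all (+ 5) (G u)) (∑-* all (+ 5) _)))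
            (≤-trans (*-mono-0≤ (0≤+ℕ 5) ∑∑G≤0) (≤-reflexive (sym (*-zeroʳ (+ 4 * m⁷ M))))))))
      where
      0<4m⁷ : 0ℤ < + 4 * m⁷ M
      0<4m⁷ = 0<* {+ 4} (+<+ (ℕ.s≤s ℕ.z≤n)) (0<* (0<* (0<* (0<* (0<* (0<* 0<M 0<M) 0<M) 0<M) 0<M) 0<M) 0<M)

    -- A random partition into thirds retains at most a third of the edges on average, so D ≤ q / 3.
    -- Together with M² ≤ 2D this forbids the graph to be empty.
    M²≤q : + 3 * (M * M) ≤ + 2 * q
    M²≤q = *-cancel-0< (0<* {+ 3} (+<+ (ℕ.s≤s ℕ.z≤n)) (0<* 0<M 0<M)) (≤-slack _ (0≤+ (0≤* (0≤+ℕ 2) (≤⇒0≤- average)) (0≤* (0≤* (0≤+ℕ 9) (0≤² M)) (≤⇒0≤- M²≤2D))) (l′ M q D))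
      where
      average : (M + (M + M)) * (M + (M + M)) * D ≤ (M + (M + M)) * (M * 0ℤ + M * 0ℤ) + (M * M + M * M + M * M) * q
      average = subst (λ x → (M + (M + M)) * (M + (M + M)) * D ≤ (M + (M + M)) * (M * x + M * x) + (M * M + M * M + M * M) * q) (∑-0 all)
        (split₃-average all m m m len (ℕₚ.+-mono-≤ 1≤m 1≤m) (λ _ → 0ℤ) (λ _ → 0ℤ) D λ R T U a≋ lR lT lU →
          ≤-trans (D≤ R T U a≋ lR lT lU) (≤-reflexive (sym (trans (cong₂ (λ x y → x + y + (Q R + Q T + Q U)) (∑-0 R) (∑-0 T)) (+-identityˡ _)))))
      l′ : ∀ m q D → + 3 * (m * m) * (+ 2 * q) - + 3 * (m * m) * (+ 3 * (m * m))
        ≡ + 2 * ((m + (m + m)) * (m * 0ℤ + m * 0ℤ) + (m * m + m * m + m * m) * q - (m + (m + m)) * (m + (m + m)) * D) + + 9 * (m * m) * (+ 2 * D - m * m)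
      l′ = solve-∀

    sparse-contradiction : ⊥
    sparse-contradiction = <-irrefl refl (<-≤-trans (0<* {+ 3} (+<+ (ℕ.s≤s ℕ.z≤n)) (0<* 0<M 0<M)) (≤-trans M²≤q (*-mono-0≤ (0≤+ℕ 2) q≤0)))

  -- A vertex of degree at least m, and the extremal graphs

  module DenseThirds
    (m : ℕ) (1≤m : 1 ℕ.≤ m) (all : List V) (len : length all ≡ m ℕ.+ (m ℕ.+ m)) (all-∈ : ∀ v → v ∈ all) (D : ℤ)
    (D≤ : ∀ X Y Z → all ≋ X ++ (Y ++ Z) → length X ≡ m → length Y ≡ m → length Z ≡ m → D ≤ Q X + Q Y + Q Z) where

    M : ℤ
    M = + m

    Empty Full : List V → List V → Set
    Empty xs ys = ∀ {x y} → x ∈ xs → y ∈ ys → adj x y ≡ false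
    Full  xs ys = ∀ {x y} → x ∈ xs → y ∈ ys → adj x y ≡ true

    Empty-sym : ∀ {xs ys} → Empty xs ys → Empty ys xs
    Empty-sym e x∈ y∈ = trans (adj-sym _ _) (e y∈ x∈)

    Full-sym : ∀ {xs ys} → Full xs ys → Full ys xs
    Full-sym e x∈ y∈ = trans (adj-sym _ _) (e y∈ x∈)

    Empty-++ : ∀ {xs ys} → Empty xs xs → Empty ys ys → Empty xs ys → Empty (xs ++ ys) (xs ++ ys)
    Empty-++ {xs} exx eyy exy x∈ y∈ with ∈-++⁻ xs x∈ | ∈-++⁻ xs y∈
    ... | inj₁ p | inj₁ q = exx p q
    ... | inj₁ p | inj₂ q = exy p q
    ... | inj₂ p | inj₁ q = Empty-sym exy p q
    ... | inj₂ p | inj₂ q = eyy p q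

    E-empty : ∀ xs ys → Empty xs ys → E xs ys ≡ 0ℤ
    E-empty xs ys e = trans (∑-cong∈ xs λ x x∈ → trans (∑-cong∈ ys λ y y∈ → A-nonadj (e x∈ y∈)) (∑-0 ys)) (∑-0 xs)

    deg-empty : ∀ ys x → deg ys x ≤ 0ℤ → ∀ {y} → y ∈ ys → adj x y ≡ false
    deg-empty ys x d≤0 {y} y∈ with adj x y in p
    ... | false = refl
    ... | true  = ⊥-elim (≤-absurd (≤-trans (A≤deg ys x y y∈) d≤0) (subst (λ z → 1ℤ ≤ z - 0ℤ) (sym (A-adj p)) (0≤+ℕ-1)))
      where
      0≤+ℕ-1 : 1ℤ ≤ 1ℤ
      0≤+ℕ-1 = ≤-refl

    deg-nonempty : ∀ ys x → 0ℤ < deg ys x → Σ V λ y → y ∈ ys × adj x y ≡ true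
    deg-nonempty [] x (+<+ ())
    deg-nonempty (y ∷ ys) x 0<d with adj x y in p
    ... | true  = y , here refl , p
    ... | false with deg-nonempty ys x (subst (0ℤ <_) (+-identityˡ (deg ys x)) 0<d)
    ...   | z , z∈ , q = z , there z∈ , q

    Q-empty : ∀ xs → Q xs ≤ 0ℤ → Empty xs xs
    Q-empty xs Q≤0 {x} x∈ = deg-empty xs x (≤-trans (≤-reflexive (sym (∑-≡-split xs (λ _ → 0ℤ) (deg xs) (λ y _ → 0≤deg xs y) (subst (Q xs ≤_) (sym (∑-0 xs)) Q≤0) x x∈))) ≤-refl)

    deg-full : ∀ ys x → # ys ≤ deg ys x → ∀ {y} → y ∈ ys → adj x y ≡ true
    deg-full ys x d≥ {y} y∈ with adj x y in p
    ... | true  = refl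
    ... | false = ⊥-elim (0≢1 (trans (sym (A-nonadj p)) (∑-≡-split ys (A x) (λ _ → 1ℤ) (λ z _ → A≤1 x z) (subst (_≤ deg ys x) (sym (trans (∑-const ys 1ℤ) (*-identityʳ (# ys)))) d≥) y y∈)))
      where
      0≢1 : ¬ (0ℤ ≡ 1ℤ)
      0≢1 ()

    E-full : ∀ xs ys → # xs * # ys ≤ E xs ys → Full xs ys
    E-full xs ys E≥ {x} x∈ = deg-full ys x (≤-reflexive (sym (∑-≡-split xs (deg ys) (λ _ → # ys) (λ z _ → deg≤# ys z) (subst (_≤ E xs ys) (sym (∑-const xs (# ys))) E≥) x x∈)))

    E≤## : ∀ xs ys → E xs ys ≤ # xs * # ys
    E≤## xs ys = subst (E xs ys ≤_) (∑-const xs (# ys)) (∑-mono xs (deg≤# ys))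

    Q-++≥ : ∀ xs ys → Q xs + Q ys ≤ Q (xs ++ ys)
    Q-++≥ xs ys = ≤-slack _ (0≤* (0≤+ℕ 2) (0≤E xs ys)) (trans (cong (_- (Q xs + Q ys)) (Q-++ xs ys)) (l (Q xs) (Q ys) (E xs ys)))
      where
      l : ∀ a b e → a + + 2 * e + b - (a + b) ≡ + 2 * e
      l = solve-∀

    Q-part : ∀ {xs} ys zs → xs ≋ ys ++ zs → Q xs ≤ 0ℤ → Q ys ≤ 0ℤ × Q zs ≤ 0ℤ
    Q-part {xs} ys zs xs≋ Q≤0 = ≤-trans (≤-slack _ (0≤+ (0≤Q zs) (≤⇒0≤- total)) (l (Q ys) (Q zs))) ≤-refl
                              , ≤-slack _ (0≤+ (0≤Q ys) (≤⇒0≤- total)) (l′ (Q ys) (Q zs))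
      where
      total : Q ys + Q zs ≤ 0ℤ
      total = ≤-trans (Q-++≥ ys zs) (subst (_≤ 0ℤ) (Q-≋ xs≋) Q≤0)
      l : ∀ a b → 0ℤ - a ≡ b + (0ℤ - (a + b))
      l = solve-∀
      l′ : ∀ a b → 0ℤ - b ≡ a + (0ℤ - (a + b))
      l′ = solve-∀

    record Extremal : Set where
      field
        U W     : List V
        all≋    : all ≋ U ++ W
        U-empty : Empty U U
        W-empty : Empty W W
        UW-full : Full U W
        sizes   : (6 ℕ.* length U ≡ 5 ℕ.* (3 ℕ.* m)) ⊎ (2 ℕ.* length U ≡ 3 ℕ.* m)

    module Equality (A₁ A₂ A₃ : List V) (all≋ : all ≋ A₁ ++ (A₂ ++ A₃)) (l₁ : length A₁ ≡ m) (l₂ : length A₂ ≡ m) (l₃ : length A₃ ≡ m)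
                    (Q₁ : Q A₁ ≤ 0ℤ) (Q₂ : Q A₂ ≤ 0ℤ) (2D≡M² : + 2 * D ≡ M * M) where

      2Q≡ : + 2 * Q A₃ ≡ # A₃ * # A₃
      2Q≡ = ≤-antisym (Mantel.mantel A₃)
        (subst (λ z → z * z ≤ + 2 * Q A₃) (cong +_ (sym l₃)) (subst (_≤ + 2 * Q A₃) 2D≡M² (*-mono-0≤ (0≤+ℕ 2)
          (≤-trans (D≤ A₁ A₂ A₃ all≋ l₁ l₂ l₃) (≤-slack _ (0≤+ (≤⇒0≤- Q₁) (≤⇒0≤- Q₂)) (l (Q A₁) (Q A₂) (Q A₃)))))))
        where
        l : ∀ a b c → c - (a + b + c) ≡ (0ℤ - a) + (0ℤ - b)
        l = solve-∀

      regular : ∀ x → x ∈ A₃ → + 2 * deg A₃ x ≡ M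
      regular x x∈ = trans (Mantel.regular A₃ 2Q≡ x x∈) (cong +_ l₃)

      root : Σ V (_∈ A₃)
      root = go A₃ (subst (1 ℕ.≤_) (sym l₃) 1≤m)
        where
        go : ∀ xs → 1 ℕ.≤ length xs → Σ V (_∈ xs)
        go (x ∷ xs) _ = x , here refl

      x₀ : V
      x₀ = proj₁ root

      P O : List V
      P = nbrs x₀ A₃
      O = others x₀ A₃

      h : ℕ
      h = length P

      h+h : h ℕ.+ h ≡ m
      h+h = +-injective (trans (l (# P)) (trans (cong (+ 2 *_) (#nbrs x₀ A₃)) (regular x₀ (proj₂ root))))
        where
        l : ∀ x → x + x ≡ + 2 * x
        l = solve-∀

      lO : length O ≡ h
      lO = ℕₚ.+-cancelˡ-≡ h _ _ (trans (sym (length-++ P)) (trans (sym (≋-length (nbrs-others x₀ A₃))) (trans l₃ (sym h+h))))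

      1≤h : 1 ℕ.≤ h
      1≤h = go h h+h
        where
        go : ∀ h → h ℕ.+ h ≡ m → 1 ℕ.≤ h
        go zero    e = ⊥-elim (ℕₚ.<-irrefl e 1≤m)
        go (suc h) e = ℕ.s≤s ℕ.z≤n

      P-empty : Empty P P
      P-empty = Q-empty P (≤-reflexive (Q-nbrs x₀ A₃))

      -- By regularity a vertex of P has h neighbours in A₃. As P is independent, they all lie among
      -- the h vertices of O.
      PO-full : Full P O
      PO-full {y} y∈ = deg-full O y (≤-reflexive (trans (cong +_ lO) (sym (*-cancelˡ-≡′ (trans (cong (+ 2 *_) degO) (trans (regular y (proj₂ (∈-filterᵇ (adj x₀) A₃ y∈))) (sym (trans (l (+ h)) (cong +_ h+h)))))))))
        where
        l : ∀ x → + 2 * x ≡ x + x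
        l = solve-∀
        *-cancelˡ-≡′ : ∀ {x y} → + 2 * x ≡ + 2 * y → x ≡ y
        *-cancelˡ-≡′ e = ≤-antisym (*-cancel-0< {+ 2} (+<+ (ℕ.s≤s ℕ.z≤n)) (≤-reflexive e)) (*-cancel-0< {+ 2} (+<+ (ℕ.s≤s ℕ.z≤n)) (≤-reflexive (sym e)))
        degO : deg O y ≡ deg A₃ y
        degO = sym (trans (deg-≋ (nbrs-others x₀ A₃) y) (trans (deg-++ P O y) (trans (cong (_+ deg O y) (trans (∑-cong∈ P λ z z∈ → A-nonadj (P-empty y∈ z∈)) (∑-0 P))) (+-identityˡ _))))

      p₀ : Σ V (_∈ P)
      p₀ = go P 1≤h
        where
        go : ∀ xs → 1 ℕ.≤ length xs → Σ V (_∈ xs)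
        go (x ∷ xs) _ = x , here refl

      common-neighbour : ∀ {x y z} → adj x y ≡ true → adj x z ≡ true → adj y z ≡ false
      common-neighbour {x} {y} {z} p q with adj y z in r
      ... | false = refl
      ... | true  = ⊥-elim (no-triangle x y z (p , r , q))

      O-empty : Empty O O
      O-empty x∈ y∈ = common-neighbour (PO-full (proj₂ p₀) x∈) (PO-full (proj₂ p₀) y∈)

      H : ℤ
      H = + h

      M≡ : M ≡ H + H
      M≡ = sym (cong +_ h+h)

      D≡ : D ≡ + 2 * (H * H)
      D≡ = ≤-antisym (*-cancel-0< {+ 2} (+<+ (ℕ.s≤s ℕ.z≤n)) (≤-reflexive e)) (*-cancel-0< {+ 2} (+<+ (ℕ.s≤s ℕ.z≤n)) (≤-reflexive (sym e)))
        where
        l : ∀ h → (h + h) * (h + h) ≡ + 2 * (+ 2 * (h * h))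
        l = solve-∀
        e : + 2 * D ≡ + 2 * (+ 2 * (H * H))
        e = trans 2D≡M² (trans (cong (λ z → z * z) M≡) (l H))

      -- In the partition into B, R and T ∪ S only the edges between T and S count. They are counted
      -- twice by `Q`, and D = 2h².
      D≤cut : ∀ B R T S → all ≋ B ++ (R ++ (T ++ S)) → length B ≡ m → length R ≡ m → length (T ++ S) ≡ m →
        Q B ≤ 0ℤ → Q R ≤ 0ℤ → Q T ≤ 0ℤ → Q S ≤ 0ℤ → H * H ≤ E T S
      D≤cut B R T S a≋ lB lR lTS QB QR QT QS = *-cancel-0< {+ 2} (+<+ (ℕ.s≤s ℕ.z≤n)) (subst (_≤ + 2 * E T S) D≡
        (≤-trans (D≤ B R (T ++ S) a≋ lB lR lTS) (≤-slack _ (0≤+ (0≤+ (≤⇒0≤- QB) (≤⇒0≤- QR)) (0≤+ (≤⇒0≤- QT) (≤⇒0≤- QS)))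
          (trans (cong (λ z → + 2 * E T S - (Q B + Q R + z)) (Q-++ T S)) (l (Q B) (Q R) (Q T) (Q S) (E T S))))))
        where
        l : ∀ b r t s e → + 2 * e - (b + r + (t + + 2 * e + s)) ≡ ((0ℤ - b) + (0ℤ - r)) + ((0ℤ - t) + (0ℤ - s))
        l = solve-∀

      lTS : ∀ (T S : List V) → length T ≡ h → length S ≡ h → length (T ++ S) ≡ m
      lTS T S lT lS = trans (length-++ T) (trans (cong₂ ℕ._+_ lT lS) h+h)

      cut-full : ∀ T S → length T ≡ h → length S ≡ h → H * H ≤ E T S → Full T S
      cut-full T S lT lS E≥ = E-full T S (subst (_≤ E T S) (sym (cong₂ (λ a b → + a * + b) lT lS)) E≥)

      module Side (A B : List V) (all≋′ : all ≋ B ++ (A ++ A₃)) (lA : length A ≡ m) (lB : length B ≡ m) (QA : Q A ≤ 0ℤ) (QB : Q B ≤ 0ℤ) where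

        -- If the independent set U is too large, then D≤cut for the k superfluous vertices reads h² ≤ k (2h − k).
        excess : ∀ U W → A ++ A₃ ≋ U ++ W → Q U ≤ 0ℤ → Q W ≤ 0ℤ → m ℕ.≤ length U → length U ≡ m ℕ.+ h
        excess U W ≋UW QU QW m≤ = trans (sym m+k) (cong (m ℕ.+_) (+-injective k≡h))
          where
          k : ℕ
          k = length U ℕ.∸ m
          m+k : m ℕ.+ k ≡ length U
          m+k = ℕₚ.m+[n∸m]≡n m≤
          T R : List V
          T = take k U
          R = drop k U
          k≤ : k ℕ.≤ length U
          k≤ = ℕₚ.m∸n≤m (length U) m
          lT : length T ≡ k
          lT = trans (length-take k U) (ℕₚ.m≤n⇒m⊓n≡m k≤)
          lR : length R ≡ m
          lR = trans (length-drop k U) (ℕₚ.m∸[m∸n]≡n m≤)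
          total : length U ℕ.+ length W ≡ m ℕ.+ m
          total = trans (sym (length-++ U)) (trans (sym (≋-length ≋UW)) (trans (length-++ A) (cong₂ ℕ._+_ lA l₃)))
          lTW : length (T ++ W) ≡ m
          lTW = trans (length-++ T) (trans (cong (ℕ._+ length W) lT) (ℕₚ.+-cancelˡ-≡ m _ _ (trans (sym (ℕₚ.+-assoc m k _)) (trans (cong (ℕ._+ length W) m+k) total))))
          QTR : Q T ≤ 0ℤ × Q R ≤ 0ℤ
          QTR = Q-part T R (take-drop-≋ k U) QU
          a≋ : all ≋ B ++ (R ++ (T ++ W))
          a≋ = ≋-trans all≋′ (≋-++ (≋-refl {xs = B}) (≋-by λ f → trans (∑≡ ≋UW f) (trans (∑-++ U W f) (trans (cong (_+ ∑ W f) (trans (∑≡ (take-drop-≋ k U) f) (∑-++ T R f)))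
            (trans (l (∑ T f) (∑ R f) (∑ W f)) (sym (trans (∑-++ R _ f) (cong (_+_ (∑ R f)) (∑-++ T W f)))))))))
            where
            l : ∀ t r w → t + r + w ≡ r + (t + w)
            l = solve-∀
          #W : # W ≡ H + H - + k
          #W = trans (l (# W) (+ k)) (cong (_- + k) (trans (cong (λ z → + z + # W) (sym lT)) (trans (cong +_ (trans (sym (length-++ T)) lTW)) M≡)))
            where
            l : ∀ w k → w ≡ k + w - k
            l = solve-∀
          k≡h : + k ≡ H
          k≡h = balanced-cut (+ k) H (subst₂ (λ x y → H * H ≤ x * y) (cong +_ lT) #W
            (≤-trans (D≤cut B R T W a≋ lB lR lTW QB (proj₂ QTR) (proj₁ QTR) QW) (E≤## T W)))

        -- P takes the place of h vertices T of A: the parts are B, P ∪ R and T ∪ O, where P ∪ R is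
        -- independent because P has no edges to A. Then h² ≤ `E T O` leaves no pair between T and O
        -- nonadjacent, and any vertex of A can be put into such a T.
        module Fill (P O : List V) (A₃≋ : A₃ ≋ P ++ O) (lP : length P ≡ h) (lO : length O ≡ h) (eP : Empty P P) (eO : Empty O O) (ePA : Empty P A)
                    (T R : List V) (A≋ : A ≋ T ++ R) (lT : length T ≡ h) where
          lR : length R ≡ h
          lR = ℕₚ.+-cancelˡ-≡ h (length R) h (trans (cong (ℕ._+ length R) (sym lT)) (trans (sym (length-++ T)) (trans (sym (≋-length A≋)) (trans lA (sym h+h)))))
          arrange : ∀ f → ∑ A f + ∑ P f ≡ ∑ T f + ∑ (P ++ R) f
          arrange f = trans (cong (_+ ∑ P f) (trans (∑≡ A≋ f) (∑-++ T R f))) (trans (l (∑ T f) (∑ R f) (∑ P f)) (cong (_+_ (∑ T f)) (sym (∑-++ P R f))))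
            where
            l : ∀ t r p → t + r + p ≡ t + (p + r)
            l = solve-∀
          PA≋ : P ++ A ≋ T ++ (P ++ R)
          PA≋ = ≋-by λ f → trans (∑-++ P A f) (trans (+-comm (∑ P f) (∑ A f)) (trans (arrange f) (sym (∑-++ T (P ++ R) f))))
          PA-empty : Empty (P ++ A) (P ++ A)
          PA-empty = Empty-++ {P} {A} eP (Q-empty A QA) ePA
          QPA : Q (P ++ A) ≤ 0ℤ
          QPA = ≤-reflexive (E-empty (P ++ A) (P ++ A) PA-empty)
          QTR : Q T ≤ 0ℤ × Q (P ++ R) ≤ 0ℤ
          QTR = Q-part {P ++ A} T (P ++ R) PA≋ QPA
          QO : Q O ≤ 0ℤ
          QO = ≤-reflexive (E-empty O O eO)
          a≋ : all ≋ B ++ ((P ++ R) ++ (T ++ O))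
          a≋ = ≋-trans all≋′ (≋-++ (≋-refl {xs = B}) (≋-by λ f → trans (∑-++ A A₃ f) (trans (cong (_+_ (∑ A f)) (trans (∑≡ A₃≋ f) (∑-++ P O f)))
              (trans (sym (+-assoc (∑ A f) (∑ P f) (∑ O f))) (trans (cong (_+ ∑ O f) (arrange f)) (trans (l (∑ T f) (∑ (P ++ R) f) (∑ O f)) (sym (trans (∑-++ (P ++ R) (T ++ O) f) (cong (_+_ (∑ (P ++ R) f)) (∑-++ T O f))))))))))
            where
            l : ∀ t r w → t + r + w ≡ r + (t + w)
            l = solve-∀
          h²≤ : H * H ≤ E T O
          h²≤ = D≤cut B (P ++ R) T O a≋ lB (lTS P R lP lR) (lTS T O lT lO) QB (proj₂ QTR) (proj₁ QTR) QO
          T-full : Full T O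
          T-full = cut-full T O lT lO h²≤

        h≤A : h ℕ.≤ length A
        h≤A = subst (h ℕ.≤_) (trans h+h (sym lA)) (ℕₚ.m≤m+n h h)

        full : ∀ P O → A₃ ≋ P ++ O → length P ≡ h → length O ≡ h → Empty P P → Empty O O → Empty P A → Full A O
        full P O A₃≋ lP lO eP eO ePA x∈ = go (subset-containing A h x∈ 1≤h h≤A)
          where
          go : Σ (List V) (λ T → Σ (List V) λ R → A ≋ T ++ R × length T ≡ h × _ ∈ T) → _
          go (T , R , A≋ , lT , x∈T) = Fill.T-full P O A₃≋ lP lO eP eO ePA T R A≋ lT x∈T

        -- A vertex of A adjacent to some member of P has no neighbour in O, since P and O are
        -- completely joined. Hence U and W below are independent sets that share out the 2m
        -- vertices of A and A₃.
        near-P : V → Bool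
        near-P x = does (0ℤ <? deg P x)

        A^P A^O U W : List V
        A^P = filterᵇ near-P A
        A^O = filterᵇ (λ x → not (near-P x)) A
        U = P ++ A^O
        W = O ++ A^P

        far : ∀ {x} → near-P x ≡ false → ∀ {y} → y ∈ P → adj x y ≡ false
        far {x} e with 0ℤ <? deg P x
        ... | no ¬p = deg-empty P x (≮⇒≥ ¬p)

        near : ∀ {x} → near-P x ≡ true → ∀ {y} → y ∈ O → adj x y ≡ false
        near {x} e y∈ with 0ℤ <? deg P x
        ... | yes p with deg-nonempty P x p
        ...   | z , z∈ , x∼z = common-neighbour (trans (adj-sym z x) x∼z) (PO-full z∈ y∈)

        A-empty : Empty A A
        A-empty = Q-empty A QA

        U-empty : Empty U U
        U-empty = Empty-++ {P} {A^O} P-empty (λ x∈ y∈ → A-empty (proj₂ (∈-filterᵇ _ A x∈)) (proj₂ (∈-filterᵇ _ A y∈)))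
          (λ x∈ y∈ → trans (adj-sym _ _) (far (not-true (proj₁ (∈-filterᵇ _ A y∈))) x∈))
          where
          not-true : ∀ {b} → not b ≡ true → b ≡ false
          not-true {false} _ = refl

        W-empty : Empty W W
        W-empty = Empty-++ {O} {A^P} O-empty (λ x∈ y∈ → A-empty (proj₂ (∈-filterᵇ _ A x∈)) (proj₂ (∈-filterᵇ _ A y∈)))
          (λ x∈ y∈ → trans (adj-sym _ _) (near (proj₁ (∈-filterᵇ near-P A y∈)) x∈))

        ≋UW : A ++ A₃ ≋ U ++ W
        ≋UW = ≋-by λ f → trans (∑-++ A A₃ f) (trans (cong₂ _+_ (trans (∑≡ (filter-≋ near-P A) f) (∑-++ A^P A^O f)) (trans (∑≡ (nbrs-others x₀ A₃) f) (∑-++ P O f)))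
          (trans (l (∑ A^P f) (∑ A^O f) (∑ P f) (∑ O f)) (sym (trans (∑-++ U W f) (cong₂ _+_ (∑-++ P A^O f) (∑-++ O A^P f))))))
          where
          l : ∀ a b c d → a + b + (c + d) ≡ c + b + (d + a)
          l = solve-∀

        total : length A^P ℕ.+ length A^O ≡ m
        total = trans (sym (length-++ A^P)) (trans (sym (≋-length (filter-≋ near-P A))) lA)

        vanishes : ∀ {a b n} → n ≡ h → n ℕ.+ b ≡ m ℕ.+ h → a ℕ.+ b ≡ m → a ≡ 0
        vanishes {a} {b} refl e e′ = ℕₚ.+-cancelʳ-≡ b a 0 (trans e′ (sym (ℕₚ.+-cancelˡ-≡ h _ _ (trans e (ℕₚ.+-comm m h)))))

        never : ∀ (p : V → Bool) xs → length (filterᵇ p xs) ≡ 0 → ∀ {x} → x ∈ xs → p x ≡ false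
        never p xs e {x} x∈ with p x in px
        ... | false = refl
        ... | true  = ⊥-elim (none (filterᵇ p xs) e (filterᵇ-∈ p xs x∈ px))
          where
          none : ∀ ys → length ys ≡ 0 → ¬ (x ∈ ys)
          none [] _ ()

        -- One of U and W has at least m of the 2m vertices, hence by `excess` exactly m + h. As it
        -- contains only h vertices of A₃, it contains all of A, which is therefore not joined to
        -- that side of A₃.
        side : (Empty P A × Full A O) ⊎ (Empty O A × Full A P)
        side with ℕₚ.≤-total m (length U)
        ... | inj₁ m≤ = inj₁ (ePA , full P O (nbrs-others x₀ A₃) refl lO P-empty O-empty ePA)
          where
          lAP : length A^P ≡ 0
          lAP = vanishes {b = length A^O} {n = length P} refl (trans (sym (length-++ P)) (excess U W ≋UW (≤-reflexive (E-empty U U U-empty)) (≤-reflexive (E-empty W W W-empty)) m≤)) total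
          ePA : Empty P A
          ePA x∈ y∈ = trans (adj-sym _ _) (far (never near-P A lAP y∈) x∈)
        ... | inj₂ ≤m = inj₂ (eOA , full O P (≋-trans (nbrs-others x₀ A₃) (≋-comm P O)) lO refl O-empty P-empty eOA)
          where
          m≤W : m ℕ.≤ length W
          m≤W = ℕₚ.+-cancelˡ-≤ (length U) _ _ (ℕₚ.≤-trans (ℕₚ.+-monoˡ-≤ m ≤m) (ℕₚ.≤-reflexive (sym (trans (sym (length-++ U)) (trans (sym (≋-length ≋UW)) (trans (length-++ A) (cong₂ ℕ._+_ lA l₃)))))))
          lAO : length A^O ≡ 0
          lAO = vanishes {b = length A^P} {n = length O} lO (trans (sym (length-++ O)) (excess W U (≋-trans ≋UW (≋-comm U W)) (≤-reflexive (E-empty W W W-empty)) (≤-reflexive (E-empty U U U-empty)) m≤W))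
            (trans (ℕₚ.+-comm (length A^O) _) total)
          eOA : Empty O A
          eOA x∈ y∈ = trans (adj-sym _ _) (near (not-false (never (λ x → not (near-P x)) A lAO y∈)) x∈)
            where
            not-false : ∀ {b} → not b ≡ false → b ≡ true
            not-false {true} _ = refl

      member : ∀ (xs : List V) → length xs ≡ h → Σ V (_∈ xs)
      member []       e = ⊥-elim (ℕₚ.<-irrefl e 1≤h)
      member (x ∷ xs) e = x , here refl

      A₂₁₃ : all ≋ A₂ ++ (A₁ ++ A₃)
      A₂₁₃ = ≋-by λ f → trans (∑≡ all≋ f) (trans (∑-++ A₁ _ f) (trans (cong (_+_ (∑ A₁ f)) (∑-++ A₂ A₃ f)) (trans (l (∑ A₁ f) (∑ A₂ f) (∑ A₃ f))
          (sym (trans (∑-++ A₂ _ f) (cong (_+_ (∑ A₂ f)) (∑-++ A₁ A₃ f)))))))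
        where
        l : ∀ a b c → a + (b + c) ≡ b + (a + c)
        l = solve-∀

      module Combine (P O : List V) (A₃≋ : A₃ ≋ P ++ O) (lP : length P ≡ h) (lO : length O ≡ h)
                     (eP : Empty P P) (eO : Empty O O) (fPO : Full P O) where

        -- A₁ and A₂ are both completely joined to O, so a common neighbour rules out edges between
        -- them. The graph is K(5h, h), with h on the side of O.
        same-side : Empty P A₁ → Full A₁ O → Empty P A₂ → Full A₂ O → Extremal
        same-side e₁ f₁ e₂ f₂ = record
          { U = P ++ (A₁ ++ A₂) ; W = O ; all≋ = a≋
          ; U-empty = Empty-++ {P} {A₁ ++ A₂} eP (Empty-++ {A₁} {A₂} (Q-empty A₁ Q₁) (Q-empty A₂ Q₂)
              (λ x∈ y∈ → common-neighbour (trans (adj-sym _ _) (f₁ x∈ (proj₂ (member O lO)))) (trans (adj-sym _ _) (f₂ y∈ (proj₂ (member O lO))))))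
              empty
          ; W-empty = eO ; UW-full = λ x∈ y∈ → full x∈ y∈ ; sizes = inj₁ size }
          where
          a≋ : all ≋ (P ++ (A₁ ++ A₂)) ++ O
          a≋ = ≋-by λ f → trans (∑≡ all≋ f) (trans (∑-++ A₁ _ f) (trans (cong (_+_ (∑ A₁ f)) (trans (∑-++ A₂ A₃ f) (cong (_+_ (∑ A₂ f)) (trans (∑≡ A₃≋ f) (∑-++ P O f)))))
              (trans (l (∑ A₁ f) (∑ A₂ f) (∑ P f) (∑ O f)) (sym (trans (∑-++ (P ++ (A₁ ++ A₂)) O f) (cong (_+ ∑ O f) (trans (∑-++ P (A₁ ++ A₂) f) (cong (_+_ (∑ P f)) (∑-++ A₁ A₂ f)))))))))
            where
            l : ∀ a b p o → a + (b + (p + o)) ≡ p + (a + b) + o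
            l = solve-∀
          empty : Empty P (A₁ ++ A₂)
          empty x∈ y∈ with ∈-++⁻ A₁ y∈
          ... | inj₁ p = e₁ x∈ p
          ... | inj₂ p = e₂ x∈ p
          full : Full (P ++ (A₁ ++ A₂)) O
          full x∈ y∈ with ∈-++⁻ P x∈
          ... | inj₁ p = fPO p y∈
          ... | inj₂ p with ∈-++⁻ A₁ p
          ...   | inj₁ r = f₁ r y∈
          ...   | inj₂ r = f₂ r y∈
          size : 6 ℕ.* length (P ++ (A₁ ++ A₂)) ≡ 5 ℕ.* (3 ℕ.* m)
          size = trans (cong (6 ℕ.*_) (trans (length-++ P) (cong₂ ℕ._+_ lP (trans (length-++ A₁) (cong₂ ℕ._+_ l₁ l₂)))))
              (subst (λ n → 6 ℕ.* (h ℕ.+ (n ℕ.+ n)) ≡ 5 ℕ.* (3 ℕ.* n)) h+h (l h))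
            where
            l : ∀ h → 6 ℕ.* (h ℕ.+ ((h ℕ.+ h) ℕ.+ (h ℕ.+ h))) ≡ 5 ℕ.* (3 ℕ.* (h ℕ.+ h))
            l = ℕ-Solver.solve-∀

        module Opposite (e₁ : Empty P A₁) (e₂ : Empty O A₂) where

          U W : List V
          U = P ++ A₁
          W = O ++ A₂

          eU : Empty U U
          eU = Empty-++ {P} {A₁} eP (Q-empty A₁ Q₁) e₁
          eW : Empty W W
          eW = Empty-++ {O} {A₂} eO (Q-empty A₂ Q₂) e₂

          lU : length U ≡ h ℕ.+ m
          lU = trans (length-++ P) (cong₂ ℕ._+_ lP l₁)
          lW : length W ≡ h ℕ.+ m
          lW = trans (length-++ O) (cong₂ ℕ._+_ lO l₂)

          a≋ : all ≋ U ++ W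
          a≋ = ≋-by λ f → trans (∑≡ all≋ f) (trans (∑-++ A₁ _ f) (trans (cong (_+_ (∑ A₁ f)) (trans (∑-++ A₂ A₃ f) (cong (_+_ (∑ A₂ f)) (trans (∑≡ A₃≋ f) (∑-++ P O f)))))
              (trans (l (∑ A₁ f) (∑ A₂ f) (∑ P f) (∑ O f)) (sym (trans (∑-++ U W f) (cong₂ _+_ (∑-++ P A₁ f) (∑-++ O A₂ f)))))))
            where
            l : ∀ a b p o → a + (b + (p + o)) ≡ (p + a) + (o + b)
            l = solve-∀

          module Fill (T R : List V) (U≋ : U ≋ T ++ R) (lT : length T ≡ h) (S R′ : List V) (W≋ : W ≋ S ++ R′) (lS : length S ≡ h) where
            remainder : ∀ (X Y Z : List V) → X ≋ Y ++ Z → length Y ≡ h → length X ≡ h ℕ.+ m → length Z ≡ m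
            remainder X Y Z X≋ lY lX = ℕₚ.+-cancelˡ-≡ h (length Z) m (trans (cong (ℕ._+ length Z) (sym lY)) (trans (sym (length-++ Y)) (trans (sym (≋-length X≋)) lX)))
            QU : Q T ≤ 0ℤ × Q R ≤ 0ℤ
            QU = Q-part {U} T R U≋ (≤-reflexive (E-empty U U eU))
            QW : Q S ≤ 0ℤ × Q R′ ≤ 0ℤ
            QW = Q-part {W} S R′ W≋ (≤-reflexive (E-empty W W eW))
            a≋′ : all ≋ R ++ (R′ ++ (T ++ S))
            a≋′ = ≋-by λ f → trans (∑≡ a≋ f) (trans (∑-++ U W f) (trans (cong₂ _+_ (trans (∑≡ U≋ f) (∑-++ T R f)) (trans (∑≡ W≋ f) (∑-++ S R′ f)))
                (trans (l (∑ T f) (∑ R f) (∑ S f) (∑ R′ f)) (sym (trans (∑-++ R _ f) (cong (_+_ (∑ R f)) (trans (∑-++ R′ _ f) (cong (_+_ (∑ R′ f)) (∑-++ T S f)))))))))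
              where
              l : ∀ t r s q → (t + r) + (s + q) ≡ r + (q + (t + s))
              l = solve-∀
            TS-full : Full T S
            TS-full = cut-full T S lT lS (D≤cut R R′ T S a≋′ (remainder U T R U≋ lT lU) (remainder W S R′ W≋ lS lW) (lTS T S lT lS) (proj₂ QU) (proj₂ QW) (proj₁ QU) (proj₁ QW))

          h≤ : ∀ {n} → n ≡ h ℕ.+ m → h ℕ.≤ n
          h≤ e = subst (h ℕ.≤_) (sym e) (ℕₚ.m≤m+n h m)

          -- The given vertices are put into h-subsets T of U and S of W. What remains of U and of W
          -- are two independent parts of size m, so `D≤cut` makes T and S completely joined. This
          -- also yields the edges between A₁ and A₂, about which the two applications of `side` say
          -- nothing.
          UW-full : Full U W
          UW-full {x} {y} x∈ y∈ = go (subset-containing U h x∈ 1≤h (h≤ lU)) (subset-containing W h y∈ 1≤h (h≤ lW))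
            where
            go : Σ (List V) (λ T → Σ (List V) λ R → U ≋ T ++ R × length T ≡ h × x ∈ T) →
                 Σ (List V) (λ S → Σ (List V) λ R′ → W ≋ S ++ R′ × length S ≡ h × y ∈ S) → adj x y ≡ true
            go (T , R , U≋ , lT , x∈T) (S , R′ , W≋ , lS , y∈S) = Fill.TS-full T R U≋ lT S R′ W≋ lS x∈T y∈S

          opposite-sides : Extremal
          opposite-sides = record { U = U ; W = W ; all≋ = a≋ ; U-empty = eU ; W-empty = eW ; UW-full = UW-full ; sizes = inj₂ size }
            where
            size : 2 ℕ.* length U ≡ 3 ℕ.* m
            size = trans (cong (2 ℕ.*_) lU) (subst (λ n → 2 ℕ.* (h ℕ.+ n) ≡ 3 ℕ.* n) h+h (l h))
              where
              l : ∀ h → 2 ℕ.* (h ℕ.+ (h ℕ.+ h)) ≡ 3 ℕ.* (h ℕ.+ h)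
              l = ℕ-Solver.solve-∀

      extremal : Extremal
      extremal = combine (Side.side A₁ A₂ A₂₁₃ l₁ l₂ Q₁ Q₂) (Side.side A₂ A₁ all≋ l₂ l₁ Q₂ Q₁)
        where
        combine : (Empty P A₁ × Full A₁ O) ⊎ (Empty O A₁ × Full A₁ P) → (Empty P A₂ × Full A₂ O) ⊎ (Empty O A₂ × Full A₂ P) → Extremal
        combine (inj₁ (e₁ , f₁)) (inj₁ (e₂ , f₂)) = Combine.same-side P O (nbrs-others x₀ A₃) refl lO P-empty O-empty PO-full e₁ f₁ e₂ f₂
        combine (inj₁ (e₁ , f₁)) (inj₂ (e₂ , f₂)) = Combine.Opposite.opposite-sides P O (nbrs-others x₀ A₃) refl lO P-empty O-empty PO-full e₁ e₂
        combine (inj₂ (e₁ , f₁)) (inj₁ (e₂ , f₂)) = Combine.Opposite.opposite-sides O P (≋-trans (nbrs-others x₀ A₃) (≋-comm P O)) lO refl O-empty P-empty (Full-sym {P} {O} PO-full) e₁ e₂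
        combine (inj₂ (e₁ , f₁)) (inj₂ (e₂ , f₂)) = Combine.same-side O P (≋-trans (nbrs-others x₀ A₃) (≋-comm P O)) lO refl O-empty P-empty (Full-sym {P} {O} PO-full) e₁ f₁ e₂ f₂

    search : ∀ Y xs → (Σ V λ v → M ≤ deg Y v) ⊎ (∀ v → v ∈ xs → deg Y v ≤ M - 1ℤ)
    search Y [] = inj₂ λ _ ()
    search Y (x ∷ xs) with M ≤? deg Y x
    ... | yes p = inj₁ (x , p)
    ... | no ¬p with search Y xs
    ...   | inj₁ r = inj₁ r
    ...   | inj₂ r = inj₂ λ { v (here refl) → ≤-slack _ (≤⇒0≤- (i<j⇒suc[i]≤j (≰⇒> ¬p))) (l M (deg Y x)) ; v (there v∈) → r v v∈ }
      where
      l : ∀ m d → m - 1ℤ - d ≡ m - (1ℤ + d)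
      l = solve-∀

    star : ∀ Y v n → length Y ≡ m ℕ.+ n → M ≤ deg Y v →
      Σ (List V) λ A′ → Σ (List V) λ R → Y ≋ A′ ++ R × length A′ ≡ m × length R ≡ n × Q A′ ≤ 0ℤ
    star Y v n lY M≤ = A′ , R , Y≋ , lA , lR , proj₁ (Q-part A′ (drop m (nbrs v Y)) (take-drop-≋ m (nbrs v Y)) (≤-reflexive (Q-nbrs v Y)))
      where
      A′ R : List V
      A′ = take m (nbrs v Y)
      R  = drop m (nbrs v Y) ++ others v Y
      Y≋ : Y ≋ A′ ++ R
      Y≋ = ≋-trans (nbrs-others v Y) (≋-trans (≋-++ (take-drop-≋ m (nbrs v Y)) (≋-refl {xs = others v Y})) (≋-assoc A′ (drop m (nbrs v Y)) (others v Y)))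
      lA : length A′ ≡ m
      lA = trans (length-take m (nbrs v Y)) (ℕₚ.m≤n⇒m⊓n≡m (drop‿+≤+ (subst (M ≤_) (sym (#nbrs v Y)) M≤)))
      lR : length R ≡ n
      lR = ℕₚ.+-cancelˡ-≡ m (length R) n (trans (cong (ℕ._+ length R) (sym lA)) (trans (sym (length-++ A′)) (trans (sym (≋-length Y≋)) lY)))

    -- Whenever one of the two searches for a vertex of degree at least m fails, the inequality is
    -- strict. Only after two successful searches does an equality case have to be analysed.
    bound : (+ 2 * D < M * M) ⊎ (+ 2 * D ≤ M * M × (+ 2 * D ≡ M * M → Extremal))
    bound with search all all
    ... | inj₂ small = inj₁ (≰⇒> λ M²≤2D →
            Thirds.sparse-contradiction m 1≤m all len D D≤ (λ v → small v (all-∈ v)) M²≤2D)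
    ... | inj₁ (v , M≤) = first (star all v (m ℕ.+ m) len M≤)
      where
      first : Σ (List V) (λ A₁ → Σ (List V) λ R → all ≋ A₁ ++ R × length A₁ ≡ m × length R ≡ m ℕ.+ m × Q A₁ ≤ 0ℤ) →
              (+ 2 * D < M * M) ⊎ (+ 2 * D ≤ M * M × (+ 2 * D ≡ M * M → Extremal))
      first (A₁ , R , all≋ , l₁ , lR , Q₁) = go (search R R)
        where
        halve : ∀ X Y → R ≋ X ++ Y → length X ≡ m → length Y ≡ m → D ≤ Q X + Q Y
        halve X Y R≋ lX lY = ≤-trans (D≤ A₁ X Y (≋-trans all≋ (≋-++ (≋-refl {xs = A₁}) R≋)) l₁ lX lY) (≤-slack _ (≤⇒0≤- Q₁) (l (Q A₁) (Q X) (Q Y)))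
          where
          l : ∀ a x y → x + y - (a + x + y) ≡ 0ℤ - a
          l = solve-∀
        go : (Σ V λ v → M ≤ deg R v) ⊎ (∀ v → v ∈ R → deg R v ≤ M - 1ℤ) → (+ 2 * D < M * M) ⊎ (+ 2 * D ≤ M * M × (+ 2 * D ≡ M * M → Extremal))
        go (inj₂ small) = inj₁ (Halves.SmallDegrees.quarter m 1≤m R lR D halve small)
        go (inj₁ (w , M≤w)) = second (star R w m lR M≤w)
          where
          second : Σ (List V) (λ A₂ → Σ (List V) λ A₃ → R ≋ A₂ ++ A₃ × length A₂ ≡ m × length A₃ ≡ m × Q A₂ ≤ 0ℤ) →
                   (+ 2 * D < M * M) ⊎ (+ 2 * D ≤ M * M × (+ 2 * D ≡ M * M → Extremal))
          second (A₂ , A₃ , R≋ , l₂ , l₃ , Q₂) = inj₂ (≤-trans (*-mono-0≤ (0≤+ℕ 2) D≤Q₃) 2Q≤ ,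
              Equality.extremal A₁ A₂ A₃ (≋-trans all≋ (≋-++ (≋-refl {xs = A₁}) R≋)) l₁ l₂ l₃ Q₁ Q₂)
            where
            D≤Q₃ : D ≤ Q A₃
            D≤Q₃ = ≤-trans (halve A₂ A₃ R≋ l₂ l₃) (≤-slack _ (≤⇒0≤- Q₂) (l (Q A₂) (Q A₃)))
              where
              l : ∀ a x → x - (a + x) ≡ 0ℤ - a
              l = solve-∀
            2Q≤ : + 2 * Q A₃ ≤ M * M
            2Q≤ = subst (λ z → + 2 * Q A₃ ≤ z * z) (cong +_ l₃) (Mantel.mantel A₃)

-- Partitions of Fin n

𝟙 : Bool → ℤ
𝟙 b = if b then 1ℤ else 0ℤ

#-filter : ∀ {V : Set} (p : V → Bool) xs → # (filterᵇ p xs) ≡ ∑ xs (λ x → 𝟙 (p x))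
#-filter p []       = refl
#-filter p (x ∷ xs) with p x
... | true  = cong (_+_ 1ℤ) (#-filter p xs)
... | false = trans (#-filter p xs) (sym (+-identityˡ _))

+-sum : ∀ {V : Set} (f : V → ℕ) xs → + sum (map f xs) ≡ ∑ xs (λ x → + f x)
+-sum f []       = refl
+-sum f (x ∷ xs) = cong (_+_ (+ f x)) (+-sum f xs)

filterᵇ-cong : ∀ {V : Set} {p q : V → Bool} → (∀ x → p x ≡ q x) → ∀ xs → length (filterᵇ p xs) ≡ length (filterᵇ q xs)
filterᵇ-cong {p = p} {q} e xs = +-injective (trans (#-filter p xs) (trans (∑-cong xs λ x → cong 𝟙 (e x)) (sym (#-filter q xs))))

∑-tabulate-single : ∀ {V : Set} {n} (g : Fin n → V) (F : V → ℤ) w → (∀ v → v ≢ w → F (g v) ≡ 0ℤ) → ∑ (tabulate g) F ≡ F (g w)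
∑-tabulate-single {V} g F zero h = trans (cong (_+_ (F (g zero))) (vanish (λ v → g (suc v)) (λ v → h (suc v) λ ()))) (+-identityʳ _)
  where
  vanish : ∀ {n} (g : Fin n → V) → (∀ v → F (g v) ≡ 0ℤ) → ∑ (tabulate g) F ≡ 0ℤ
  vanish {zero}  g h = refl
  vanish {suc n} g h = cong₂ _+_ (h zero) (vanish (λ v → g (suc v)) (λ v → h (suc v)))
∑-tabulate-single g F (suc w) h = trans (cong₂ _+_ (h zero λ ()) (∑-tabulate-single (λ v → g (suc v)) F w (λ v v≢ → h (suc v) λ e → v≢ (Finₚ.suc-injective e)))) (+-identityˡ _)

count : ∀ n → (Fin n → Bool) → ℕ
count zero    c = 0
count (suc n) c with c zero
... | true  = suc (count n (λ i → c (suc i)))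
... | false = count n (λ i → c (suc i))

count≤ : ∀ n c → count n c ℕ.≤ n
count≤ zero    c = ℕ.z≤n
count≤ (suc n) c with c zero
... | true  = ℕ.s≤s (count≤ n _)
... | false = ℕₚ.m≤n⇒m≤1+n (count≤ n _)

count-filter : ∀ {V : Set} n (g : Fin n → V) (p : V → Bool) → length (filterᵇ p (tabulate g)) ≡ count n (λ i → p (g i))
count-filter zero    g p = refl
count-filter (suc n) g p with p (g zero)
... | true  = cong suc (count-filter n (λ i → g (suc i)) p)
... | false = count-filter n (λ i → g (suc i)) p

toℕ-punchIn-fromℕ : ∀ {n} (k : Fin n) → toℕ (punchIn (fromℕ n) k) ≡ toℕ k
toℕ-punchIn-fromℕ zero    = refl
toℕ-punchIn-fromℕ (suc k) = cong suc (toℕ-punchIn-fromℕ k)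

≤⇒≮ᵇ : ∀ {a b} → a ℕ.≤ b → (b ℕ.<ᵇ a) ≡ false
≤⇒≮ᵇ {zero}  {zero}  _           = refl
≤⇒≮ᵇ {zero}  {suc b} _           = refl
≤⇒≮ᵇ {suc a} {suc b} (ℕ.s≤s a≤b) = ≤⇒≮ᵇ a≤b

<⇒<ᵇ≡ : ∀ {a b} → a ℕ.< b → (a ℕ.<ᵇ b) ≡ true
<⇒<ᵇ≡ {zero}  {suc b} _         = refl
<⇒<ᵇ≡ {suc a} {suc b} (ℕ.s≤s p) = <⇒<ᵇ≡ p

-- Brings the vertices satisfying c to the front, where `KBip` expects its first class: the head is
-- inserted at position 0 if it satisfies c and at the last position otherwise.
sort : ∀ n (c : Fin n → Bool) → Σ (Permutation n n) λ σ → ∀ i → (toℕ (σ ⟨$⟩ʳ i) ℕ.<ᵇ count n c) ≡ c i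
sort zero    c = idₚ , λ ()
sort (suc n) c with c zero in e | sort n (λ i → c (suc i))
... | true  | σ , h = insert zero zero σ , λ
  { zero    → sym e
  ; (suc i) → trans (cong (λ k → toℕ k ℕ.<ᵇ suc (count n (λ i → c (suc i)))) (insert-punchIn zero zero σ i)) (h i) }
... | false | σ , h = insert zero (fromℕ n) σ , λ
  { zero    → trans (cong (ℕ._<ᵇ count n (λ i → c (suc i))) (Finₚ.toℕ-fromℕ n)) (trans (≤⇒≮ᵇ (count≤ n _)) (sym e))
  ; (suc i) → trans (cong (λ k → toℕ k ℕ.<ᵇ count n (λ i → c (suc i))) (insert-punchIn zero (fromℕ n) σ i))
                (trans (cong (ℕ._<ᵇ count n (λ i → c (suc i))) (toℕ-punchIn-fromℕ (σ ⟨$⟩ʳ i))) (h i)) }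

module _ {n : ℕ} (G : Graph n) (tf : TriangleFree G) where

  open TriangleFreeGraph (adj G) (Graph.sym G) (irref G) tf

  all : List (Fin n)
  all = allFin n

  δ : Fin n → Fin n → ℤ
  δ v w = 𝟙 ⌊ v ≟ᶠ w ⌋

  0≤δ : ∀ v w → 0ℤ ≤ δ v w
  0≤δ v w with v ≟ᶠ w
  ... | yes _ = 0≤+ℕ 1
  ... | no _  = ≤-refl

  -- The multiplicity of v in the list. Through it `≋`, which only speaks of sums, determines a
  -- class for each vertex: the multiplicities in the three parts add up to 1.
  χ : List (Fin n) → Fin n → ℤ
  χ xs v = ∑ xs (δ v)

  ∑-δ : ∀ w (f : Fin n → ℤ) → ∑ all (λ v → δ v w * f v) ≡ f w
  ∑-δ w f = trans (∑-tabulate-single (λ v → v) (λ v → δ v w * f v) w off) (on w)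
    where
    off : ∀ v → v ≢ w → δ v w * f v ≡ 0ℤ
    off v v≢w with v ≟ᶠ w
    ... | yes e = ⊥-elim (v≢w e)
    ... | no _  = refl
    on : ∀ w → δ w w * f w ≡ f w
    on w with w ≟ᶠ w
    ... | yes _ = *-identityˡ (f w)
    ... | no w≢ = ⊥-elim (w≢ refl)

  ∑-χ : ∀ xs (f : Fin n → ℤ) → ∑ xs f ≡ ∑ all (λ v → χ xs v * f v)
  ∑-χ xs f = trans (∑-cong xs λ w → sym (∑-δ w f)) (trans (∑-swap xs all _) (∑-cong all λ v → ∑-*ʳ xs (f v) (δ v)))

  χ-all : ∀ v → χ all v ≡ 1ℤ
  χ-all v = trans (∑-cong all λ w → l (δ v w) (flip w)) (∑-δ v (λ _ → 1ℤ))
    where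
    flip : ∀ w → δ v w ≡ δ w v
    flip w with v ≟ᶠ w | w ≟ᶠ v
    ... | yes _ | yes _ = refl
    ... | no _  | no _  = refl
    ... | yes e | no ¬e = ⊥-elim (¬e (sym e))
    ... | no ¬e | yes e = ⊥-elim (¬e (sym e))
    l : ∀ x {y} → x ≡ y → x ≡ y * 1ℤ
    l x refl = sym (*-identityʳ x)

  0≤χ : ∀ xs v → 0ℤ ≤ χ xs v
  0≤χ xs v = 0≤∑ xs (0≤δ v)

  ∈-χ : ∀ xs v → 0ℤ < χ xs v → v ∈ xs
  ∈-χ [] v (+<+ ())
  ∈-χ (x ∷ xs) v p with v ≟ᶠ x
  ... | yes refl = here refl
  ... | no _     = there (∈-χ xs v (subst (0ℤ <_) (+-identityˡ _) p))

  trisect : ∀ x y z → 0ℤ ≤ x → 0ℤ ≤ y → 0ℤ ≤ z → x + (y + z) ≡ 1ℤ →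
    Σ (Fin 3) λ c → x ≡ 𝟙 ⌊ c ≟ᶠ 0F ⌋ × y ≡ 𝟙 ⌊ c ≟ᶠ 1F ⌋ × z ≡ 𝟙 ⌊ c ≟ᶠ 2F ⌋
  trisect (+ 1) (+ 0) (+ 0) _ _ _ _ = 0F , refl , refl , refl
  trisect (+ 0) (+ 1) (+ 0) _ _ _ _ = 1F , refl , refl , refl
  trisect (+ 0) (+ 0) (+ 1) _ _ _ _ = 2F , refl , refl , refl
  trisect (+ 0) (+ 0) (+ 0) _ _ _ ()
  trisect (+ 0) (+ 0) (+ suc (suc c)) _ _ _ ()
  trisect (+ 0) (+ 1) (+ suc c) _ _ _ ()
  trisect (+ 0) (+ suc (suc b)) (+ c) _ _ _ ()
  trisect (+ 1) (+ 0) (+ suc c) _ _ _ ()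
  trisect (+ 1) (+ suc b) (+ c) _ _ _ ()
  trisect (+ suc (suc a)) (+ b) (+ c) _ _ _ ()

  cost : Partition3 n → ℕ
  cost = internalEdges G

  same-colour : ∀ (c d : Fin 3) → 𝟙 ⌊ c ≟ᶠ d ⌋ ≡ 𝟙 ⌊ c ≟ᶠ 0F ⌋ * 𝟙 ⌊ d ≟ᶠ 0F ⌋ + 𝟙 ⌊ c ≟ᶠ 1F ⌋ * 𝟙 ⌊ d ≟ᶠ 1F ⌋ + 𝟙 ⌊ c ≟ᶠ 2F ⌋ * 𝟙 ⌊ d ≟ᶠ 2F ⌋
  same-colour 0F 0F = refl
  same-colour 0F 1F = refl
  same-colour 0F 2F = refl
  same-colour 1F 0F = refl
  same-colour 1F 1F = refl
  same-colour 1F 2F = refl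
  same-colour 2F 0F = refl
  same-colour 2F 1F = refl
  same-colour 2F 2F = refl

  -- For an adjacent pair exactly one of i < j and j < i holds, as `irref` excludes i = j. So the
  -- one-sided count in `inside` becomes half of a symmetric double sum, the form in which `Q` is
  -- defined.
  inside-sym : ∀ p i j → + inside G p i j + + inside G p j i ≡ A i j * 𝟙 ⌊ p i ≟ᶠ p j ⌋
  inside-sym p i j with adj G i j in e | adj G j i in e′
  ... | false | false = refl
  ... | true  | false = ⊥-elim (clash (trans (sym e) (trans (Graph.sym G i j) e′)))
    where
    clash : ¬ (true ≡ false)
    clash ()
  ... | false | true  = ⊥-elim (clash (trans (sym e′) (trans (Graph.sym G j i) e)))
    where
    clash : ¬ (true ≡ false)
    clash ()
  ... | true  | true with ℕₚ.<-cmp (toℕ i) (toℕ j)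
  ...   | tri< i<j _ _ rewrite <⇒<ᵇ≡ i<j | ≤⇒≮ᵇ (ℕₚ.<⇒≤ i<j) = one ⌊ p i ≟ᶠ p j ⌋
    where
    one : ∀ b → + (if b then 1 else 0) + 0ℤ ≡ 1ℤ * 𝟙 b
    one true  = refl
    one false = refl
  ...   | tri> _ _ j<i rewrite <⇒<ᵇ≡ j<i | ≤⇒≮ᵇ (ℕₚ.<⇒≤ j<i) = one (p j) (p i)
    where
    one : ∀ (c d : Fin 3) → 0ℤ + + (if ⌊ c ≟ᶠ d ⌋ then 1 else 0) ≡ 1ℤ * 𝟙 ⌊ d ≟ᶠ c ⌋
    one c d with c ≟ᶠ d | d ≟ᶠ c
    ... | yes _ | yes _ = refl
    ... | no _  | no _  = refl
    ... | yes q | no ¬q = ⊥-elim (¬q (sym q))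
    ... | no ¬q | yes q = ⊥-elim (¬q (sym q))
  ...   | tri≈ _ i≡j _ with Finₚ.toℕ-injective i≡j
  ...     | refl = ⊥-elim (clash (trans (sym e) (irref G i)))
    where
    clash : ¬ (true ≡ false)
    clash ()

  2cost : ∀ p → + 2 * + cost p ≡ ∑ all (λ i → ∑ all (λ j → A i j * 𝟙 ⌊ p i ≟ᶠ p j ⌋))
  2cost p = trans (l (+ cost p)) (trans (cong₂ _+_ expand (trans expand (∑-swap all all (λ i j → + inside G p i j))))
      (trans (sym (∑-+ all _ _)) (∑-cong all λ i → trans (sym (∑-+ all _ _)) (∑-cong all λ j → inside-sym p i j))))
    where
    l : ∀ x → + 2 * x ≡ x + x
    l = solve-∀
    expand : + cost p ≡ ∑ all (λ i → ∑ all (λ j → + inside G p i j))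
    expand = trans (+-sum (λ i → sum (map (inside G p i) all)) all) (∑-cong all λ i → +-sum (inside G p i) all)

  module FromLists (m : ℕ) (X Y Z : List (Fin n)) (all≋ : all ≋ X ++ (Y ++ Z)) (lX : length X ≡ m) (lY : length Y ≡ m) (lZ : length Z ≡ m) where

    colour : ∀ v → Σ (Fin 3) λ c → χ X v ≡ 𝟙 ⌊ c ≟ᶠ 0F ⌋ × χ Y v ≡ 𝟙 ⌊ c ≟ᶠ 1F ⌋ × χ Z v ≡ 𝟙 ⌊ c ≟ᶠ 2F ⌋
    colour v = trisect (χ X v) (χ Y v) (χ Z v) (0≤χ X v) (0≤χ Y v) (0≤χ Z v)
      (trans (sym (trans (∑-++ X (Y ++ Z) (δ v)) (cong (_+_ (χ X v)) (∑-++ Y Z (δ v))))) (trans (sym (∑≡ all≋ (δ v))) (χ-all v)))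

    p : Partition3 n
    p v = proj₁ (colour v)

    class : Fin 3 → List (Fin n)
    class 0F = X
    class 1F = Y
    class 2F = Z

    χ-class : ∀ c v → χ (class c) v ≡ 𝟙 ⌊ p v ≟ᶠ c ⌋
    χ-class 0F v = proj₁ (proj₂ (colour v))
    χ-class 1F v = proj₁ (proj₂ (proj₂ (colour v)))
    χ-class 2F v = proj₂ (proj₂ (proj₂ (colour v)))

    l-class : ∀ c → length (class c) ≡ m
    l-class 0F = lX
    l-class 1F = lY
    l-class 2F = lZ

    size : ∀ c → classSize p c ≡ m
    size c = trans (+-injective (trans (#-filter (λ v → ⌊ p v ≟ᶠ c ⌋) all) (trans (∑-cong all λ v → trans (sym (χ-class c v)) (sym (*-identityʳ (χ (class c) v))))
      (trans (sym (∑-χ (class c) (λ _ → 1ℤ))) (trans (∑-const (class c) 1ℤ) (*-identityʳ (# (class c)))))))) (l-class c)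

    balanced : Balanced p
    balanced c d = trans (size c) (sym (size d))

    Q-class : ∀ c → Q (class c) ≡ ∑ all (λ i → ∑ all (λ j → A i j * (𝟙 ⌊ p i ≟ᶠ c ⌋ * 𝟙 ⌊ p j ≟ᶠ c ⌋)))
    Q-class c = trans (∑-χ (class c) (deg (class c))) (∑-cong all λ i → trans (cong (χ (class c) i *_) (∑-χ (class c) (A i)))
      (trans (sym (∑-* all (χ (class c) i) _)) (∑-cong all λ j → go (χ-class c i) (χ-class c j))))
      where
      l : ∀ x y a → x * (y * a) ≡ a * (x * y)
      l = solve-∀
      go : ∀ {x y a x′ y′} → x ≡ x′ → y ≡ y′ → x * (y * a) ≡ a * (x′ * y′)
      go {x} {y} {a} refl refl = l x y a

    2cost≡ : + 2 * + cost p ≡ Q X + Q Y + Q Z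
    2cost≡ = trans (2cost p) (trans (∑-cong all λ i → trans (∑-cong all λ j → trans (cong (A i j *_) (same-colour (p i) (p j))) (distrib (A i j) _ _ _))
        (trans (∑-+ all _ _) (cong (_+ ∑ all (λ j → A i j * (𝟙 ⌊ p i ≟ᶠ 2F ⌋ * 𝟙 ⌊ p j ≟ᶠ 2F ⌋))) (∑-+ all _ _))))
      (trans (∑-+ all _ _) (trans (cong (_+ ∑ all (λ i → ∑ all (λ j → A i j * (𝟙 ⌊ p i ≟ᶠ 2F ⌋ * 𝟙 ⌊ p j ≟ᶠ 2F ⌋)))) (∑-+ all _ _))
        (sym (cong₂ _+_ (cong₂ _+_ (Q-class 0F) (Q-class 1F)) (Q-class 2F))))))
      where
      distrib : ∀ a x y z → a * (x + y + z) ≡ a * x + a * y + a * z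
      distrib = solve-∀

  inside-cong : ∀ {p q : Partition3 n} → (∀ v → p v ≡ q v) → ∀ i j → inside G p i j ≡ inside G q i j
  inside-cong e i j = cong₂ (λ c d → if adj G i j ∧ (toℕ i ℕ.<ᵇ toℕ j) ∧ ⌊ c ≟ᶠ d ⌋ then 1 else 0) (e i) (e j)

  cost-cong : ∀ {p q : Partition3 n} → (∀ v → p v ≡ q v) → cost p ≡ cost q
  cost-cong e = cong sum (map-cong (λ i → cong sum (map-cong (λ j → inside-cong e i j) all)) all)

  balanced-cong : ∀ {p q : Partition3 n} → (∀ v → p v ≡ q v) → Balanced p → Balanced q
  balanced-cong {p} {q} e b c d = trans (sym (size c)) (trans (b c d) (size d))
    where
    size : ∀ c → classSize p c ≡ classSize q c
    size c = filterᵇ-cong (λ v → cong (λ x → ⌊ x ≟ᶠ c ⌋) (e v)) all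

  balanced? : ∀ (p : Partition3 n) → Dec (Balanced p)
  balanced? p = Finₚ.all? λ c → Finₚ.all? λ d → classSize p c ℕₚ.≟ classSize p d

  cheapest : ∀ (ps : List (Partition3 n)) →
    (Σ (Partition3 n) λ p → Balanced p × (∀ q → q ∈ ps → Balanced q → cost p ℕ.≤ cost q)) ⊎ (∀ q → q ∈ ps → ¬ Balanced q)
  cheapest [] = inj₂ λ _ ()
  cheapest (p ∷ ps) with balanced? p | cheapest ps
  ... | no ¬b | inj₁ (r , br , min) = inj₁ (r , br , λ { q (here refl) bq → ⊥-elim (¬b bq) ; q (there q∈) bq → min q q∈ bq })
  ... | no ¬b | inj₂ none = inj₂ λ { q (here refl) bq → ¬b bq ; q (there q∈) bq → none q q∈ bq }
  ... | yes b | inj₂ none = inj₁ (p , b , λ { q (here refl) bq → ℕₚ.≤-refl ; q (there q∈) bq → ⊥-elim (none q q∈ bq) })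
  ... | yes b | inj₁ (r , br , min) with ℕₚ.≤-total (cost p) (cost r)
  ...   | inj₁ p≤r = inj₁ (p , b , λ { q (here refl) bq → ℕₚ.≤-refl ; q (there q∈) bq → ℕₚ.≤-trans p≤r (min q q∈ bq) })
  ...   | inj₂ r≤p = inj₁ (r , br , λ { q (here refl) bq → r≤p ; q (there q∈) bq → min q q∈ bq })

_▸_ : ∀ {n} → Fin 3 → Partition3 n → Partition3 (suc n)
(c ▸ p) zero    = c
(c ▸ p) (suc v) = p v

partitions : ∀ n → List (Partition3 n)
partitions zero    = (λ ()) ∷ []
partitions (suc n) = cartesianProductWith _▸_ (allFin 3) (partitions n)

-- The agreement is pointwise; `cost-cong` and `balanced-cong` carry cost and balance over from the
-- listed partition.
partitions-complete : ∀ n (p : Partition3 n) → Σ (Partition3 n) λ q → q ∈ partitions n × (∀ v → p v ≡ q v)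
partitions-complete zero    p = (λ ()) , here refl , λ ()
partitions-complete (suc n) p with partitions-complete n (λ v → p (suc v))
... | q , q∈ , e = p zero ▸ q , ∈-cartesianProductWith⁺ _▸_ (∈-allFin (p zero)) q∈ , λ { zero → refl ; (suc v) → e v }

KBip-adj : ∀ n a (i j : Fin n) {b c d} → (toℕ i ℕ.<ᵇ a) ≡ b → (toℕ j ℕ.<ᵇ a) ≡ c →
  (b ≡ c → d ≡ false) → (b ≡ not c → d ≡ true) → d ≡ adj (KBip n a) i j
KBip-adj n a i j {true}  {true}  e e′ h h′ rewrite e | e′ = h refl
KBip-adj n a i j {true}  {false} e e′ h h′ rewrite e | e′ = h′ refl
KBip-adj n a i j {false} {true}  e e′ h h′ rewrite e | e′ = h′ refl
KBip-adj n a i j {false} {false} e e′ h h′ rewrite e | e′ = h refl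

-- From lists of vertices to balanced partitions and isomorphism

module _ (m : ℕ) (1≤m : 1 ℕ.≤ m) (G : Graph (3 ℕ.* m)) (tf : TriangleFree G) where

  n : ℕ
  n = 3 ℕ.* m

  open TriangleFreeGraph (adj G) (Graph.sym G) (irref G) tf

  len : length (allFin n) ≡ m ℕ.+ (m ℕ.+ m)
  len = trans (length-tabulate {n = n} (λ v → v)) (cong (λ k → m ℕ.+ (m ℕ.+ k)) (ℕₚ.+-identityʳ m))

  X₀ R₀ Y₀ Z₀ : List (Fin n)
  X₀ = take m (allFin n)
  R₀ = drop m (allFin n)
  Y₀ = take m R₀
  Z₀ = drop m R₀

  lR₀ : length R₀ ≡ m ℕ.+ m
  lR₀ = trans (length-drop m (allFin n)) (trans (cong (ℕ._∸ m) len) (ℕₚ.m+n∸m≡n m (m ℕ.+ m)))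

  -- Cutting the list of all vertices into thirds shows that a balanced partition exists, so that
  -- the minimum is taken over a nonempty set.
  module Initial = FromLists G tf m X₀ Y₀ Z₀ (≋-trans (take-drop-≋ m (allFin n)) (≋-++ (≋-refl {xs = X₀}) (take-drop-≋ m R₀)))
    (trans (length-take m (allFin n)) (ℕₚ.m≤n⇒m⊓n≡m (subst (m ℕ.≤_) (sym len) (ℕₚ.m≤m+n m _))))
    (trans (length-take m R₀) (ℕₚ.m≤n⇒m⊓n≡m (subst (m ℕ.≤_) (sym lR₀) (ℕₚ.m≤m+n m m))))
    (trans (length-drop m R₀) (trans (cong (ℕ._∸ m) lR₀) (ℕₚ.m+n∸m≡n m m)))

  minimum : Σ (Partition3 n) λ p → Balanced p × (∀ q → Balanced q → internalEdges G p ℕ.≤ internalEdges G q)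
  minimum with cheapest G tf (partitions n)
  ... | inj₁ (p , b , min) = p , b , λ q bq → via q bq (partitions-complete n q)
    where
    via : ∀ q → Balanced q → Σ (Partition3 n) (λ r → r ∈ partitions n × (∀ v → q v ≡ r v)) → internalEdges G p ℕ.≤ internalEdges G q
    via q bq (r , r∈ , e) = subst (internalEdges G p ℕ.≤_) (sym (cost-cong G tf e)) (min r r∈ (balanced-cong G tf e bq))
  ... | inj₂ none with partitions-complete n Initial.p
  ...   | r , r∈ , e = ⊥-elim (none r r∈ (balanced-cong G tf e Initial.balanced))

  module Bound (d : ℕ) (d≤ : ∀ q → Balanced q → d ℕ.≤ internalEdges G q) where

    D : ℤ
    D = + 2 * + d

    D≤ : ∀ X Y Z → allFin n ≋ X ++ (Y ++ Z) → length X ≡ m → length Y ≡ m → length Z ≡ m → D ≤ Q X + Q Y + Q Z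
    D≤ X Y Z all≋ lX lY lZ = subst (D ≤_) L.2cost≡ (*-mono-0≤ (0≤+ℕ 2) (+≤+ (d≤ L.p L.balanced)))
      where module L = FromLists G tf m X Y Z all≋ lX lY lZ

    module Dense = BalancedPartitions.DenseThirds (adj G) (Graph.sym G) (irref G) tf m 1≤m (allFin n) len ∈-allFin D D≤
    open Dense using (Extremal; Empty; Full)

    module _ (x : Extremal) where
      open Extremal x

      left : Fin n → Bool
      left v = ⌊ 0ℤ <? χ G tf U v ⌋

      left-true : ∀ v → left v ≡ true → v ∈ U
      left-true v e with 0ℤ <? χ G tf U v
      ... | yes p = ∈-χ G tf U v p

      left-false : ∀ v → left v ≡ false → v ∈ W
      left-false v e with 0ℤ <? χ G tf U v
      ... | no ¬p = ∈-χ G tf W v (subst (0ℤ <_) (sym χW) (+<+ (ℕ.s≤s ℕ.z≤n)))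
        where
        χW : χ G tf W v ≡ 1ℤ
        χW = trans (sym (+-identityˡ _)) (trans (cong (_+ χ G tf W v) (sym (≤-antisym (≮⇒≥ ¬p) (0≤χ G tf U v))))
          (trans (sym (∑-++ U W (δ G tf v))) (trans (sym (∑≡ all≋ (δ G tf v))) (χ-all G tf v))))

      χ≤1 : ∀ v → χ G tf U v ≤ 1ℤ
      χ≤1 v = ≤-slack (χ G tf W v) (0≤χ G tf W v) (trans (cong (_- χ G tf U v) (trans (sym (χ-all G tf v)) (trans (∑≡ all≋ (δ G tf v)) (∑-++ U W (δ G tf v))))) (l (χ G tf U v) (χ G tf W v)))
        where
        l : ∀ a b → a + b - a ≡ b
        l = solve-∀

      χ-left : ∀ v → χ G tf U v ≡ 𝟙 (left v)
      χ-left v with 0ℤ <? χ G tf U v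
      ... | yes p = ≤-antisym (χ≤1 v) (0<⇒1≤ p)
      ... | no ¬p = ≤-antisym (≮⇒≥ ¬p) (0≤χ G tf U v)

      count-left : count n left ≡ length U
      count-left = trans (sym (count-filter n (λ v → v) left)) (+-injective (trans (#-filter left (allFin n))
        (trans (∑-cong (allFin n) λ v → trans (sym (χ-left v)) (sym (*-identityʳ (χ G tf U v)))) (trans (sym (∑-χ G tf U (λ _ → 1ℤ))) (trans (∑-const U 1ℤ) (*-identityʳ (# U)))))))

      isomorphic : G ≅ KBip n (length U)
      isomorphic = proj₁ σ , λ i j → KBip-adj n (length U) (proj₁ σ ⟨$⟩ʳ i) (proj₁ σ ⟨$⟩ʳ j) (position i) (position j) (same i j) (different i j)
        where
        σ : Σ (Permutation n n) λ σ → ∀ i → (toℕ (σ ⟨$⟩ʳ i) ℕ.<ᵇ count n left) ≡ left i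
        σ = sort n left
        position : ∀ i → (toℕ (proj₁ σ ⟨$⟩ʳ i) ℕ.<ᵇ length U) ≡ left i
        position i = subst (λ a → (toℕ (proj₁ σ ⟨$⟩ʳ i) ℕ.<ᵇ a) ≡ left i) count-left (proj₂ σ i)
        same : ∀ i j → left i ≡ left j → adj G i j ≡ false
        same i j e = go (left i) (left j) refl refl e
          where
          go : ∀ b c → left i ≡ b → left j ≡ c → b ≡ c → adj G i j ≡ false
          go true  true  p q _ = U-empty (left-true i p) (left-true j q)
          go false false p q _ = W-empty (left-false i p) (left-false j q)
        different : ∀ i j → left i ≡ not (left j) → adj G i j ≡ true
        different i j e = go (left i) (left j) refl refl e
          where
          go : ∀ b c → left i ≡ b → left j ≡ c → b ≡ not c → adj G i j ≡ true
          go true  false p q _ = UW-full (left-true i p) (left-false j q)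
          go false true  p q _ = trans (Graph.sym G i j) (UW-full (left-true j q) (left-false i p))

      structure : (Σ ℕ λ a → 6 ℕ.* a ≡ 5 ℕ.* (3 ℕ.* m) × G ≅ KBip (3 ℕ.* m) a) ⊎ (Σ ℕ λ a → 2 ℕ.* a ≡ 3 ℕ.* m × G ≅ KBip (3 ℕ.* m) a)
      structure with sizes
      ... | inj₁ e = inj₁ (length U , e , isomorphic)
      ... | inj₂ e = inj₂ (length U , e , isomorphic)

    scaled : ∀ x → + (36 ℕ.* x) ≡ + 9 * (+ 2 * (+ 2 * + x))
    scaled x = trans (pos-* 36 x) (l (+ x))
      where
      l : ∀ x → + 36 * x ≡ + 9 * (+ 2 * (+ 2 * x))
      l = solve-∀

    square : + ((3 ℕ.* m) ℕ.* (3 ℕ.* m)) ≡ + 9 * (+ m * + m)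
    square = trans (pos-* (3 ℕ.* m) (3 ℕ.* m)) (trans (cong (λ z → z * z) (pos-* 3 m)) (l (+ m)))
      where
      l : ∀ m → (+ 3 * m) * (+ 3 * m) ≡ + 9 * (m * m)
      l = solve-∀

    conclusion : 36 ℕ.* d ℕ.≤ (3 ℕ.* m) ℕ.* (3 ℕ.* m) × (36 ℕ.* d ≡ (3 ℕ.* m) ℕ.* (3 ℕ.* m) →
      (Σ ℕ λ a → 6 ℕ.* a ≡ 5 ℕ.* (3 ℕ.* m) × G ≅ KBip (3 ℕ.* m) a) ⊎ (Σ ℕ λ a → 2 ℕ.* a ≡ 3 ℕ.* m × G ≅ KBip (3 ℕ.* m) a))
    conclusion = conclude Dense.bound
      where
      below : + 2 * D ≤ + m * + m → 36 ℕ.* d ℕ.≤ (3 ℕ.* m) ℕ.* (3 ℕ.* m)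
      below h = drop‿+≤+ (subst₂ _≤_ (sym (scaled d)) (sym square) (*-mono-0≤ (0≤+ℕ 9) h))
      tight : 36 ℕ.* d ≡ (3 ℕ.* m) ℕ.* (3 ℕ.* m) → + 2 * D ≡ + m * + m
      tight e = ≤-antisym (*-cancel-0< {+ 9} (+<+ (ℕ.s≤s ℕ.z≤n)) (≤-reflexive e′)) (*-cancel-0< {+ 9} (+<+ (ℕ.s≤s ℕ.z≤n)) (≤-reflexive (sym e′)))
        where
        e′ : + 9 * (+ 2 * D) ≡ + 9 * (+ m * + m)
        e′ = trans (sym (scaled d)) (trans (cong +_ e) square)
      conclude : (+ 2 * D < + m * + m) ⊎ (+ 2 * D ≤ + m * + m × (+ 2 * D ≡ + m * + m → Extremal)) →
        36 ℕ.* d ℕ.≤ (3 ℕ.* m) ℕ.* (3 ℕ.* m) × (36 ℕ.* d ≡ (3 ℕ.* m) ℕ.* (3 ℕ.* m) →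
          (Σ ℕ λ a → 6 ℕ.* a ≡ 5 ℕ.* (3 ℕ.* m) × G ≅ KBip (3 ℕ.* m) a) ⊎ (Σ ℕ λ a → 2 ℕ.* a ≡ 3 ℕ.* m × G ≅ KBip (3 ℕ.* m) a))
      conclude (inj₁ lt)         = below (<⇒≤ lt) , λ e → ⊥-elim (<-irrefl (tight e) lt)
      conclude (inj₂ (le , ext)) = below le , λ e → structure (ext (tight e))

theorem1p6 : Σ ℕ λ n₀ → ∀ (m : ℕ) → n₀ ℕ.≤ 3 ℕ.* m → (G : Graph (3 ℕ.* m)) → TriangleFree G →
    Σ ℕ λ d → IsD3b G d × 36 ℕ.* d ℕ.≤ (3 ℕ.* m) ℕ.* (3 ℕ.* m)
      × (36 ℕ.* d ≡ (3 ℕ.* m) ℕ.* (3 ℕ.* m) →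
          (Σ ℕ λ a → 6 ℕ.* a ≡ 5 ℕ.* (3 ℕ.* m) × G ≅ KBip (3 ℕ.* m) a)
          ⊎ (Σ ℕ λ a → 2 ℕ.* a ≡ 3 ℕ.* m × G ≅ KBip (3 ℕ.* m) a))
-- The value 1 of n₀ rules out m = 0, for which 1 ≤ 3 · 0 is absurd; hence only successors are
-- matched.
theorem1p6 = 1 , λ { (suc m) _ G tf → assemble m G tf (minimum (suc m) (ℕ.s≤s ℕ.z≤n) G tf) }
  where
  assemble : ∀ m (G : Graph (3 ℕ.* suc m)) → TriangleFree G →
    (Σ (Partition3 (3 ℕ.* suc m)) λ p → Balanced p × (∀ q → Balanced q → internalEdges G p ℕ.≤ internalEdges G q)) → _
  assemble m G tf (p , b , min) = internalEdges G p , ((p , b , refl) , min) , Bound.conclusion (suc m) (ℕ.s≤s ℕ.z≤n) G tf (internalEdges G p) min
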